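{- For every integer $n\ge 4$ and every graph $G$ on $n$ vertices, $\mathcal{CC}_4(G)\le \mathcal{CC}_4(T(n,4))$, with equality if and only if $G$ is isomorphic to $T(n,4)$.
   Context: For $n\ge t$, the Turán graph $T(n,t)$ is the $n$-vertex complete $t$-partite graph whose part sizes differ by at most one. A $t$-clique cover of a graph $G$ is a collection of cliques of $G$ such that every $t$-clique ($K_t$ subgraph) of $G$ is a subgraph of some clique in the collection. The $t$-clique cover number $\mathcal{CC}_t(G)$ is the minimum number of cliques in a $t$-clique cover of $G$. -}

module Defs where

open import Data.Nat using (ℕ; _≤_; _%_)
open import Data.Bool using (Bool; true; false; T)
open import Data.Fin using (Fin; toℕ)
open import Data.Fin.Subset using (Subset; _∈_)
open import Data.List using (List; length)
open import Data.List.Relation.Unary.All using (All)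
open import Data.List.Relation.Unary.Any using (Any)
open import Data.Product using (Σ; _×_)
open import Function.Bundles using (_↔_; Inverse)
open import Relation.Binary.PropositionalEquality using (_≡_; _≢_; refl; cong) renaming (sym to ≡-sym)
open import Relation.Nullary using (yes; no)
open import Data.Empty using (⊥-elim)
open import Relation.Nullary using (¬_)
open import Data.Nat using (_≟_)
open import Relation.Nullary.Decidable using (⌊_⌋)
open import Data.Bool using (not)

record Graph (n : ℕ) : Set where
  field
    Adj    : Fin n → Fin n → Bool
    sym    : ∀ u v → Adj u v ≡ Adj v u
    irrefl : ∀ v → Adj v v ≡ false
open Graph public

_∼[_]_ : ∀ {n} → Fin n → Graph n → Fin n → Set
u ∼[ G ] v = T (Adj G u v)

IsClique : ∀ {n} → Graph n → Subset n → Set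
IsClique G C = ∀ u v → u ∈ C → v ∈ C → u ≢ v → u ∼[ G ] v

-- A t-clique (K_t subgraph) of G: t distinct, pairwise adjacent vertices,
-- given as an injective labelling Fin t → Fin n.
IsKClique : ∀ {n} → (t : ℕ) → Graph n → (Fin t → Fin n) → Set
IsKClique t G f = ∀ i j → i ≢ j → f i ∼[ G ] f j

_⊆K_ : ∀ {n t} → (Fin t → Fin n) → Subset n → Set
f ⊆K C = ∀ i → f i ∈ C

IsCliqueCover : ∀ {n} → ℕ → Graph n → List (Subset n) → Set
IsCliqueCover t G 𝒞 =
  All (IsClique G) 𝒞 ×
  (∀ (f : Fin t → Fin _) → IsKClique t G f → Any (f ⊆K_) 𝒞)

IsCCNumber : ∀ {n} → ℕ → Graph n → ℕ → Set
IsCCNumber t G m =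
  Σ (List (Subset _)) (λ 𝒞 → IsCliqueCover t G 𝒞 × length 𝒞 ≡ m) ×
  (∀ 𝒞 → IsCliqueCover t G 𝒞 → m ≤ length 𝒞)

-- Turán graph T(n,t) for t ≥ 1: vertex i lies in part (i mod t); vertices
-- are adjacent iff they lie in different parts.  Parts are residue classes,
-- so their sizes differ by at most one.
turánAdj : ∀ {n} (t : ℕ) → .{{_ : Data.Nat.NonZero t}} → Fin n → Fin n → Bool
turánAdj t u v = not ⌊ (toℕ u % t) ≟ (toℕ v % t) ⌋

private
  ≟-sym : (a b : ℕ) → ⌊ a ≟ b ⌋ ≡ ⌊ b ≟ a ⌋
  ≟-sym a b with a ≟ b | b ≟ a
  ... | yes _ | yes _ = refl
  ... | no _  | no _  = refl
  ... | yes p | no q  = ⊥-elim (q (≡-sym p))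
  ... | no p  | yes q = ⊥-elim (p (≡-sym q))

  ≟-refl : (a : ℕ) → ⌊ a ≟ a ⌋ ≡ true
  ≟-refl a with a ≟ a
  ... | yes _ = refl
  ... | no p  = ⊥-elim (p refl)

turán : (n t : ℕ) → .{{_ : Data.Nat.NonZero t}} → Graph n
turán n t = record
  { Adj    = turánAdj t
  ; sym    = λ u v → cong not (≟-sym (toℕ u % t) (toℕ v % t))
  ; irrefl = λ v → cong not (≟-refl (toℕ v % t))
  }

_≅_ : ∀ {n} → Graph n → Graph n → Set
G ≅ H = Σ (Fin _ ↔ Fin _) λ φ →
  ∀ u v → Adj G u v ≡ Adj H (Inverse.to φ u) (Inverse.to φ v)

-- Induction on the vertex set, removing a maximum clique K of size r; write R for the other m vertices.
-- The 4-cliques meeting K are covered by K and by the cliques S ∪ (N(S) ∩ K), where S is a vertex, an edge or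
-- a triangle of R, so CC₄(G) ≤ CC₄(R) + 1 + m + k₂(R) + k₃(R). Since R has no clique with more than r vertices,
-- Turán-type bounds on k₂ and k₃ (proved by the same induction) finish the step unless r = 5: the increment
-- is at most that of T(n,4) if r = 4, and strictly less if r ≥ 6.
-- If r = 5 then k₃(R) can be slightly too large, when R is close to T(m,5), and the triangles have to be covered
-- more cheaply. For a K₅ X in R the five cliques v + (X ∩ N(v)), v ∈ K, replace the ten cliques coming from the
-- triangles of X. As two adjacent vertices have at most three common neighbours in X, a greedily chosen
-- triangle-disjoint family of such X is large in terms of the number of K₅ in R, which the Moon–Moser
-- inequalities bound from below in terms of k₃(R).
-- Equality forces r = 4 and every vertex of R to miss exactly one vertex of K, so that an enumeration of R
-- which is round-robin over the parts of T(m,4) can be extended by K in a suitable order.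
module Submission where

open import Defs hiding (sym)
open import Data.Bool using (Bool; true; false; T; _∧_; not)
open import Data.Bool.ListAction using (all)
open import Data.Bool.Properties using (T?; T-∧; T-≡; ∧-comm)
open import Data.Fin using (Fin; zero; suc; toℕ; cast)
open import Data.Fin.Properties using (toℕ<n; toℕ-injective; toℕ-cast; cast-is-id; cast-trans; all?) renaming (_≟_ to _≟ᵥ_)
open import Data.Fin.Subset using (Subset) renaming (_∈_ to _∈ₛ_)
open import Data.Fin.Subset.Properties using (anySubset?) renaming (_∈?_ to _∈ₛ?_)
open import Data.List using (List; []; _∷_; _++_; length; filter; map; take; lookup; allFin; tabulate)
open import Data.List.Membership.Propositional using (_∈_)
open import Data.List.Membership.Propositional.Properties using (∈-∃++; ∈-filter⁻; ∈-filter⁺; ∈-++⁺ˡ; ∈-++⁺ʳ; ∈-++⁻; ∈-map⁺; ∈-allFin; ∈-lookup)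
open import Data.List.Properties using (length-++; length-take; length-map; length-filter; filter-notAll; length-tabulate; ++-assoc)
open import Data.List.Relation.Binary.Permutation.Propositional using (_↭_; ↭-refl; ↭-sym; ↭-trans; prep; swap; ↭⇒↭ₛ)
import Data.List.Relation.Binary.Permutation.Propositional as Perm
open import Data.List.Relation.Binary.Permutation.Propositional.Properties using (∈-resp-↭; shift; ++⁺; ++⁺ʳ; ↭-length; All-resp-↭)
import Data.List.Relation.Binary.Permutation.Setoid.Properties as PermSetoid
open import Data.List.Relation.Unary.All as All using (All; []; _∷_)
import Data.List.Relation.Unary.All.Properties as All
open import Data.List.Relation.Unary.AllPairs as AllPairs using (AllPairs; []; _∷_)
import Data.List.Relation.Unary.AllPairs.Properties as AllPairs
open import Data.List.Relation.Unary.Any as Any using (Any; here; there; any?; index)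
import Data.List.Relation.Unary.Any.Properties as Any
open import Data.List.Relation.Unary.Unique.Propositional using (Unique)
open import Data.List.Relation.Unary.Unique.Propositional.Properties using (allFin⁺)
open import Data.Nat
open import Data.Nat.DivMod using (m<n⇒m%n≡m; m%n<n)
open import Data.Nat.Properties
open import Data.Nat.Tactic.RingSolver using (solve-∀)
open import Data.Product using (_×_; _,_; Σ; ∃; ∃₂; proj₁; proj₂)
open import Data.Sum using (_⊎_; inj₁; inj₂)
open import Data.Unit using (tt)
import Data.Vec as Vec
open import Data.Vec.Properties using (lookup∘tabulate; []=⇒lookup; lookup⇒[]=)
open import Function using (_∘_; id; Equivalence; _⇔_; mk⇔; mk↔ₛ′; Inverse)
open import Function.Construct.Identity using (↔-id)
open import Relation.Binary.PropositionalEquality using (_≡_; _≢_; refl; sym; trans; cong; cong₂; subst; subst₂; setoid; module ≡-Reasoning)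
open import Relation.Nullary using (yes; no; ¬_; contradiction; ⌊_⌋; Dec; ¬?; map′)
open import Relation.Nullary.Decidable using (toWitness; fromWitness; _×-dec_; _→-dec_)

-- The quantity to stay below is `turán₄ n`, the product of the part sizes of T(n,4): it counts the
-- transversals, which are 4-cliques no two of which lie in a common clique. From m to m + r
-- vertices it grows by about (r/64) m³, whereas a graph on m vertices without r + 1 pairwise
-- adjacent vertices can have about ((r-1)(r-2)/(6r²)) m³ triangles. The two coefficients coincide
-- at r = 4, compare as 0.078125 against 0.08 at r = 5, and are in the right order for every r ≥ 6
-- (0.09375 against 0.0926 at r = 6). Hence r = 4 leaves no room and needs exact recursions that
-- T(m,4) satisfies with equality, density bounds are enough for r ≥ 6, and r = 5 requires saving
-- more than 2.3 percent of the triangles. In T(m,5) with parts of size q the packing of K₅ is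
-- guaranteed to save q³/2 of the 10q³ triangles, five percent, which is the origin of the bound
-- 19m³/250 = 0.076 m³. Cliques are counted as ordered tuples wherever possible, since nested sums
-- over a list can be split and permuted freely.

-- Finite sums over lists.

∑ : ∀ {A : Set} → List A → (A → ℕ) → ℕ
∑ []      f = 0
∑ (x ∷ l) f = f x + ∑ l f

∑-mono : ∀ {A : Set} (l : List A) {f g} → (∀ {x} → x ∈ l → f x ≤ g x) → ∑ l f ≤ ∑ l g
∑-mono []      h = z≤n
∑-mono (x ∷ l) h = +-mono-≤ (h (here refl)) (∑-mono l (h ∘ there))

∑-cong : ∀ {A : Set} (l : List A) {f g} → (∀ {x} → x ∈ l → f x ≡ g x) → ∑ l f ≡ ∑ l g
∑-cong []      h = refl
∑-cong (x ∷ l) h = cong₂ _+_ (h (here refl)) (∑-cong l (h ∘ there))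

∑-+ : ∀ {A : Set} (l : List A) f g → ∑ l (λ x → f x + g x) ≡ ∑ l f + ∑ l g
∑-+ []      f g = refl
∑-+ (x ∷ l) f g rewrite ∑-+ l f g = lem (f x) (g x) (∑ l f) (∑ l g)
  where lem : ∀ a b c d → a + b + (c + d) ≡ a + c + (b + d)
        lem = solve-∀

∑-*ˡ : ∀ {A : Set} (l : List A) c f → ∑ l (λ x → c * f x) ≡ c * ∑ l f
∑-*ˡ []      c f = sym (*-zeroʳ c)
∑-*ˡ (x ∷ l) c f rewrite ∑-*ˡ l c f = sym (*-distribˡ-+ c (f x) (∑ l f))

∑-*ʳ : ∀ {A : Set} (l : List A) c f → ∑ l (λ x → f x * c) ≡ ∑ l f * c
∑-*ʳ []      c f = refl
∑-*ʳ (x ∷ l) c f rewrite ∑-*ʳ l c f = sym (*-distribʳ-+ c (f x) (∑ l f))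

∑-const : ∀ {A : Set} (l : List A) c → ∑ l (λ _ → c) ≡ length l * c
∑-const []      c = refl
∑-const (x ∷ l) c = cong (c +_) (∑-const l c)

∑-zero : ∀ {A : Set} (l : List A) {f} → (∀ {x} → x ∈ l → f x ≡ 0) → ∑ l f ≡ 0
∑-zero l h = trans (∑-cong l h) (trans (∑-const l 0) (*-zeroʳ (length l)))

∑-≤-const : ∀ {A : Set} (l : List A) c {f} → (∀ {x} → x ∈ l → f x ≤ c) → ∑ l f ≤ length l * c
∑-≤-const l c h = ≤-trans (∑-mono l h) (≤-reflexive (∑-const l c))

∑-comm : ∀ {A B : Set} (l : List A) (k : List B) (f : A → B → ℕ) →
         ∑ l (λ x → ∑ k (λ y → f x y)) ≡ ∑ k (λ y → ∑ l (λ x → f x y))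
∑-comm []      k f = sym (∑-zero k (λ _ → refl))
∑-comm (x ∷ l) k f = trans (cong (∑ k (f x) +_) (∑-comm l k f)) (sym (∑-+ k (f x) _))

∑-++ : ∀ {A : Set} (l k : List A) f → ∑ (l ++ k) f ≡ ∑ l f + ∑ k f
∑-++ []      k f = refl
∑-++ (x ∷ l) k f = trans (cong (f x +_) (∑-++ l k f)) (sym (+-assoc (f x) _ _))

∑-map : ∀ {A B : Set} (h : A → B) (l : List A) f → ∑ (map h l) f ≡ ∑ l (f ∘ h)
∑-map h []      f = refl
∑-map h (x ∷ l) f = cong (f (h x) +_) (∑-map h l f)

∑-↭ : ∀ {A : Set} {l k : List A} → l ↭ k → ∀ f → ∑ l f ≡ ∑ k f
∑-↭ Perm.refl         f = refl
∑-↭ (Perm.prep x p)   f = cong (f x +_) (∑-↭ p f)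
∑-↭ (Perm.swap {xs} {ys} x y p) f rewrite ∑-↭ p f = lem (f x) (f y) (∑ ys f)
  where lem : ∀ a b c → a + (b + c) ≡ b + (a + c)
        lem = solve-∀
∑-↭ (Perm.trans p q)  f = trans (∑-↭ p f) (∑-↭ q f)

-- Indicators, sublists, and unordered pairs and triples.

⟦_⟧ : Bool → ℕ
⟦ true ⟧  = 1
⟦ false ⟧ = 0

⟦⟧≤1 : ∀ b → ⟦ b ⟧ ≤ 1
⟦⟧≤1 true  = ≤-refl
⟦⟧≤1 false = z≤n

⟦∧⟧ : ∀ a b → ⟦ a ∧ b ⟧ ≡ ⟦ a ⟧ * ⟦ b ⟧
⟦∧⟧ true  b = sym (+-identityʳ ⟦ b ⟧)
⟦∧⟧ false b = refl

sift : ∀ {A : Set} → (A → Bool) → List A → List A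
sift p = filter (T? ∘ p)

length-sift : ∀ {A : Set} (p : A → Bool) l → length (sift p l) ≡ ∑ l (⟦_⟧ ∘ p)
length-sift p []      = refl
length-sift p (x ∷ l) with p x
... | true  = cong suc (length-sift p l)
... | false = length-sift p l

∑-sift : ∀ {A : Set} (p : A → Bool) l f → ∑ (sift p l) f ≡ ∑ l (λ x → ⟦ p x ⟧ * f x)
∑-sift p []      f = refl
∑-sift p (x ∷ l) f with p x
... | true  = cong₂ _+_ (sym (+-identityʳ (f x))) (∑-sift p l f)
... | false = ∑-sift p l f

∈-tail : ∀ {A : Set} {x y : A} {l} → y ∈ x ∷ l → x ≢ y → y ∈ l
∈-tail h x≢y = Any.tail (x≢y ∘ sym) h

module _ {A : Set} where
  pairs : List A → List (A × A)
  pairs []      = []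
  pairs (x ∷ l) = map (x ,_) l ++ pairs l

  triples : List A → List (A × A × A)
  triples []      = []
  triples (x ∷ l) = map (x ,_) (pairs l) ++ triples l

  -- Bridge between ordered counts, which split well, and unordered ones, which are sizes of covers.
  -- The vanishing diagonal also takes care of repeated entries.
  ∑-pairs : ∀ (l : List A) (g : A → A → ℕ) → (∀ x y → g x y ≡ g y x) → (∀ x → g x x ≡ 0) →
            ∑ l (λ x → ∑ l (λ y → g x y)) ≡ 2 * ∑ (pairs l) (λ (x , y) → g x y)
  ∑-pairs []      g s i = refl
  ∑-pairs (a ∷ l) g s i = begin
    g a a + ∑ l (g a) + ∑ l (λ x → g x a + ∑ l (g x))
      ≡⟨ cong₂ (λ p q → p + ∑ l (g a) + q) (i a) (trans (∑-+ l _ _) (cong₂ _+_ (∑-cong l (λ _ → s _ a)) (∑-pairs l g s i))) ⟩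
    ∑ l (g a) + (∑ l (g a) + 2 * ∑ (pairs l) _)
      ≡⟨ lem (∑ l (g a)) _ ⟩
    2 * (∑ l (g a) + ∑ (pairs l) _)
      ≡⟨ cong (2 *_) (sym (trans (∑-++ (map (a ,_) l) (pairs l) _) (cong (_+ _) (∑-map (a ,_) l _)))) ⟩
    2 * ∑ (pairs (a ∷ l)) _ ∎
    where
      open ≡-Reasoning
      lem : ∀ a b → a + (a + 2 * b) ≡ 2 * (a + b)
      lem = solve-∀

  ∑-triples : ∀ (l : List A) (g : A → A → A → ℕ) → (∀ x y z → g x y z ≡ g y x z) → (∀ x y z → g x y z ≡ g x z y) →
              (∀ x z → g x x z ≡ 0) →
              ∑ l (λ x → ∑ l (λ y → ∑ l (λ z → g x y z))) ≡ 6 * ∑ (triples l) (λ (x , y , z) → g x y z)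
  ∑-triples []      g s t i = refl
  ∑-triples (a ∷ l) g s t i = begin
    (g a a a + ∑ l (g a a)) + ∑ l (λ y → g a y a + ∑ l (g a y)) + ∑ l (λ x → (g x a a + ∑ l (g x a)) + ∑ l (λ y → g x y a + ∑ l (g x y)))
      ≡⟨ cong₂ _+_ (cong₂ _+_ (cong₂ _+_ (i a a) (∑-zero l (λ _ → i a _)))
                              (∑-cong l λ {y} _ → cong (_+ ∑ l (g a y)) (trans (t a y a) (i a y))))
                   (trans (∑-cong l λ {x} _ → cong₂ _+_ (cong₂ _+_ (trans (s x a a) (trans (t a x a) (i a x))) (∑-cong l λ _ → s x a _))
                                             (trans (∑-+ l _ _) (cong (_+ ∑ l (λ y → ∑ l (g x y))) (∑-cong l λ {y} _ → trans (t x y a) (s x a y)))))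
                          (trans (∑-+ l _ _) (cong (∑ l (λ x → ∑ l (g a x)) +_) (∑-+ l _ _)))) ⟩
    S + (S + (S + ∑ l (λ x → ∑ l (λ y → ∑ l (g x y)))))
      ≡⟨ cong₂ (λ p q → p + (p + (p + q))) (∑-pairs l (g a) (t a) diag) (∑-triples l g s t i) ⟩
    2 * P + (2 * P + (2 * P + 6 * Q))
      ≡⟨ lem P Q ⟩
    6 * (P + Q)
      ≡⟨ cong (6 *_) (sym (trans (∑-++ (map (a ,_) (pairs l)) (triples l) _) (cong (_+ Q) (∑-map (a ,_) (pairs l) _)))) ⟩
    6 * ∑ (triples (a ∷ l)) _ ∎
    where
      open ≡-Reasoning
      S = ∑ l (λ x → ∑ l (g a x))
      P = ∑ (pairs l) (λ (y , z) → g a y z)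
      Q = ∑ (triples l) (λ (x , y , z) → g x y z)
      diag : ∀ x → g a x x ≡ 0
      diag x = trans (s a x x) (trans (t x a x) (i x a))
      lem : ∀ p q → 2 * p + (2 * p + (2 * p + 6 * q)) ≡ 6 * (p + q)
      lem = solve-∀

sift-split : ∀ {A : Set} (p : A → Bool) l → sift p l ++ sift (not ∘ p) l ↭ l
sift-split p []      = ↭-refl
sift-split p (x ∷ l) with p x
... | true  = prep x (sift-split p l)
... | false = ↭-trans (shift x (sift p l) (sift (not ∘ p) l)) (prep x (sift-split p l))

∈-sift⁻ : ∀ {A : Set} (p : A → Bool) {l x} → x ∈ sift p l → x ∈ l × T (p x)
∈-sift⁻ p = ∈-filter⁻ (T? ∘ p)

∈-sift⁺ : ∀ {A : Set} (p : A → Bool) {l x} → x ∈ l → T (p x) → x ∈ sift p l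
∈-sift⁺ p = ∈-filter⁺ (T? ∘ p)

module _ {A : Set} where
  -- Each pair is listed in one order only, so the result is some arrangement on which the symmetric
  -- P still holds; letting P carry a permutation recovers the original pair.
  pairs-complete : (P : A → A → Set) → (∀ {x y} → P x y → P y x) → (∀ {x} → ¬ P x x) →
    ∀ {l x y} → x ∈ l → y ∈ l → P x y → ∃₂ λ a b → (a , b) ∈ pairs l × P a b
  pairs-complete P s i (here refl) (here refl) p = contradiction p i
  pairs-complete P s i {a ∷ l} (here refl) (there y∈) p = _ , _ , ∈-++⁺ˡ (∈-map⁺ (a ,_) y∈) , p
  pairs-complete P s i {a ∷ l} (there x∈) (here refl) p = _ , _ , ∈-++⁺ˡ (∈-map⁺ (a ,_) x∈) , s p
  pairs-complete P s i {a ∷ l} (there x∈) (there y∈) p =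
    let _ , _ , h , q = pairs-complete P s i x∈ y∈ p in _ , _ , ∈-++⁺ʳ (map (a ,_) l) h , q

  triples-complete : (P : A → A → A → Set) → (∀ {x y z} → P x y z → P y x z) → (∀ {x y z} → P x y z → P x z y) →
    (∀ {x z} → ¬ P x x z) →
    ∀ {l x y z} → x ∈ l → y ∈ l → z ∈ l → P x y z → ∃ λ a → ∃₂ λ b c → (a , b , c) ∈ triples l × P a b c
  triples-complete P s t i {a ∷ l} = go
    where
      first : ∀ {y z} → y ∈ l → z ∈ l → P a y z → ∃ λ a′ → ∃₂ λ b c → (a′ , b , c) ∈ triples (a ∷ l) × P a′ b c
      first y∈ z∈ p = let _ , _ , h , q = pairs-complete (P a) t (i ∘ s ∘ t ∘ s) y∈ z∈ p
                      in _ , _ , _ , ∈-++⁺ˡ (∈-map⁺ (a ,_) h) , q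
      go : ∀ {x y z} → x ∈ a ∷ l → y ∈ a ∷ l → z ∈ a ∷ l → P x y z → ∃ λ a′ → ∃₂ λ b c → (a′ , b , c) ∈ triples (a ∷ l) × P a′ b c
      go (here refl) (here refl) _           p = contradiction p i
      go (here refl) (there _)   (here refl) p = contradiction (t p) i
      go (there _)   (here refl) (here refl) p = contradiction (t (s p)) i
      go (here refl) (there y∈)  (there z∈)  p = first y∈ z∈ p
      go (there x∈)  (here refl) (there z∈)  p = first x∈ z∈ (s p)
      go (there x∈)  (there y∈)  (here refl) p = first x∈ y∈ (s (t p))
      go (there x∈)  (there y∈)  (there z∈)  p =
        let _ , _ , _ , h , q = triples-complete P s t i x∈ y∈ z∈ p in _ , _ , _ , ∈-++⁺ʳ (map (a ,_) (pairs l)) h , q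

  ∑-pos : ∀ (l : List A) {f} → 0 < ∑ l f → ∃ λ x → x ∈ l × 0 < f x
  ∑-pos (x ∷ l) {f} h with f x in eq
  ... | suc _ = x , here refl , subst (0 <_) (sym eq) z<s
  ... | zero  = let y , y∈ , p = ∑-pos l h in y , there y∈ , p

  ∑-⊆ : ∀ {X R : List A} f → Unique X → All (_∈ R) X → ∑ X f ≤ ∑ R f
  ∑-⊆ f [] [] = z≤n
  ∑-⊆ {x ∷ X} f (x∉X ∷ u) (x∈R ∷ X⊆R) with ∈-∃++ x∈R
  ... | as , bs , refl = ≤-trans (+-monoʳ-≤ (f x) (∑-⊆ f u (All.tabulate λ h → ∈-tail (∈-resp-↭ (shift x as bs) (All.lookup X⊆R h)) (All.lookup x∉X h))))
                           (≤-reflexive (sym (∑-↭ (shift x as bs) f)))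

  all-pairs : ∀ {R : A → A → Set} {X} → AllPairs R X → All (λ (x , y) → R x y) (pairs X)
  all-pairs []      = []
  all-pairs (h ∷ c) = All.++⁺ (All.map⁺ h) (all-pairs c)

  all-triples : ∀ {R : A → A → Set} {X} → AllPairs R X → All (λ (x , y , z) → R x y × R x z × R y z) (triples X)
  all-triples []      = []
  all-triples {R} {x ∷ X} (h ∷ c) = All.++⁺ (All.map⁺ (go h (all-pairs c))) (all-triples c)
    where
      go : ∀ {Y} → All (R x) Y → All (λ (y , z) → R y z) (pairs Y) → All (λ (y , z) → R x y × R x z × R y z) (pairs Y)
      go []            _ = []
      go {y ∷ Y} (p ∷ ps) q = All.++⁺ (All.map⁺ (All.tabulate λ h → p , All.lookup ps h , All.lookup (All.map⁻ (All.++⁻ˡ (map (y ,_) Y) q)) h))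
                                (go ps (All.++⁻ʳ (map (y ,_) Y) q))

length-triples-≤3 : ∀ {A : Set} (Z : List A) → length Z ≤ 3 → length (triples Z) ≤ 1
length-triples-≤3 []              _ = z≤n
length-triples-≤3 (_ ∷ [])        _ = z≤n
length-triples-≤3 (_ ∷ _ ∷ [])    _ = z≤n
length-triples-≤3 (_ ∷ _ ∷ _ ∷ []) _ = ≤-refl
length-triples-≤3 (_ ∷ _ ∷ _ ∷ _ ∷ _) (s≤s (s≤s (s≤s ())))

dropˡ : ∀ {A : Set} {R : A → A → Set} xs {ys} → AllPairs R (xs ++ ys) → AllPairs R ys
dropˡ []       c       = c
dropˡ (_ ∷ xs) (_ ∷ c) = dropˡ xs c

dropʳ : ∀ {A : Set} {R : A → A → Set} xs {ys} → AllPairs R (xs ++ ys) → AllPairs R xs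
dropʳ []       c       = []
dropʳ (_ ∷ xs) (h ∷ c) = All.++⁻ˡ xs h ∷ dropʳ xs c

extend-↭ : ∀ {A : Set} {P K : List A} → Unique P → All (_∈ K) P → ∃ λ Q → P ++ Q ↭ K
extend-↭ {P = []} {K} _ _ = K , ↭-refl
extend-↭ {P = x ∷ P} (x∉P ∷ u) (x∈K ∷ P⊑K) with ∈-∃++ x∈K
... | as , bs , refl with extend-↭ u (All.tabulate λ h → ∈-tail (∈-resp-↭ (shift x as bs) (All.lookup P⊑K h)) (All.lookup x∉P h))
...   | Q , p = Q , ↭-trans (prep x p) (↭-sym (shift x as bs))

lookup-injective : ∀ {A : Set} {ℓ : List A} → Unique ℓ → ∀ i j → lookup ℓ i ≡ lookup ℓ j → i ≡ j
lookup-injective {ℓ = _ ∷ _} _ zero zero _ = refl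
lookup-injective {ℓ = _ ∷ ℓ} (h ∷ _) zero (suc j) eq = contradiction eq (All.lookup h (∈-lookup j))
lookup-injective {ℓ = _ ∷ ℓ} (h ∷ _) (suc i) zero eq = contradiction (sym eq) (All.lookup h (∈-lookup i))
lookup-injective {ℓ = _ ∷ _} (_ ∷ u) (suc i) (suc j) eq = cong suc (lookup-injective u i j eq)

∑-≤1 : ∀ {A : Set} (p : A → Bool) {l} → Unique l → (∀ {x y} → x ∈ l → y ∈ l → T (p x) → T (p y) → x ≡ y) → ∑ l (⟦_⟧ ∘ p) ≤ 1
∑-≤1 p [] _ = z≤n
∑-≤1 p {x ∷ l} (x∉l ∷ u) same with p x in eq
... | false = ∑-≤1 p u λ y∈ z∈ → same (there y∈) (there z∈)
... | true  = ≤-reflexive (cong suc (∑-zero l λ {y} y∈ → none y y∈))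
  where
    none : ∀ y → y ∈ l → ⟦ p y ⟧ ≡ 0
    none y y∈ with p y in eq′
    ... | false = refl
    ... | true  = contradiction (same (here refl) (there y∈) (subst T (sym eq) tt) (subst T (sym eq′) tt)) (All.lookup x∉l y∈)

0<* : ∀ a b → 0 < a * b → 0 < a × 0 < b
0<* (suc a) (suc b) _ = z<s , z<s
0<* (suc a) zero    h = contradiction (subst (0 <_) (*-zeroʳ a) h) λ ()

0<⟦⟧ : ∀ {b} → 0 < ⟦ b ⟧ → T b
0<⟦⟧ {true} _ = tt

T⇒≡true : ∀ {b} → T b → b ≡ true
T⇒≡true {true} _ = refl

¬T⇒≡false : ∀ {b} → ¬ T b → b ≡ false
¬T⇒≡false {true}  h = contradiction tt h
¬T⇒≡false {false} _ = refl

≢⇒not-≟ : ∀ {a b} → a ≢ b → not ⌊ a ≟ b ⌋ ≡ true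
≢⇒not-≟ {a} {b} h with a ≟ b
... | yes p = contradiction p h
... | no  _ = refl

≡⇒not-≟ : ∀ {a b} → a ≡ b → not ⌊ a ≟ b ⌋ ≡ false
≡⇒not-≟ {a} {b} h with a ≟ b
... | yes _ = refl
... | no  p = contradiction h p

T-not⁺ : ∀ {b} → ¬ T b → T (not b)
T-not⁺ {true}  f = f tt
T-not⁺ {false} _ = tt

T-not⁻ : ∀ {b} → T (not b) → ¬ T b
T-not⁻ {false} _ ()

∧-leftComm : ∀ a b c → a ∧ (b ∧ c) ≡ b ∧ (a ∧ c)
∧-leftComm true  b     _ = refl
∧-leftComm false true  _ = refl
∧-leftComm false false _ = refl

-- Arithmetic of Turán numbers and of their increments.

∸1-scale : ∀ {s r} → s ≤ r → r * (s ∸ 1) ≤ (r ∸ 1) * s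
∸1-scale {s} {r} h = begin
  r * (s ∸ 1)     ≡⟨ *-distribˡ-∸ r s 1 ⟩
  r * s ∸ r * 1   ≤⟨ ∸-monoʳ-≤ (r * s) (≤-trans (≤-reflexive (*-comm 1 s)) (≤-trans (*-monoˡ-≤ 1 h) ≤-refl)) ⟩
  r * s ∸ 1 * s   ≡⟨ sym (*-distribʳ-∸ s r 1) ⟩
  (r ∸ 1) * s     ∎
  where open ≤-Reasoning

∸2-scale : ∀ {s r} → s ≤ r → r * (s ∸ 2) ≤ (r ∸ 2) * s
∸2-scale {s} {r} h = begin
  r * (s ∸ 2)     ≡⟨ *-distribˡ-∸ r s 2 ⟩
  r * s ∸ r * 2   ≤⟨ ∸-monoʳ-≤ (r * s) (≤-trans (≤-reflexive (*-comm 2 s)) (*-monoˡ-≤ 2 h)) ⟩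
  r * s ∸ 2 * s   ≡⟨ sym (*-distribʳ-∸ s r 2) ⟩
  (r ∸ 2) * s     ∎
  where open ≤-Reasoning

-- The number of j < m with j ≡ i (mod 4), i.e. the size of the i-th part of T(m,4).
part₀ part₁ part₂ part₃ : ℕ → ℕ
part₀ (suc (suc (suc (suc m)))) = suc (part₀ m)
part₀ 0 = 0
part₀ _ = 1
part₁ (suc (suc (suc (suc m)))) = suc (part₁ m)
part₁ (suc (suc _)) = 1
part₁ _ = 0
part₂ (suc (suc (suc (suc m)))) = suc (part₂ m)
part₂ 3 = 1
part₂ _ = 0
part₃ (suc (suc (suc (suc m)))) = suc (part₃ m)
part₃ _ = 0

e₂ e₃ e₄ : ℕ → ℕ → ℕ → ℕ → ℕ
e₂ a b c d = a * b + a * c + a * d + b * c + b * d + c * d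
e₃ a b c d = a * b * c + a * b * d + a * c * d + b * c * d
e₄ a b c d = a * b * c * d

turán₂ turán₃ turán₄ : ℕ → ℕ
turán₂ m = e₂ (part₀ m) (part₁ m) (part₂ m) (part₃ m)
turán₃ m = e₃ (part₀ m) (part₁ m) (part₂ m) (part₃ m)
turán₄ m = e₄ (part₀ m) (part₁ m) (part₂ m) (part₃ m)

sum-parts : ∀ m → part₀ m + part₁ m + part₂ m + part₃ m ≡ m
sum-parts 0 = refl
sum-parts 1 = refl
sum-parts 2 = refl
sum-parts 3 = refl
sum-parts (suc (suc (suc (suc m)))) =
  trans (lem (part₀ m) (part₁ m) (part₂ m) (part₃ m)) (cong (4 +_) (sum-parts m))
  where lem : ∀ a b c d → suc a + suc b + suc c + suc d ≡ 4 + (a + b + c + d)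
        lem = solve-∀

-- T(4 + m, 4) is T(m,4) with one new vertex in each part, that is, with a K₄ in which every old
-- vertex misses exactly one vertex. The terms sort the edges by the number of ends in this K₄.
turán₂-step : ∀ m → turán₂ (4 + m) ≡ turán₂ m + 3 * m + 6
turán₂-step m = trans (lem (part₀ m) (part₁ m) (part₂ m) (part₃ m)) (cong (λ k → turán₂ m + 3 * k + 6) (sum-parts m))
  where lem : ∀ a b c d → ((1 + a) * (1 + b) + (1 + a) * (1 + c) + (1 + a) * (1 + d) + (1 + b) * (1 + c) + (1 + b) * (1 + d) + (1 + c) * (1 + d)) ≡ (a * b + a * c + a * d + b * c + b * d + c * d) + 3 * (a + b + c + d) + 6
        lem = solve-∀

turán₃-step : ∀ m → turán₃ (4 + m) ≡ turán₃ m + 2 * turán₂ m + 3 * m + 4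
turán₃-step m = trans (lem (part₀ m) (part₁ m) (part₂ m) (part₃ m)) (cong (λ k → turán₃ m + 2 * turán₂ m + 3 * k + 4) (sum-parts m))
  where lem : ∀ a b c d → ((1 + a) * (1 + b) * (1 + c) + (1 + a) * (1 + b) * (1 + d) + (1 + a) * (1 + c) * (1 + d) + (1 + b) * (1 + c) * (1 + d)) ≡ (a * b * c + a * b * d + a * c * d + b * c * d) + 2 * (a * b + a * c + a * d + b * c + b * d + c * d) + 3 * (a + b + c + d) + 4
        lem = solve-∀

-- The bracket is the price of the cliques added for r = 4 when R is T(m,4): its triangles, edges
-- and vertices, and K itself. The recursion therefore loses nothing there.
turán₄-step : ∀ m → turán₄ (4 + m) ≡ turán₄ m + (turán₃ m + turán₂ m + m + 1)
turán₄-step m = trans (lem (part₀ m) (part₁ m) (part₂ m) (part₃ m)) (cong (λ k → turán₄ m + (turán₃ m + turán₂ m + k + 1)) (sum-parts m))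
  where lem : ∀ a b c d → (1 + a) * (1 + b) * (1 + c) * (1 + d) ≡ a * b * c * d + ((a * b * c + a * b * d + a * c * d + b * c * d) + (a * b + a * c + a * d + b * c + b * d + c * d) + (a + b + c + d) + 1)
        lem = solve-∀

-- Case distinction m = 4q + i without division: the recursion takes 4 off m and shifts the
-- predicate, so that q occurs only in the four cases.
shape-elim : (P : ℕ → ℕ → ℕ → ℕ → ℕ → Set) →
  (∀ q → P (4 * q) q q q q) → (∀ q → P (1 + 4 * q) (1 + q) q q q) →
  (∀ q → P (2 + 4 * q) (1 + q) (1 + q) q q) → (∀ q → P (3 + 4 * q) (1 + q) (1 + q) (1 + q) q) →
  ∀ m → P m (part₀ m) (part₁ m) (part₂ m) (part₃ m)
shape-elim P h₀ h₁ h₂ h₃ 0 = h₀ 0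
shape-elim P h₀ h₁ h₂ h₃ 1 = h₁ 0
shape-elim P h₀ h₁ h₂ h₃ 2 = h₂ 0
shape-elim P h₀ h₁ h₂ h₃ 3 = h₃ 0
shape-elim P h₀ h₁ h₂ h₃ (suc (suc (suc (suc m)))) =
  shape-elim (λ m a b c d → P (4 + m) (suc a) (suc b) (suc c) (suc d))
    (λ q → subst (λ k → P k (suc q) (suc q) (suc q) (suc q)) (*-suc 4 q) (h₀ (suc q)))
    (λ q → subst (λ k → P (1 + k) (2 + q) (suc q) (suc q) (suc q)) (*-suc 4 q) (h₁ (suc q)))
    (λ q → subst (λ k → P (2 + k) (2 + q) (2 + q) (suc q) (suc q)) (*-suc 4 q) (h₂ (suc q)))
    (λ q → subst (λ k → P (3 + k) (2 + q) (2 + q) (2 + q) (suc q)) (*-suc 4 q) (h₃ (suc q)))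
    m

slack : ∀ {a b} c → a + c ≡ b → a ≤ b
slack {a} c refl = m≤m+n a c

-- AM-GM for four part sizes with sum m; in each residue class the slack is an explicit polynomial
-- in q.
turán₄≤ : ∀ m → 256 * turán₄ m ≤ m * m * (m * m)
turán₄≤ m = shape-elim
  (λ m a b c d → ∀ {e} → e ≡ (a * b * c * d) → 256 * e ≤ m * m * (m * m))
  (λ q eq → subst (λ e → 256 * e ≤ (4 * q) * (4 * q) * ((4 * q) * (4 * q))) (sym eq) (le₀ q))
  (λ q eq → subst (λ e → 256 * e ≤ (1 + 4 * q) * (1 + 4 * q) * ((1 + 4 * q) * (1 + 4 * q))) (sym eq) (le₁ q))
  (λ q eq → subst (λ e → 256 * e ≤ (2 + 4 * q) * (2 + 4 * q) * ((2 + 4 * q) * (2 + 4 * q))) (sym eq) (le₂ q))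
  (λ q eq → subst (λ e → 256 * e ≤ (3 + 4 * q) * (3 + 4 * q) * ((3 + 4 * q) * (3 + 4 * q))) (sym eq) (le₃ q))
  m refl
  where
    lem₀ : ∀ q → 256 * (q * q * q * q) + (0) ≡ (4 * q) * (4 * q) * ((4 * q) * (4 * q))
    lem₀ = solve-∀
    le₀ : ∀ q → 256 * (q * q * q * q) ≤ (4 * q) * (4 * q) * ((4 * q) * (4 * q))
    le₀ q = slack (0) (lem₀ q)
    lem₁ : ∀ q → 256 * ((1 + q) * q * q * q) + (96 * q * q + 16 * q + 1) ≡ (1 + 4 * q) * (1 + 4 * q) * ((1 + 4 * q) * (1 + 4 * q))
    lem₁ = solve-∀
    le₁ : ∀ q → 256 * ((1 + q) * q * q * q) ≤ (1 + 4 * q) * (1 + 4 * q) * ((1 + 4 * q) * (1 + 4 * q))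
    le₁ q = slack (96 * q * q + 16 * q + 1) (lem₁ q)
    lem₂ : ∀ q → 256 * ((1 + q) * (1 + q) * q * q) + (128 * q * q + 128 * q + 16) ≡ (2 + 4 * q) * (2 + 4 * q) * ((2 + 4 * q) * (2 + 4 * q))
    lem₂ = solve-∀
    le₂ : ∀ q → 256 * ((1 + q) * (1 + q) * q * q) ≤ (2 + 4 * q) * (2 + 4 * q) * ((2 + 4 * q) * (2 + 4 * q))
    le₂ q = slack (128 * q * q + 128 * q + 16) (lem₂ q)
    lem₃ : ∀ q → 256 * ((1 + q) * (1 + q) * (1 + q) * q) + (96 * q * q + 176 * q + 81) ≡ (3 + 4 * q) * (3 + 4 * q) * ((3 + 4 * q) * (3 + 4 * q))
    lem₃ = solve-∀
    le₃ : ∀ q → 256 * ((1 + q) * (1 + q) * (1 + q) * q) ≤ (3 + 4 * q) * (3 + 4 * q) * ((3 + 4 * q) * (3 + 4 * q))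
    le₃ q = slack (96 * q * q + 176 * q + 81) (lem₃ q)

-- The coefficient 8 is forced by m = 4q + 2, where the difference of m⁴ and 256 `turán₄ m` is 8m² -
-- 16, and the constant 9 by m = 3, where equality holds.
≤turán₄ : ∀ m → m * m * (m * m) ≤ 256 * turán₄ m + (8 * (m * m) + 9)
≤turán₄ m = shape-elim
  (λ m a b c d → ∀ {e} → e ≡ (a * b * c * d) → m * m * (m * m) ≤ 256 * e + (8 * (m * m) + 9))
  (λ q eq → subst (λ e → (4 * q) * (4 * q) * ((4 * q) * (4 * q)) ≤ 256 * e + (8 * ((4 * q) * (4 * q)) + 9)) (sym eq) (le₀ q))
  (λ q eq → subst (λ e → (1 + 4 * q) * (1 + 4 * q) * ((1 + 4 * q) * (1 + 4 * q)) ≤ 256 * e + (8 * ((1 + 4 * q) * (1 + 4 * q)) + 9)) (sym eq) (le₁ q))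
  (λ q eq → subst (λ e → (2 + 4 * q) * (2 + 4 * q) * ((2 + 4 * q) * (2 + 4 * q)) ≤ 256 * e + (8 * ((2 + 4 * q) * (2 + 4 * q)) + 9)) (sym eq) (le₂ q))
  (λ q eq → subst (λ e → (3 + 4 * q) * (3 + 4 * q) * ((3 + 4 * q) * (3 + 4 * q)) ≤ 256 * e + (8 * ((3 + 4 * q) * (3 + 4 * q)) + 9)) (sym eq) (le₃ q))
  m refl
  where
    lem₀ : ∀ q → (4 * q) * (4 * q) * ((4 * q) * (4 * q)) + (128 * q * q + 9) ≡ 256 * (q * q * q * q) + (8 * ((4 * q) * (4 * q)) + 9)
    lem₀ = solve-∀
    le₀ : ∀ q → (4 * q) * (4 * q) * ((4 * q) * (4 * q)) ≤ 256 * (q * q * q * q) + (8 * ((4 * q) * (4 * q)) + 9)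
    le₀ q = slack (128 * q * q + 9) (lem₀ q)
    lem₁ : ∀ q → (1 + 4 * q) * (1 + 4 * q) * ((1 + 4 * q) * (1 + 4 * q)) + (32 * q * q + 48 * q + 16) ≡ 256 * ((1 + q) * q * q * q) + (8 * ((1 + 4 * q) * (1 + 4 * q)) + 9)
    lem₁ = solve-∀
    le₁ : ∀ q → (1 + 4 * q) * (1 + 4 * q) * ((1 + 4 * q) * (1 + 4 * q)) ≤ 256 * ((1 + q) * q * q * q) + (8 * ((1 + 4 * q) * (1 + 4 * q)) + 9)
    le₁ q = slack (32 * q * q + 48 * q + 16) (lem₁ q)
    lem₂ : ∀ q → (2 + 4 * q) * (2 + 4 * q) * ((2 + 4 * q) * (2 + 4 * q)) + (25) ≡ 256 * ((1 + q) * (1 + q) * q * q) + (8 * ((2 + 4 * q) * (2 + 4 * q)) + 9)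
    lem₂ = solve-∀
    le₂ : ∀ q → (2 + 4 * q) * (2 + 4 * q) * ((2 + 4 * q) * (2 + 4 * q)) ≤ 256 * ((1 + q) * (1 + q) * q * q) + (8 * ((2 + 4 * q) * (2 + 4 * q)) + 9)
    le₂ q = slack (25) (lem₂ q)
    lem₃ : ∀ q → (3 + 4 * q) * (3 + 4 * q) * ((3 + 4 * q) * (3 + 4 * q)) + (32 * q * q + 16 * q) ≡ 256 * ((1 + q) * (1 + q) * (1 + q) * q) + (8 * ((3 + 4 * q) * (3 + 4 * q)) + 9)
    lem₃ = solve-∀
    le₃ : ∀ q → (3 + 4 * q) * (3 + 4 * q) * ((3 + 4 * q) * (3 + 4 * q)) ≤ 256 * ((1 + q) * (1 + q) * (1 + q) * q) + (8 * ((3 + 4 * q) * (3 + 4 * q)) + 9)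
    le₃ q = slack (32 * q * q + 16 * q) (lem₃ q)

turán₄-pos : ∀ m → 1 ≤ turán₄ (4 + m)
turán₄-pos m = subst (1 ≤_) (sym (turán₄-step m)) (≤-trans (m≤n+m 1 _) (m≤n+m _ (turán₄ m)))

-- The added 1 is the room left by rounding: m² ≤ 3 `turán₂ m` fails at m = 1, but an integer k with
-- 3k ≤ m² is still at most `turán₂ m`. In this way the bounds for graphs without K₄ fall below the
-- numbers of T(m,4).
turán₂-lower : ∀ m → 1 + m * m ≤ 3 * (1 + turán₂ m)
turán₂-lower m = shape-elim
  (λ m a b c d → ∀ {e} → e ≡ (a * b + a * c + a * d + b * c + b * d + c * d) → 1 + m * m ≤ 3 * (1 + e))
  (λ q eq → subst (λ e → 1 + (4 * q) * (4 * q) ≤ 3 * (1 + e)) (sym eq) (le₀ q))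
  (λ q eq → subst (λ e → 1 + (1 + 4 * q) * (1 + 4 * q) ≤ 3 * (1 + e)) (sym eq) (le₁ q))
  (λ q eq → subst (λ e → 1 + (2 + 4 * q) * (2 + 4 * q) ≤ 3 * (1 + e)) (sym eq) (le₂ q))
  (λ q eq → subst (λ e → 1 + (3 + 4 * q) * (3 + 4 * q) ≤ 3 * (1 + e)) (sym eq) (le₃ q))
  m refl
  where
    lem₀ : ∀ q → 1 + (4 * q) * (4 * q) + (2 * q * q + 2) ≡ 3 * (1 + (q * q + q * q + q * q + q * q + q * q + q * q))
    lem₀ = solve-∀
    le₀ : ∀ q → 1 + (4 * q) * (4 * q) ≤ 3 * (1 + (q * q + q * q + q * q + q * q + q * q + q * q))
    le₀ q = slack (2 * q * q + 2) (lem₀ q)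
    lem₁ : ∀ q → 1 + (1 + 4 * q) * (1 + 4 * q) + (2 * q * q + q + 1) ≡ 3 * (1 + ((1 + q) * q + (1 + q) * q + (1 + q) * q + q * q + q * q + q * q))
    lem₁ = solve-∀
    le₁ : ∀ q → 1 + (1 + 4 * q) * (1 + 4 * q) ≤ 3 * (1 + ((1 + q) * q + (1 + q) * q + (1 + q) * q + q * q + q * q + q * q))
    le₁ q = slack (2 * q * q + q + 1) (lem₁ q)
    lem₂ : ∀ q → 1 + (2 + 4 * q) * (2 + 4 * q) + (2 * q * q + 2 * q + 1) ≡ 3 * (1 + ((1 + q) * (1 + q) + (1 + q) * q + (1 + q) * q + (1 + q) * q + (1 + q) * q + q * q))
    lem₂ = solve-∀
    le₂ : ∀ q → 1 + (2 + 4 * q) * (2 + 4 * q) ≤ 3 * (1 + ((1 + q) * (1 + q) + (1 + q) * q + (1 + q) * q + (1 + q) * q + (1 + q) * q + q * q))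
    le₂ q = slack (2 * q * q + 2 * q + 1) (lem₂ q)
    lem₃ : ∀ q → 1 + (3 + 4 * q) * (3 + 4 * q) + (2 * q * q + 3 * q + 2) ≡ 3 * (1 + ((1 + q) * (1 + q) + (1 + q) * (1 + q) + (1 + q) * q + (1 + q) * (1 + q) + (1 + q) * q + (1 + q) * q))
    lem₃ = solve-∀
    le₃ : ∀ q → 1 + (3 + 4 * q) * (3 + 4 * q) ≤ 3 * (1 + ((1 + q) * (1 + q) + (1 + q) * (1 + q) + (1 + q) * q + (1 + q) * (1 + q) + (1 + q) * q + (1 + q) * q))
    le₃ q = slack (2 * q * q + 3 * q + 2) (lem₃ q)

turán₃-lower : ∀ m → 1 + m * m * m ≤ 27 * (1 + turán₃ m)
turán₃-lower m = shape-elim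
  (λ m a b c d → ∀ {e} → e ≡ (a * b * c + a * b * d + a * c * d + b * c * d) → 1 + m * m * m ≤ 27 * (1 + e))
  (λ q eq → subst (λ e → 1 + (4 * q) * (4 * q) * (4 * q) ≤ 27 * (1 + e)) (sym eq) (le₀ q))
  (λ q eq → subst (λ e → 1 + (1 + 4 * q) * (1 + 4 * q) * (1 + 4 * q) ≤ 27 * (1 + e)) (sym eq) (le₁ q))
  (λ q eq → subst (λ e → 1 + (2 + 4 * q) * (2 + 4 * q) * (2 + 4 * q) ≤ 27 * (1 + e)) (sym eq) (le₂ q))
  (λ q eq → subst (λ e → 1 + (3 + 4 * q) * (3 + 4 * q) * (3 + 4 * q) ≤ 27 * (1 + e)) (sym eq) (le₃ q))
  m refl
  where
    m≤m² : ∀ q → q ≤ q * q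
    m≤m² zero    = z≤n
    m≤m² (suc q) = m≤m+n (suc q) _
    lem₀ : ∀ q → 1 + (4 * q) * (4 * q) * (4 * q) + (44 * q * q * q + 26) ≡ 27 * (1 + (q * q * q + q * q * q + q * q * q + q * q * q))
    lem₀ = solve-∀
    le₀ : ∀ q → 1 + (4 * q) * (4 * q) * (4 * q) ≤ 27 * (1 + (q * q * q + q * q * q + q * q * q + q * q * q))
    le₀ q = slack (44 * q * q * q + 26) (lem₀ q)
    lem₁ : ∀ q → 1 + (1 + 4 * q) * (1 + 4 * q) * (1 + 4 * q) + (33 * (q * q) + 25 + 44 * (q * q * q)) ≡ 27 * (1 + ((1 + q) * q * q + (1 + q) * q * q + (1 + q) * q * q + q * q * q)) + 12 * q
    lem₁ = solve-∀
    le₁ : ∀ q → 1 + (1 + 4 * q) * (1 + 4 * q) * (1 + 4 * q) ≤ 27 * (1 + ((1 + q) * q * q + (1 + q) * q * q + (1 + q) * q * q + q * q * q))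
    -- The difference of the sides is 44q³ + 33q² - 12q + 25; its one negative term is absorbed by
    -- 12q ≤ 33q².
    le₁ q = +-cancelʳ-≤ (33 * (q * q) + 25) _ _ (≤-trans
      (slack (44 * (q * q * q)) (trans (+-assoc (1 + (1 + 4 * q) * (1 + 4 * q) * (1 + 4 * q)) _ _) (lem₁ q)))
      (+-monoʳ-≤ (27 * (1 + ((1 + q) * q * q + (1 + q) * q * q + (1 + q) * q * q + q * q * q))) (m≤n⇒m≤n+o 25 (*-mono-≤ {12} {33} (m≤m+n 12 21) (m≤m² q)))))
    lem₂ : ∀ q → 1 + (2 + 4 * q) * (2 + 4 * q) * (2 + 4 * q) + (44 * q * q * q + 66 * q * q + 6 * q + 18) ≡ 27 * (1 + ((1 + q) * (1 + q) * q + (1 + q) * (1 + q) * q + (1 + q) * q * q + (1 + q) * q * q))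
    lem₂ = solve-∀
    le₂ : ∀ q → 1 + (2 + 4 * q) * (2 + 4 * q) * (2 + 4 * q) ≤ 27 * (1 + ((1 + q) * (1 + q) * q + (1 + q) * (1 + q) * q + (1 + q) * q * q + (1 + q) * q * q))
    le₂ q = slack (44 * q * q * q + 66 * q * q + 6 * q + 18) (lem₂ q)
    lem₃ : ∀ q → 1 + (3 + 4 * q) * (3 + 4 * q) * (3 + 4 * q) + (44 * q * q * q + 99 * q * q + 54 * q + 26) ≡ 27 * (1 + ((1 + q) * (1 + q) * (1 + q) + (1 + q) * (1 + q) * q + (1 + q) * (1 + q) * q + (1 + q) * (1 + q) * q))
    lem₃ = solve-∀
    le₃ : ∀ q → 1 + (3 + 4 * q) * (3 + 4 * q) * (3 + 4 * q) ≤ 27 * (1 + ((1 + q) * (1 + q) * (1 + q) + (1 + q) * (1 + q) * q + (1 + q) * (1 + q) * q + (1 + q) * (1 + q) * q))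
    le₃ q = slack (44 * q * q * q + 99 * q * q + 54 * q + 26) (lem₃ q)

≤turán₂ : ∀ m k → 3 * k ≤ m * m → k ≤ turán₂ m
≤turán₂ m k h = s≤s⁻¹ (*-cancelˡ-< 3 k (suc (turán₂ m)) (≤-<-trans h (turán₂-lower m)))

≤turán₃ : ∀ m k → 27 * k ≤ m * m * m → k ≤ turán₃ m
≤turán₃ m k h = s≤s⁻¹ (*-cancelˡ-< 27 k (suc (turán₃ m)) (≤-<-trans h (turán₃-lower m)))

-- 256 turán₄ n lies between n⁴ − 8n² − 9 and n⁴, so it suffices to compare fourth powers.
turán₄-gap : ∀ m r x →
  m * m * (m * m) + 256 * x + (8 * ((m + r) * (m + r)) + 9) < (m + r) * (m + r) * ((m + r) * (m + r)) →
  turán₄ m + x < turán₄ (m + r)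
turán₄-gap m r x h = *-cancelˡ-< 256 _ _ (+-cancelʳ-< (8 * (n * n) + 9) _ _ (begin-strict
  256 * (turán₄ m + x) + (8 * (n * n) + 9)        ≡⟨ cong (_+ (8 * (n * n) + 9)) (*-distribˡ-+ 256 (turán₄ m) x) ⟩
  256 * turán₄ m + 256 * x + (8 * (n * n) + 9)    ≤⟨ +-monoˡ-≤ (8 * (n * n) + 9) (+-monoˡ-≤ (256 * x) (turán₄≤ m)) ⟩
  m * m * (m * m) + 256 * x + (8 * (n * n) + 9)   <⟨ h ⟩
  n * n * (n * n)                                 ≤⟨ ≤turán₄ n ⟩
  256 * turán₄ n + (8 * (n * n) + 9)              ∎))
  where
    open ≤-Reasoning
    n = m + r

gap-5 : ∀ m k c → 5 * k ≤ 2 * (m * m) → 250 * c ≤ 19 * (m * m * m) →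
        turán₄ m + (c + k + m + 1) < turán₄ (m + 5)
gap-5 m k c hk hc = turán₄-gap m 5 _ (begin-strict
  m * m * (m * m) + 256 * (c + k + m + 1) + (8 * ((m + 5) * (m + 5)) + 9)
    ≡⟨ lem₁ m k c ⟩
  256 * c + (256 * k + (m * m * (m * m) + 256 * (m + 1) + (8 * ((m + 5) * (m + 5)) + 9)))
    ≤⟨ +-mono-≤ hc′ (+-monoˡ-≤ _ hk′) ⟩
  20 * (m * m * m) + (103 * (m * m) + (m * m * (m * m) + 256 * (m + 1) + (8 * ((m + 5) * (m + 5)) + 9)))
    <⟨ slack (39 * m * m + 164 * m + 159) (lem₂ m) ⟩
  (m + 5) * (m + 5) * ((m + 5) * (m + 5)) ∎)
  where
    open ≤-Reasoning
    hc′ : 256 * c ≤ 20 * (m * m * m)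
    hc′ = *-cancelˡ-≤ 250 (begin
      250 * (256 * c)        ≡⟨ lem c ⟩
      256 * (250 * c)        ≤⟨ *-monoʳ-≤ 256 hc ⟩
      256 * (19 * (m * m * m)) ≤⟨ slack (136 * (m * m * m)) (lem′ (m * m * m)) ⟩
      250 * (20 * (m * m * m)) ∎)
      where
        lem : ∀ c → 250 * (256 * c) ≡ 256 * (250 * c)
        lem = solve-∀
        lem′ : ∀ x → 256 * (19 * x) + 136 * x ≡ 250 * (20 * x)
        lem′ = solve-∀
    hk′ : 256 * k ≤ 103 * (m * m)
    hk′ = *-cancelˡ-≤ 5 (begin
      5 * (256 * k)        ≡⟨ lem k ⟩
      256 * (5 * k)        ≤⟨ *-monoʳ-≤ 256 hk ⟩
      256 * (2 * (m * m))  ≤⟨ slack (3 * (m * m)) (lem′ (m * m)) ⟩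
      5 * (103 * (m * m)) ∎)
      where
        lem : ∀ c → 5 * (256 * c) ≡ 256 * (5 * c)
        lem = solve-∀
        lem′ : ∀ x → 256 * (2 * x) + 3 * x ≡ 5 * (103 * x)
        lem′ = solve-∀
    lem₁ : ∀ m k c → m * m * (m * m) + 256 * (c + k + m + 1) + (8 * ((m + 5) * (m + 5)) + 9)
         ≡ 256 * c + (256 * k + (m * m * (m * m) + 256 * (m + 1) + (8 * ((m + 5) * (m + 5)) + 9)))
    lem₁ = solve-∀
    lem₂ : ∀ m → 1 + (20 * (m * m * m) + (103 * (m * m) + (m * m * (m * m) + 256 * (m + 1) + (8 * ((m + 5) * (m + 5)) + 9))))
         + (39 * m * m + 164 * m + 159) ≡ (m + 5) * (m + 5) * ((m + 5) * (m + 5))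
    lem₂ = solve-∀

-- With r = 6 + p the comparison of the cubic terms is 64(r-1)(r-2) ≤ 6r³, which reads 1280 ≤ 1296
-- at r = 6; it is an equality at r = 4 and fails at r = 5.
gap-≥6 : ∀ m p k c → 2 * k ≤ m * m →
         (6 + p) * (6 + p) * (6 * c) ≤ (5 + p) * (4 + p) * (m * m * m) →
         turán₄ m + (c + k + m + 1) < turán₄ (m + (6 + p))
gap-≥6 m p k c hk hc = turán₄-gap m (6 + p) _ (begin-strict
  m * m * (m * m) + 256 * (c + k + m + 1) + (8 * ((m + (6 + p)) * (m + (6 + p))) + 9)
    ≡⟨ lem₁ m k c p ⟩
  256 * c + (256 * k + (m * m * (m * m) + 256 * (m + 1) + (8 * ((m + (6 + p)) * (m + (6 + p))) + 9)))
    ≤⟨ +-mono-≤ hc′ (+-monoˡ-≤ _ hk′) ⟩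
  4 * (6 + p) * (m * m * m) + (128 * (m * m) + (m * m * (m * m) + 256 * (m + 1) + (8 * ((m + (6 + p)) * (m + (6 + p))) + 9)))
    <⟨ slack ((80 + 72 * p + 6 * p * p) * (m * m) + (512 + 416 * p + 72 * p * p + 4 * p * p * p) * m + (742 + 768 * p + 208 * p * p + 24 * p * p * p + p * p * p * p)) (lem₂ m p) ⟩
  (m + (6 + p)) * (m + (6 + p)) * ((m + (6 + p)) * (m + (6 + p))) ∎)
  where
    open ≤-Reasoning
    hk′ : 256 * k ≤ 128 * (m * m)
    hk′ = begin
      256 * k       ≡⟨ *-assoc 128 2 k ⟩
      128 * (2 * k) ≤⟨ *-monoʳ-≤ 128 hk ⟩
      128 * (m * m) ∎
    hc′ : 256 * c ≤ 4 * (6 + p) * (m * m * m)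
    hc′ = *-cancelˡ-≤ ((6 + p) * (6 + p)) (*-cancelˡ-≤ 6 (begin
      6 * ((6 + p) * (6 + p) * (256 * c))                ≡⟨ lem c p ⟩
      256 * ((6 + p) * (6 + p) * (6 * c))                ≤⟨ *-monoʳ-≤ 256 hc ⟩
      256 * ((5 + p) * (4 + p) * (m * m * m))            ≤⟨ slack ((64 + 288 * p + 176 * p * p + 24 * p * p * p) * (m * m * m)) (lem′ (m * m * m) p) ⟩
      6 * ((6 + p) * (6 + p) * (4 * (6 + p) * (m * m * m))) ∎))
      where
        lem : ∀ c p → 6 * ((6 + p) * (6 + p) * (256 * c)) ≡ 256 * ((6 + p) * (6 + p) * (6 * c))
        lem = solve-∀
        lem′ : ∀ x p → 256 * ((5 + p) * (4 + p) * x) + (64 + 288 * p + 176 * p * p + 24 * p * p * p) * x ≡ 6 * ((6 + p) * (6 + p) * (4 * (6 + p) * x))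
        lem′ = solve-∀
    lem₁ : ∀ m k c p → m * m * (m * m) + 256 * (c + k + m + 1) + (8 * ((m + (6 + p)) * (m + (6 + p))) + 9)
         ≡ 256 * c + (256 * k + (m * m * (m * m) + 256 * (m + 1) + (8 * ((m + (6 + p)) * (m + (6 + p))) + 9)))
    lem₁ = solve-∀
    lem₂ : ∀ m p → 1 + (4 * (6 + p) * (m * m * m) + (128 * (m * m) + (m * m * (m * m) + 256 * (m + 1) + (8 * ((m + (6 + p)) * (m + (6 + p))) + 9))))
         + ((80 + 72 * p + 6 * p * p) * (m * m) + (512 + 416 * p + 72 * p * p + 4 * p * p * p) * m + (742 + 768 * p + 208 * p * p + 24 * p * p * p + p * p * p * p)) ≡ (m + (6 + p)) * (m + (6 + p)) * ((m + (6 + p)) * (m + (6 + p)))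
    lem₂ = solve-∀

2ab≤a²+b² : ∀ a b → 2 * (a * b) ≤ a * a + b * b
2ab≤a²+b² a b with ≤-total a b
... | inj₁ a≤b = subst (λ t → 2 * (a * t) ≤ a * a + t * t) (m+[n∸m]≡n a≤b) (slack ((b ∸ a) * (b ∸ a)) (lem a (b ∸ a)))
  where lem : ∀ a c → 2 * (a * (a + c)) + c * c ≡ a * a + (a + c) * (a + c)
        lem = solve-∀
... | inj₂ b≤a = subst (λ t → 2 * (t * b) ≤ t * t + b * b) (m+[n∸m]≡n b≤a) (slack ((a ∸ b) * (a ∸ b)) (lem b (a ∸ b)))
  where lem : ∀ b c → 2 * ((b + c) * b) + c * c ≡ (b + c) * (b + c) + b * b
        lem = solve-∀

part-size : ℕ → ℕ → ℕ
part-size i n = ∑ (allFin n) λ x → ⟦ ⌊ toℕ x % 4 ≟ i ⌋ ⟧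

∑-tabulate : ∀ {A : Set} {m} (f : Fin m → A) g → ∑ (tabulate f) g ≡ ∑ (allFin m) (g ∘ f)
∑-tabulate {m = zero}  f g = refl
∑-tabulate {m = suc m} f g = cong (g (f zero) +_) (trans (∑-tabulate (f ∘ suc) g) (sym (∑-tabulate suc (g ∘ f))))

part-size-4+ : ∀ i n → part-size i (4 + n) ≡ ⟦ ⌊ 0 ≟ i ⌋ ⟧ + (⟦ ⌊ 1 ≟ i ⌋ ⟧ + (⟦ ⌊ 2 ≟ i ⌋ ⟧ + (⟦ ⌊ 3 ≟ i ⌋ ⟧ + part-size i n)))
part-size-4+ i n = cong (λ s → ⟦ ⌊ 0 ≟ i ⌋ ⟧ + (⟦ ⌊ 1 ≟ i ⌋ ⟧ + (⟦ ⌊ 2 ≟ i ⌋ ⟧ + (⟦ ⌊ 3 ≟ i ⌋ ⟧ + s))))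
  (∑-tabulate (λ (x : Fin n) → suc (suc (suc (suc x)))) (λ x → ⟦ ⌊ toℕ x % 4 ≟ i ⌋ ⟧))

part-size₀ : ∀ n → part-size 0 n ≡ part₀ n
part-size₀ 0 = refl
part-size₀ 1 = refl
part-size₀ 2 = refl
part-size₀ 3 = refl
part-size₀ (suc (suc (suc (suc n)))) = trans (part-size-4+ 0 n) (cong suc (part-size₀ n))

part-size₁ : ∀ n → part-size 1 n ≡ part₁ n
part-size₁ 0 = refl
part-size₁ 1 = refl
part-size₁ 2 = refl
part-size₁ 3 = refl
part-size₁ (suc (suc (suc (suc n)))) = trans (part-size-4+ 1 n) (cong suc (part-size₁ n))

part-size₂ : ∀ n → part-size 2 n ≡ part₂ n
part-size₂ 0 = refl
part-size₂ 1 = refl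
part-size₂ 2 = refl
part-size₂ 3 = refl
part-size₂ (suc (suc (suc (suc n)))) = trans (part-size-4+ 2 n) (cong suc (part-size₂ n))

part-size₃ : ∀ n → part-size 3 n ≡ part₃ n
part-size₃ 0 = refl
part-size₃ 1 = refl
part-size₃ 2 = refl
part-size₃ 3 = refl
part-size₃ (suc (suc (suc (suc n)))) = trans (part-size-4+ 3 n) (cong suc (part-size₃ n))

-- Cliques as lists, maximum cliques, and counting across a maximum clique.

module Cliques {n : ℕ} (G : Graph n) where
  V : Set
  V = Fin n

  adj : V → V → Bool
  adj = Adj G

  _~_ : V → V → Set
  x ~ y = T (adj x y)

  ~-sym : ∀ {x y} → x ~ y → y ~ x
  ~-sym {x} {y} = subst T (Graph.sym G x y)

  ~-irrefl : ∀ {x} → ¬ x ~ x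
  ~-irrefl {x} h = subst T (irrefl G x) h

  -- Irreflexivity of adjacency excludes repetitions, so the length of such a list is the size of
  -- the clique.
  Clique : List V → Set
  Clique = AllPairs _~_

  _⊑_ : List V → List V → Set
  K ⊑ L = All (_∈ L) K

  Free : ℕ → List V → Set
  Free r L = ∀ K → Clique K → K ⊑ L → length K ≤ r

  Clique-↭ : ∀ {K K′} → K ↭ K′ → Clique K → Clique K′
  Clique-↭ p = PermSetoid.AllPairs-resp-↭ (setoid V) ~-sym
    ((λ { refl h → h }) , (λ { refl h → h })) (↭⇒↭ₛ p)

  -- The complement is kept as a list together with a permutation, so that every sum over L splits
  -- into a sum over the clique and one over the rest.
  record CliqueIn (k : ℕ) (L : List V) : Set where
    constructor cliqueIn
    field
      members rest : List V
      isClique     : Clique members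
      size         : length members ≡ k
      split        : members ++ rest ↭ L

    members⊑ : members ⊑ L
    members⊑ = All.tabulate (λ h → ∈-resp-↭ split (∈-++⁺ˡ h))
    rest⊑ : rest ⊑ L
    rest⊑ = All.tabulate (λ h → ∈-resp-↭ split (∈-++⁺ʳ members h))
    length-split : length L ≡ k + length rest
    length-split = trans (sym (↭-length split)) (trans (length-++ members) (cong (_+ length rest) size))

  -- A clique of size k + 1 in x ∷ l either contains x, and then has k further vertices among the
  -- neighbours of x, or lies in l.
  findClique : ∀ k L → CliqueIn k L ⊎ (∀ K → Clique K → K ⊑ L → length K ≢ k)
  findClique zero    L  = inj₁ (cliqueIn [] L [] refl ↭-refl)
  findClique (suc k) [] = inj₂ λ { (x ∷ K) _ (() ∷ _) _ ; [] _ _ () }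
  findClique (suc k) (x ∷ l) with findClique k (sift (adj x) l) | findClique (suc k) l
  ... | inj₁ (cliqueIn K R c s p) | _ = inj₁ (cliqueIn (x ∷ K) (R ++ sift (not ∘ adj x) l)
          (All.tabulate (λ h → proj₂ (∈-sift⁻ (adj x) {l} (∈-resp-↭ p (∈-++⁺ˡ h)))) ∷ c) (cong suc s)
          (prep x (↭-trans (subst (_↭ (sift (adj x) l ++ sift (not ∘ adj x) l)) (++-assoc K R _) (++⁺ʳ _ p)) (sift-split (adj x) l))))
  ... | inj₂ _ | inj₁ (cliqueIn K R c s p) = inj₁ (cliqueIn K (x ∷ R) c s (↭-trans (shift x K R) (prep x p)))
  ... | inj₂ no₁ | inj₂ no₂ = inj₂ none
    where
      none : ∀ K → Clique K → K ⊑ (x ∷ l) → length K ≢ suc k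
      none K c i s with any? (x ≟ᵥ_) K
      ... | no x∉K  = no₂ K c (All.tabulate λ h → ∈-tail (All.lookup i h) λ { refl → x∉K h }) s
      ... | yes x∈K with ∈-∃++ x∈K
      ...   | as , bs , refl with Clique-↭ (shift x as bs) c | All-resp-↭ (shift x as bs) i
      ...     | xs ∷ c′ | _ ∷ i′ = no₁ (as ++ bs) c′
                (All.tabulate λ h → ∈-sift⁺ (adj x)
                   (∈-tail (All.lookup i′ h) λ { refl → ~-irrefl (All.lookup xs h) }) (All.lookup xs h))
                (suc-injective (trans (sym (↭-length (shift x as bs))) s))

  maxClique : ∀ L → ∃ λ s → CliqueIn s L × Free s L
  maxClique L = go (length L) 0 (cliqueIn [] L [] refl ↭-refl) ≤-refl
    where
      open CliqueIn
      -- The first k + 1 vertices of a larger clique form a clique of size exactly k + 1, so its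
      -- absence rules out all larger sizes.
      free : ∀ {k} → (∀ K → Clique K → K ⊑ L → length K ≢ suc k) → Free k L
      free {k} none K c i with length K ≤? k
      ... | yes h = h
      ... | no  h = contradiction (trans (length-take (suc k) K) (m≤n⇒m⊓n≡m (≰⇒> h)))
                      (none (take (suc k) K) (AllPairs.take⁺ (suc k) c) (All.take⁺ (suc k) i))
      go : ∀ fuel k → CliqueIn k L → length L ≤ k + fuel → ∃ λ s → CliqueIn s L × Free s L
      go fuel k C h with findClique (suc k) L
      go fuel       k C h | inj₂ none = k , C , free none
      go zero       k C h | inj₁ C′ = contradiction (≤-trans (m≤m+n (suc k) _) (≤-trans (≤-reflexive (sym (length-split C′))) (≤-trans h (≤-reflexive (+-identityʳ k))))) 1+n≰n
      go (suc fuel) k C h | inj₁ C′ = go fuel (suc k) C′ (≤-trans h (≤-reflexive (+-suc k fuel)))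

  nbrs : List V → List V → List V
  nbrs P K = sift (λ v → all (adj v) P) K

  ∈-nbrs⁻ : ∀ P {K v} → v ∈ nbrs P K → v ∈ K × All (v ~_) P
  ∈-nbrs⁻ P h = let v∈K , a = ∈-sift⁻ _ h in v∈K , All.all⁺ _ P a

  ∈-nbrs⁺ : ∀ P {K v} → v ∈ K → All (v ~_) P → v ∈ nbrs P K
  ∈-nbrs⁺ P h a = ∈-sift⁺ _ h (All.all⁻ _ a)

  Clique-nbrs : ∀ P {K} → Clique P → Clique K → Clique (P ++ nbrs P K)
  Clique-nbrs P {K} cP cK = AllPairs.++⁺ cP (AllPairs.filter⁺ _ cK)
    (All.tabulate λ p → All.tabulate λ h → ~-sym (All.lookup (proj₂ (∈-nbrs⁻ P {K} h)) p))

  -- P and its common neighbours in the clique K form one clique. Hence a vertex has at most s - 1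
  -- neighbours in a maximum clique of size s, and an edge at most s - 2 common ones.
  nbrs-bound : ∀ {r L} P {K} → Free r L → Clique P → P ⊑ L → Clique K → K ⊑ L → length P + length (nbrs P K) ≤ r
  nbrs-bound {r} {L} P {K} free cP iP cK iK = subst (_≤ r) (length-++ P)
    (free _ (Clique-nbrs P cP cK) (All.++⁺ iP (All.tabulate λ h → All.lookup iK (proj₁ (∈-nbrs⁻ P {K} h)))))

  A : V → V → ℕ
  A x y = ⟦ adj x y ⟧

  A₃ : V → V → V → ℕ
  A₃ x y z = A x y * (A x z * A y z)

  A-sym : ∀ x y → A x y ≡ A y x
  A-sym x y = cong ⟦_⟧ (Graph.sym G x y)

  A≤1 : ∀ x y → A x y ≤ 1
  A≤1 x y = ⟦⟧≤1 (adj x y)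

  -- K₂, K₃, K₄, K₅ count ordered cliques; the unordered counts are k₂ and k₃.
  K₂ K₃ : List V → ℕ
  K₂ L = ∑ L λ x → ∑ L λ y → A x y
  K₃ L = ∑ L λ x → ∑ L λ y → ∑ L λ z → A₃ x y z

  A₃-swap₁₂ : ∀ x y z → A₃ x y z ≡ A₃ y x z
  A₃-swap₁₂ x y z = cong₂ _*_ (A-sym x y) (*-comm (A x z) (A y z))

  A₃-swap₂₃ : ∀ x y z → A₃ x y z ≡ A₃ x z y
  A₃-swap₂₃ x y z rewrite A-sym y z = lem (A x y) (A x z) (A z y)
    where lem : ∀ a b c → a * (b * c) ≡ b * (a * c)
          lem = solve-∀

  module _ {s L} (free : Free s L) (C : CliqueIn s L) where
    open CliqueIn C renaming (members to K; rest to R)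

    private
      ∑-split : ∀ f → ∑ L f ≡ ∑ K f + ∑ R f
      ∑-split f = trans (sym (∑-↭ split f)) (∑-++ K R f)

    degree-bound : ∀ {x} → x ∈ L → ∑ K (λ v → A x v) ≤ s ∸ 1
    degree-bound {x} x∈L = ≤-trans (≤-reflexive (trans (∑-cong K λ {v} _ → trans (A-sym x v) (lem v)) (sym (length-sift _ K))))
      (∸-monoˡ-≤ 1 (nbrs-bound (x ∷ []) free ([] ∷ []) (x∈L ∷ []) isClique members⊑))
      where lem : ∀ v → A v x ≡ ⟦ adj v x ∧ true ⟧
            lem v with adj v x
            ... | true  = refl
            ... | false = refl

    codegree-bound : ∀ {x y} → x ∈ L → y ∈ L → ∑ K (λ v → A₃ x y v) ≤ A x y * (s ∸ 2)
    codegree-bound {x} {y} x∈L y∈L = ≤-trans (≤-reflexive (∑-*ˡ K (A x y) (λ v → A x v * A y v))) go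
      where
        lem : ∀ v → A x v * A y v ≡ ⟦ adj v x ∧ adj v y ∧ true ⟧
        lem v rewrite Graph.sym G x v | Graph.sym G y v with adj v x | adj v y
        ... | true  | true  = refl
        ... | true  | false = refl
        ... | false | _     = refl
        common≤ : x ~ y → ∑ K (λ v → A x v * A y v) ≤ s ∸ 2
        common≤ h = ≤-trans (≤-reflexive (trans (∑-cong K λ {v} _ → lem v) (sym (length-sift _ K))))
          (∸-monoˡ-≤ 2 (nbrs-bound (x ∷ y ∷ []) free ((h ∷ []) ∷ [] ∷ []) (x∈L ∷ y∈L ∷ []) isClique members⊑))
        go : A x y * ∑ K (λ v → A x v * A y v) ≤ A x y * (s ∸ 2)
        go with adj x y | common≤
        ... | false | _ = z≤n
        ... | true  | h = *-monoʳ-≤ 1 (h _)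

    private
      R∈ : ∀ {x} → x ∈ R → x ∈ L
      R∈ = All.lookup rest⊑
      m = length R

    ∑RK≤ : ∑ R (λ x → ∑ K λ v → A x v) ≤ m * (s ∸ 1)
    ∑RK≤ = ∑-≤-const R _ (degree-bound ∘ R∈)

    ∑KR≤ : ∑ K (λ v → ∑ R λ x → A v x) ≤ m * (s ∸ 1)
    ∑KR≤ = ≤-trans (≤-reflexive (trans (∑-comm K R A) (∑-cong R λ _ → ∑-cong K λ _ → A-sym _ _))) ∑RK≤

    ∑LR≤ : ∑ L (λ x → ∑ R λ y → A x y) ≤ m * (s ∸ 1) + K₂ R
    ∑LR≤ = ≤-trans (≤-reflexive (∑-split _)) (+-monoˡ-≤ (K₂ R) ∑KR≤)

    -- An ordered edge with an end in K is charged to its other end, which has at most s - 1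
    -- neighbours in K; only the edges inside R remain.
    K₂-step : K₂ L ≤ length L * (s ∸ 1) + (m * (s ∸ 1) + K₂ R)
    K₂-step = begin
      K₂ L
        ≡⟨ ∑-cong L (λ {x} _ → ∑-split (A x)) ⟩
      ∑ L (λ x → ∑ K (A x) + ∑ R (A x))
        ≡⟨ ∑-+ L _ _ ⟩
      ∑ L (λ x → ∑ K (A x)) + ∑ L (λ x → ∑ R (A x))
        ≤⟨ +-mono-≤ (∑-≤-const L _ degree-bound) ∑LR≤ ⟩
      length L * (s ∸ 1) + (m * (s ∸ 1) + K₂ R) ∎
      where open ≤-Reasoning

    -- Ordered triangles are split by their last position in K. The other two vertices span an edge,
    -- which has at most s - 2 common neighbours in K, so each class is bounded by a count of
    -- ordered edges.
    K₃-step : K₃ L ≤ (K₂ L + (m * (s ∸ 1) + K₂ R) + K₂ R) * (s ∸ 2) + K₃ R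
    K₃-step = begin
      K₃ L
        ≡⟨ ∑-cong L (λ {x} _ → trans (∑-cong L λ {y} _ → ∑-split (A₃ x y)) (∑-+ L _ _)) ⟩
      ∑ L (λ x → ∑ L (λ y → ∑ K (A₃ x y)) + ∑ L (λ y → ∑ R (A₃ x y)))
        ≡⟨ ∑-+ L _ _ ⟩
      ∑ L (λ x → ∑ L (λ y → ∑ K (A₃ x y))) + ∑ L (λ x → ∑ L (λ y → ∑ R (A₃ x y)))
        ≡⟨ cong (∑ L (λ x → ∑ L (λ y → ∑ K (A₃ x y))) +_) (trans (∑-cong L λ _ → ∑-split _) (∑-+ L _ _)) ⟩
      ∑ L (λ x → ∑ L (λ y → ∑ K (A₃ x y))) + (∑ L (λ x → ∑ K (λ y → ∑ R (A₃ x y))) + ∑ L (λ x → ∑ R (λ y → ∑ R (A₃ x y))))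
        ≡⟨ cong (λ t → ∑ L (λ x → ∑ L (λ y → ∑ K (A₃ x y))) + (∑ L (λ x → ∑ K (λ y → ∑ R (A₃ x y))) + t)) (∑-split _) ⟩
      ∑ L (λ x → ∑ L (λ y → ∑ K (A₃ x y))) + (∑ L (λ x → ∑ K (λ y → ∑ R (A₃ x y))) + (∑ K (λ x → ∑ R (λ y → ∑ R (A₃ x y))) + K₃ R))
        ≤⟨ +-mono-≤ LLK (+-mono-≤ LKR (+-monoˡ-≤ (K₃ R) KRR)) ⟩
      K₂ L * t + ((m * (s ∸ 1) + K₂ R) * t + (K₂ R * t + K₃ R))
        ≡⟨ lem (K₂ L) (m * (s ∸ 1) + K₂ R) (K₂ R) (K₃ R) t ⟩
      (K₂ L + (m * (s ∸ 1) + K₂ R) + K₂ R) * t + K₃ R ∎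
      where
        open ≤-Reasoning
        t = s ∸ 2
        lem : ∀ a b c d t → a * t + (b * t + (c * t + d)) ≡ (a + b + c) * t + d
        lem = solve-∀
        LLK : ∑ L (λ x → ∑ L (λ y → ∑ K (A₃ x y))) ≤ K₂ L * t
        LLK = ≤-trans (∑-mono L λ x∈ → ∑-mono L λ y∈ → codegree-bound x∈ y∈)
                (≤-reflexive (trans (∑-cong L λ _ → ∑-*ʳ L t _) (∑-*ʳ L t _)))
        LKR : ∑ L (λ x → ∑ K (λ y → ∑ R (A₃ x y))) ≤ (m * (s ∸ 1) + K₂ R) * t
        LKR = begin
          ∑ L (λ x → ∑ K (λ y → ∑ R (λ z → A₃ x y z)))
            ≡⟨ ∑-cong L (λ {x} _ → trans (∑-comm K R (A₃ x)) (∑-cong R λ _ → ∑-cong K λ _ → A₃-swap₂₃ x _ _)) ⟩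
          ∑ L (λ x → ∑ R (λ z → ∑ K (λ y → A₃ x z y)))
            ≤⟨ ∑-mono L (λ x∈ → ∑-mono R λ z∈ → codegree-bound x∈ (R∈ z∈)) ⟩
          ∑ L (λ x → ∑ R (λ z → A x z * t))
            ≡⟨ trans (∑-cong L λ _ → ∑-*ʳ R t _) (∑-*ʳ L t _) ⟩
          ∑ L (λ x → ∑ R (λ z → A x z)) * t
            ≤⟨ *-monoˡ-≤ t ∑LR≤ ⟩
          (m * (s ∸ 1) + K₂ R) * t ∎
        KRR : ∑ K (λ x → ∑ R (λ y → ∑ R (A₃ x y))) ≤ K₂ R * t
        KRR = begin
          ∑ K (λ x → ∑ R (λ y → ∑ R (λ z → A₃ x y z)))
            ≡⟨ trans (∑-comm K R _) (∑-cong R λ _ → ∑-comm K R _) ⟩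
          ∑ R (λ y → ∑ R (λ z → ∑ K (λ x → A₃ x y z)))
            ≡⟨ ∑-cong R (λ _ → ∑-cong R λ _ → ∑-cong K λ _ → trans (A₃-swap₁₂ _ _ _) (A₃-swap₂₃ _ _ _)) ⟩
          ∑ R (λ y → ∑ R (λ z → ∑ K (λ x → A₃ y z x)))
            ≤⟨ ∑-mono R (λ y∈ → ∑-mono R λ z∈ → codegree-bound (R∈ y∈) (R∈ z∈)) ⟩
          ∑ R (λ y → ∑ R (λ z → A y z * t))
            ≡⟨ trans (∑-cong R λ _ → ∑-*ʳ R t _) (∑-*ʳ R t _) ⟩
          K₂ R * t ∎

-- Turán-type bounds on edges and triangles.

module TuránBounds {n : ℕ} (G : Graph n) where
  open Cliques G

  A-diag : ∀ x → A x x ≡ 0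
  A-diag x = cong ⟦_⟧ (irrefl G x)

  A₃-diag : ∀ x z → A₃ x x z ≡ 0
  A₃-diag x z rewrite irrefl G x = refl

  k₂ k₃ : List V → ℕ
  k₂ L = ∑ (pairs L) λ (x , y) → A x y
  k₃ L = ∑ (triples L) λ (x , y , z) → A₃ x y z

  K₂≡2k₂ : ∀ L → K₂ L ≡ 2 * k₂ L
  K₂≡2k₂ L = ∑-pairs L A A-sym A-diag

  K₃≡6k₃ : ∀ L → K₃ L ≡ 6 * k₃ L
  K₃≡6k₃ L = ∑-triples L A₃ A₃-swap₁₂ A₃-swap₂₃ A₃-diag

  Free-⊑ : ∀ {r L R} → R ⊑ L → Free r L → Free r R
  Free-⊑ i free K c j = free K c (All.map (All.lookup i) j)

  open CliqueIn

  Free-0⇒[] : ∀ {L} → Free 0 L → L ≡ []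
  Free-0⇒[] {[]}    _    = refl
  Free-0⇒[] {x ∷ l} free = contradiction (free (x ∷ []) ([] ∷ []) (here refl ∷ [])) λ ()

  clique-induction : ∀ {ℓ} (P : List V → Set ℓ) → P [] →
    (∀ {L s} → 1 ≤ s → Free s L → (C : CliqueIn s L) → P (rest C) → P L) → ∀ L → P L
  clique-induction P p[] step L = go (length L) L ≤-refl
    where
      go : ∀ fuel L → length L ≤ fuel → P L
      go _    []      _ = p[]
      go (suc fuel) L@(x ∷ l) h with maxClique L
      ... | zero  , C , free = contradiction (Free-0⇒[] free) λ ()
      ... | suc s , C , free = step (s≤s z≤n) free C (go fuel (rest C)
              (≤-trans (m≤n+m _ s) (s≤s⁻¹ (≤-trans (≤-reflexive (sym (length-split C))) h))))

  size≤ : ∀ {r s L} → Free r L → CliqueIn s L → s ≤ r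
  size≤ {r} free C = subst (_≤ r) (size C) (free _ (isClique C) (members⊑ C))

  module _ (r : ℕ) where
    private
      a = r ∸ 1
      b = r ∸ 2

    -- These are the density bounds, attained by T(m,r) when r divides m. The clique removed may
    -- have size s < r; `∸1-scale` and `∸2-scale` exchange s for r, after which the contributions
    -- complete the square and the cube of s + m.
    Turán-bounds : ∀ L → Free r L →
      r * K₂ L ≤ a * (length L * length L) × r * r * K₃ L ≤ a * b * (length L * length L * length L)
    Turán-bounds = clique-induction _ (λ _ → subst (_≤ a * 0) (sym (*-zeroʳ r)) z≤n , subst (_≤ a * b * 0) (sym (*-zeroʳ (r * r))) z≤n) step
      where
        step : ∀ {L s} → 1 ≤ s → Free s L → (C : CliqueIn s L) →
          (Free r (rest C) → r * K₂ (rest C) ≤ a * (length (rest C) * length (rest C))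
                           × r * r * K₃ (rest C) ≤ a * b * (length (rest C) * length (rest C) * length (rest C))) →
          Free r L → r * K₂ L ≤ a * (length L * length L) × r * r * K₃ L ≤ a * b * (length L * length L * length L)
        step {L} {s} _ freeₛ C ih freeᵣ rewrite length-split C = bound₂ , bound₃
          where
            R = rest C
            m = length R
            ihR = ih (Free-⊑ (rest⊑ C) freeᵣ)
            s≤r = size≤ freeᵣ C
            step₂ : K₂ L ≤ (s + m) * (s ∸ 1) + (m * (s ∸ 1) + K₂ R)
            step₂ = subst (λ t → K₂ L ≤ t * (s ∸ 1) + (m * (s ∸ 1) + K₂ R)) (length-split C) (K₂-step freeₛ C)
            open ≤-Reasoning
            bound₂ : r * K₂ L ≤ a * ((s + m) * (s + m))
            bound₂ = begin
              r * K₂ L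
                ≤⟨ *-monoʳ-≤ r step₂ ⟩
              r * ((s + m) * (s ∸ 1) + (m * (s ∸ 1) + K₂ R))
                ≡⟨ lem r s m (s ∸ 1) (K₂ R) ⟩
              (r * (s ∸ 1)) * (s + 2 * m) + r * K₂ R
                ≤⟨ +-mono-≤ (*-monoˡ-≤ (s + 2 * m) (∸1-scale s≤r)) (proj₁ ihR) ⟩
              (a * s) * (s + 2 * m) + a * (m * m)
                ≡⟨ lem′ a s m ⟩
              a * ((s + m) * (s + m)) ∎
              where
                lem : ∀ r s m t k → r * ((s + m) * t + (m * t + k)) ≡ (r * t) * (s + 2 * m) + r * k
                lem = solve-∀
                lem′ : ∀ a s m → (a * s) * (s + 2 * m) + a * (m * m) ≡ a * ((s + m) * (s + m))
                lem′ = solve-∀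
            bound₃ : r * r * K₃ L ≤ a * b * ((s + m) * (s + m) * (s + m))
            bound₃ = begin
              r * r * K₃ L
                ≤⟨ *-monoʳ-≤ (r * r) (K₃-step freeₛ C) ⟩
              r * r * ((K₂ L + (m * (s ∸ 1) + K₂ R) + K₂ R) * (s ∸ 2) + K₃ R)
                ≡⟨ lem r m (s ∸ 1) (s ∸ 2) (K₂ L) (K₂ R) (K₃ R) ⟩
              (r * K₂ L + m * (r * (s ∸ 1)) + 2 * (r * K₂ R)) * (r * (s ∸ 2)) + r * r * K₃ R
                ≤⟨ +-mono-≤ (*-mono-≤ (+-mono-≤ (+-mono-≤ bound₂ (*-monoʳ-≤ m (∸1-scale s≤r))) (*-monoʳ-≤ 2 (proj₁ ihR))) (∸2-scale s≤r)) (proj₂ ihR) ⟩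
              (a * ((s + m) * (s + m)) + m * (a * s) + 2 * (a * (m * m))) * (b * s) + a * b * (m * m * m)
                ≡⟨ lem′ a b s m ⟩
              a * b * ((s + m) * (s + m) * (s + m)) ∎
              where
                lem : ∀ r m u t k k′ l → r * r * ((k + (m * u + k′) + k′) * t + l) ≡ (r * k + m * (r * u) + 2 * (r * k′)) * (r * t) + r * r * l
                lem = solve-∀
                lem′ : ∀ a b s m → (a * ((s + m) * (s + m)) + m * (a * s) + 2 * (a * (m * m))) * (b * s) + a * b * (m * m * m) ≡ a * b * ((s + m) * (s + m) * (s + m))
                lem′ = solve-∀

  -- Removing a K₄ leaves no slack in the main induction, so here the exact numbers of T(m,4) are
  -- required.
  Turán₄-bounds : ∀ L → Free 4 L → k₂ L ≤ turán₂ (length L) × k₃ L ≤ turán₃ (length L)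
  Turán₄-bounds = clique-induction _ (λ _ → z≤n , z≤n) step
    where
      step : ∀ {L s} → 1 ≤ s → Free s L → (C : CliqueIn s L) →
        (Free 4 (rest C) → k₂ (rest C) ≤ turán₂ (length (rest C)) × k₃ (rest C) ≤ turán₃ (length (rest C))) →
        Free 4 L → k₂ L ≤ turán₂ (length L) × k₃ L ≤ turán₃ (length L)
      step {L} {s} _ freeₛ C ih free₄ with s ≤? 3
      -- Without K₄ the densities for r = 3 are already below those of T(m,4), up to the rounding
      -- settled by `≤turán₂` and `≤turán₃`.
      ... | yes s≤3 = ≤turán₂ (length L) (k₂ L) (*-cancelˡ-≤ 2 (begin
                2 * (3 * k₂ L)  ≡⟨ lem₂ (k₂ L) ⟩
                3 * (2 * k₂ L)  ≡⟨ cong (3 *_) (K₂≡2k₂ L) ⟨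
                3 * K₂ L        ≤⟨ proj₁ bounds ⟩
                2 * (length L * length L) ∎))
            , ≤turán₃ (length L) (k₃ L) (*-cancelˡ-≤ 2 (begin
                2 * (27 * k₃ L) ≡⟨ lem₃ (k₃ L) ⟩
                9 * (6 * k₃ L)  ≡⟨ cong (9 *_) (K₃≡6k₃ L) ⟨
                9 * K₃ L        ≤⟨ proj₂ bounds ⟩
                2 * (length L * length L * length L) ∎))
        where
          open ≤-Reasoning
          bounds = Turán-bounds 3 L (λ K c i → ≤-trans (freeₛ K c i) s≤3)
          lem₂ : ∀ k → 2 * (3 * k) ≡ 3 * (2 * k)
          lem₂ = solve-∀
          lem₃ : ∀ k → 2 * (27 * k) ≡ 9 * (6 * k)
          lem₃ = solve-∀
      ... | no s≰3 with ≤-antisym (size≤ free₄ C) (≰⇒> s≰3)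
      ...   | refl = bound₂ , bound₃
        where
          R = rest C
          m = length R
          ihR = ih (Free-⊑ (rest⊑ C) free₄)
          open ≤-Reasoning
          k₂-step : k₂ L ≤ k₂ R + 3 * m + 6
          k₂-step = *-cancelˡ-≤ 2 (begin
            2 * k₂ L                       ≡⟨ K₂≡2k₂ L ⟨
            K₂ L                           ≤⟨ K₂-step freeₛ C ⟩
            length L * 3 + (m * 3 + K₂ R)  ≡⟨ cong₂ (λ p q → p * 3 + (m * 3 + q)) (length-split C) (K₂≡2k₂ R) ⟩
            (4 + m) * 3 + (m * 3 + 2 * k₂ R) ≡⟨ lem m (k₂ R) ⟩
            2 * (k₂ R + 3 * m + 6)         ∎)
            where
              lem : ∀ m k → (4 + m) * 3 + (m * 3 + 2 * k) ≡ 2 * (k + 3 * m + 6)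
              lem = solve-∀
          k₃-step : k₃ L ≤ k₃ R + 2 * k₂ R + 3 * m + 4
          k₃-step = *-cancelˡ-≤ 6 (begin
            6 * k₃ L                                   ≡⟨ K₃≡6k₃ L ⟨
            K₃ L                                       ≤⟨ K₃-step freeₛ C ⟩
            (K₂ L + (m * 3 + K₂ R) + K₂ R) * 2 + K₃ R  ≡⟨ cong₂ (λ p q → (p + (m * 3 + q) + q) * 2 + K₃ R) (K₂≡2k₂ L) (K₂≡2k₂ R) ⟩
            (2 * k₂ L + (m * 3 + 2 * k₂ R) + 2 * k₂ R) * 2 + K₃ R
              ≤⟨ +-mono-≤ (*-monoˡ-≤ 2 (+-monoˡ-≤ (2 * k₂ R) (+-monoˡ-≤ (m * 3 + 2 * k₂ R) (*-monoʳ-≤ 2 k₂-step)))) (≤-reflexive (K₃≡6k₃ R)) ⟩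
            (2 * (k₂ R + 3 * m + 6) + (m * 3 + 2 * k₂ R) + 2 * k₂ R) * 2 + 6 * k₃ R ≡⟨ lem m (k₂ R) (k₃ R) ⟩
            6 * (k₃ R + 2 * k₂ R + 3 * m + 4)          ∎)
            where
              lem : ∀ m k l → (2 * (k + 3 * m + 6) + (m * 3 + 2 * k) + 2 * k) * 2 + 6 * l ≡ 6 * (l + 2 * k + 3 * m + 4)
              lem = solve-∀
          bound₂ : k₂ L ≤ turán₂ (length L)
          bound₂ = begin
            k₂ L               ≤⟨ k₂-step ⟩
            k₂ R + 3 * m + 6   ≤⟨ +-monoˡ-≤ 6 (+-monoˡ-≤ (3 * m) (proj₁ ihR)) ⟩
            turán₂ m + 3 * m + 6 ≡⟨ trans (cong turán₂ (length-split C)) (turán₂-step m) ⟨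
            turán₂ (length L)  ∎
          bound₃ : k₃ L ≤ turán₃ (length L)
          bound₃ = begin
            k₃ L               ≤⟨ k₃-step ⟩
            k₃ R + 2 * k₂ R + 3 * m + 4 ≤⟨ +-monoˡ-≤ 4 (+-monoˡ-≤ (3 * m) (+-mono-≤ (proj₂ ihR) (*-monoʳ-≤ 2 (proj₁ ihR)))) ⟩
            turán₃ m + 2 * turán₂ m + 3 * m + 4 ≡⟨ trans (cong turán₃ (length-split C)) (turán₃-step m) ⟨
            turán₃ (length L)  ∎

-- Moon-Moser inequalities and the size of the triangle packing.

module MoonMoserBounds {n : ℕ} (G : Graph n) where
  open Cliques G
  open TuránBounds G

  C₂ : V → V → V → ℕ
  C₂ x y z = A x z * A y z

  C₃ : V → V → V → V → ℕ
  C₃ x y z w = A x w * (A y w * A z w)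

  C₄ : V → V → V → V → V → ℕ
  C₄ x y z w u = A x u * C₃ y z w u

  A₄ : V → V → V → V → ℕ
  A₄ x y z w = A₃ x y z * C₃ x y z w

  A₅ : V → V → V → V → V → ℕ
  A₅ x y z w u = A₄ x y z w * C₄ x y z w u

  K₄ K₅ : List V → ℕ
  K₄ L = ∑ L λ x → ∑ L λ y → ∑ L λ z → ∑ L λ w → A₄ x y z w
  K₅ L = ∑ L λ x → ∑ L λ y → ∑ L λ z → ∑ L λ w → ∑ L λ u → A₅ x y z w u

  A₄-swap₁₂ : ∀ x y z w → A₄ x y z w ≡ A₄ y x z w
  A₄-swap₁₂ x y z w = cong₂ _*_ (A₃-swap₁₂ x y z) (lem (A x w) (A y w) (A z w))
    where lem : ∀ a b c → a * (b * c) ≡ b * (a * c)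
          lem = solve-∀

  A₄-swap₂₃ : ∀ x y z w → A₄ x y z w ≡ A₄ x z y w
  A₄-swap₂₃ x y z w = cong₂ _*_ (A₃-swap₂₃ x y z) (cong (A x w *_) (*-comm (A y w) (A z w)))

  A₄-swap₃₄ : ∀ x y z w → A₄ x y z w ≡ A₄ x y w z
  A₄-swap₃₄ x y z w rewrite A-sym z w = lem (A x y) (A x z) (A y z) (A x w) (A y w) (A w z)
    where lem : ∀ a b c d e f → a * (b * c) * (d * (e * f)) ≡ a * (d * e) * (b * (c * f))
          lem = solve-∀

  module MoonMoser (L : List V) where
    private m = length L

    d : V → V → ℕ
    d x y = ∑ L (C₂ x y)

    e : V → V → V → ℕ
    e x y z = ∑ L (C₃ x y z)

    Q₂ Q₃ : ℕ
    Q₂ = ∑ L λ x → ∑ L λ y → A x y * (d x y * d x y)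
    Q₃ = ∑ L λ x → ∑ L λ y → ∑ L λ z → A₃ x y z * (e x y z * e x y z)

    K₃≡ : K₃ L ≡ ∑ L λ x → ∑ L λ y → A x y * d x y
    K₃≡ = ∑-cong L λ {x} _ → ∑-cong L λ {y} _ → ∑-*ˡ L (A x y) (C₂ x y)

    K₄≡ : K₄ L ≡ ∑ L λ x → ∑ L λ y → ∑ L λ z → A₃ x y z * e x y z
    K₄≡ = ∑-cong L λ {x} _ → ∑-cong L λ {y} _ → ∑-cong L λ {z} _ → ∑-*ˡ L (A₃ x y z) (C₃ x y z)

    -- A vertex is joined to both ends of at most one edge of a triangle, or of all three.
    Q₂-bound : 3 * Q₂ ≤ m * K₃ L + 2 * K₄ L
    Q₂-bound = begin
      3 * Q₂
        ≡⟨ lem Q₂ ⟩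
      Q₂ + (Q₂ + Q₂)
        ≡⟨ cong₂ _+_ q₁ (cong₂ _+_ q₂ q₃) ⟩
      ∑³ (λ x y z → A₃ x y z * d x y) + (∑³ (λ x y z → A₃ x y z * d x z) + ∑³ (λ x y z → A₃ x y z * d y z))
        ≡⟨ trans (∑³-+ (λ x y z → A₃ x y z * d x y) (λ x y z → A₃ x y z * d x z + A₃ x y z * d y z))
                 (cong (∑³ (λ x y z → A₃ x y z * d x y) +_) (∑³-+ (λ x y z → A₃ x y z * d x z) (λ x y z → A₃ x y z * d y z))) ⟨
      ∑³ (λ x y z → A₃ x y z * d x y + (A₃ x y z * d x z + A₃ x y z * d y z))
        ≤⟨ ∑³-mono (λ x y z → pointwise x y z) ⟩
      ∑³ (λ x y z → m * A₃ x y z + 2 * ∑ L (A₄ x y z))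
        ≡⟨ ∑³-+ (λ x y z → m * A₃ x y z) (λ x y z → 2 * ∑ L (A₄ x y z)) ⟩
      ∑³ (λ x y z → m * A₃ x y z) + ∑³ (λ x y z → 2 * ∑ L (A₄ x y z))
        ≡⟨ cong₂ _+_ (∑³-*ˡ m A₃) (∑³-*ˡ 2 (λ x y z → ∑ L (A₄ x y z))) ⟩
      m * K₃ L + 2 * K₄ L ∎
      where
        open ≤-Reasoning
        ∑³ : (V → V → V → ℕ) → ℕ
        ∑³ f = ∑ L λ x → ∑ L λ y → ∑ L λ z → f x y z
        ∑³-+ : ∀ f g → ∑³ (λ x y z → f x y z + g x y z) ≡ ∑³ f + ∑³ g
        ∑³-+ f g = trans (∑-cong L λ _ → trans (∑-cong L λ _ → ∑-+ L _ _) (∑-+ L _ _)) (∑-+ L _ _)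
        ∑³-*ˡ : ∀ c f → ∑³ (λ x y z → c * f x y z) ≡ c * ∑³ f
        ∑³-*ˡ c f = trans (∑-cong L λ _ → trans (∑-cong L λ _ → ∑-*ˡ L c _) (∑-*ˡ L c _)) (∑-*ˡ L c _)
        ∑³-mono : ∀ {f g} → (∀ x y z → f x y z ≤ g x y z) → ∑³ f ≤ ∑³ g
        ∑³-mono h = ∑-mono L λ _ → ∑-mono L λ _ → ∑-mono L λ _ → h _ _ _
        lem : ∀ q → 3 * q ≡ q + (q + q)
        lem = solve-∀
        q₁ : Q₂ ≡ ∑³ (λ x y z → A₃ x y z * d x y)
        q₁ = ∑-cong L λ {x} _ → ∑-cong L λ {y} _ → trans (sym (*-assoc (A x y) (d x y) (d x y)))
               (trans (cong (_* d x y) (sym (∑-*ˡ L (A x y) (C₂ x y)))) (sym (∑-*ʳ L (d x y) _)))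
        q₂ : Q₂ ≡ ∑³ (λ x y z → A₃ x y z * d x z)
        q₂ = trans q₁ (∑-cong L λ {x} _ → trans (∑-comm L L _)
               (∑-cong L λ {z} _ → ∑-cong L λ {y} _ → cong (_* d x y) (A₃-swap₂₃ x y z)))
        q₃ : Q₂ ≡ ∑³ (λ x y z → A₃ x y z * d y z)
        q₃ = trans q₂ (trans (∑-comm L L _)
               (∑-cong L λ {y} _ → ∑-cong L λ {x} _ → ∑-cong L λ {z} _ → cong (_* d x z) (A₃-swap₁₂ x y z)))
        bits : ∀ a b c → ⟦ a ⟧ * ⟦ b ⟧ + (⟦ a ⟧ * ⟦ c ⟧ + ⟦ b ⟧ * ⟦ c ⟧) ≤ 1 + 2 * (⟦ a ⟧ * (⟦ b ⟧ * ⟦ c ⟧))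
        bits false false _     = z≤n
        bits false true  false = z≤n
        bits false true  true  = ≤-refl
        bits true  false false = z≤n
        bits true  false true  = ≤-refl
        bits true  true  false = ≤-refl
        bits true  true  true  = ≤-refl
        pointwise : ∀ x y z → A₃ x y z * d x y + (A₃ x y z * d x z + A₃ x y z * d y z) ≤ m * A₃ x y z + 2 * ∑ L (A₄ x y z)
        pointwise x y z = begin
          a * d x y + (a * d x z + a * d y z)
            ≡⟨ lem₁ a (d x y) (d x z) (d y z) ⟩
          a * (d x y + (d x z + d y z))
            ≡⟨ cong (a *_) (trans (∑-+ L (C₂ x y) (λ w → C₂ x z w + C₂ y z w)) (cong (d x y +_) (∑-+ L (C₂ x z) (C₂ y z)))) ⟨
          a * ∑ L (λ w → C₂ x y w + (C₂ x z w + C₂ y z w))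
            ≤⟨ *-monoʳ-≤ a (∑-mono L λ {w} _ → bits (adj x w) (adj y w) (adj z w)) ⟩
          a * ∑ L (λ w → 1 + 2 * C₃ x y z w)
            ≡⟨ cong (a *_) (trans (∑-+ L (λ _ → 1) (λ w → 2 * C₃ x y z w)) (cong₂ _+_ (∑-const L 1) (∑-*ˡ L 2 (C₃ x y z)))) ⟩
          a * (m * 1 + 2 * ∑ L (C₃ x y z))
            ≡⟨ lem₂ a m _ ⟩
          m * a + 2 * (a * ∑ L (C₃ x y z))
            ≡⟨ cong (λ t → m * a + 2 * t) (∑-*ˡ L a (C₃ x y z)) ⟨
          m * a + 2 * ∑ L (A₄ x y z) ∎
          where
            a = A₃ x y z
            lem₁ : ∀ a p q r → a * p + (a * q + a * r) ≡ a * (p + (q + r))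
            lem₁ = solve-∀
            lem₂ : ∀ a m p → a * (m * 1 + 2 * p) ≡ m * a + 2 * (a * p)
            lem₂ = solve-∀

    -- A vertex is joined to all of at most one triangle of a K₄, unless it is joined to the whole
    -- K₄ and hence to all four triangles; this is the pointwise bound 1 + 3 · [all four].
    Q₃-bound : 4 * Q₃ ≤ m * K₄ L + 3 * K₅ L
    Q₃-bound = begin
      4 * Q₃
        ≡⟨ lem Q₃ ⟩
      Q₃ + (Q₃ + (Q₃ + Q₃))
        ≡⟨ cong₂ _+_ q₁ (cong₂ _+_ q₂ (cong₂ _+_ q₃ q₄)) ⟩
      ∑⁴ f₁ + (∑⁴ f₂ + (∑⁴ f₃ + ∑⁴ f₄))
        ≡⟨ trans (∑⁴-+ f₁ _) (cong (∑⁴ f₁ +_) (trans (∑⁴-+ f₂ _) (cong (∑⁴ f₂ +_) (∑⁴-+ f₃ f₄)))) ⟨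
      ∑⁴ (λ x y z w → f₁ x y z w + (f₂ x y z w + (f₃ x y z w + f₄ x y z w)))
        ≤⟨ ∑⁴-mono pointwise ⟩
      ∑⁴ (λ x y z w → m * A₄ x y z w + 3 * ∑ L (A₅ x y z w))
        ≡⟨ ∑⁴-+ (λ x y z w → m * A₄ x y z w) (λ x y z w → 3 * ∑ L (A₅ x y z w)) ⟩
      ∑⁴ (λ x y z w → m * A₄ x y z w) + ∑⁴ (λ x y z w → 3 * ∑ L (A₅ x y z w))
        ≡⟨ cong₂ _+_ (∑⁴-*ˡ m A₄) (∑⁴-*ˡ 3 (λ x y z w → ∑ L (A₅ x y z w))) ⟩
      m * K₄ L + 3 * K₅ L ∎
      where
        open ≤-Reasoning
        f₁ f₂ f₃ f₄ : V → V → V → V → ℕ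
        f₁ x y z w = A₄ x y z w * e x y z
        f₂ x y z w = A₄ x y z w * e x y w
        f₃ x y z w = A₄ x y z w * e x z w
        f₄ x y z w = A₄ x y z w * e y z w
        ∑⁴ : (V → V → V → V → ℕ) → ℕ
        ∑⁴ f = ∑ L λ x → ∑ L λ y → ∑ L λ z → ∑ L λ w → f x y z w
        ∑⁴-+ : ∀ f g → ∑⁴ (λ x y z w → f x y z w + g x y z w) ≡ ∑⁴ f + ∑⁴ g
        ∑⁴-+ f g = trans (∑-cong L λ _ → trans (∑-cong L λ _ → trans (∑-cong L λ _ → ∑-+ L _ _) (∑-+ L _ _)) (∑-+ L _ _)) (∑-+ L _ _)
        ∑⁴-*ˡ : ∀ c f → ∑⁴ (λ x y z w → c * f x y z w) ≡ c * ∑⁴ f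
        ∑⁴-*ˡ c f = trans (∑-cong L λ _ → trans (∑-cong L λ _ → trans (∑-cong L λ _ → ∑-*ˡ L c _) (∑-*ˡ L c _)) (∑-*ˡ L c _)) (∑-*ˡ L c _)
        ∑⁴-mono : ∀ {f g} → (∀ x y z w → f x y z w ≤ g x y z w) → ∑⁴ f ≤ ∑⁴ g
        ∑⁴-mono h = ∑-mono L λ _ → ∑-mono L λ _ → ∑-mono L λ _ → ∑-mono L λ _ → h _ _ _ _
        lem : ∀ q → 4 * q ≡ q + (q + (q + q))
        lem = solve-∀
        q₁ : Q₃ ≡ ∑⁴ f₁
        q₁ = ∑-cong L λ {x} _ → ∑-cong L λ {y} _ → ∑-cong L λ {z} _ →
               trans (sym (*-assoc (A₃ x y z) (e x y z) (e x y z)))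
               (trans (cong (_* e x y z) (sym (∑-*ˡ L (A₃ x y z) (C₃ x y z)))) (sym (∑-*ʳ L (e x y z) _)))
        q₂ : Q₃ ≡ ∑⁴ f₂
        q₂ = trans q₁ (∑-cong L λ {x} _ → ∑-cong L λ {y} _ → trans (∑-comm L L _)
               (∑-cong L λ {w} _ → ∑-cong L λ {z} _ → cong (_* e x y z) (A₄-swap₃₄ x y z w)))
        q₃ : Q₃ ≡ ∑⁴ f₃
        q₃ = trans q₂ (∑-cong L λ {x} _ → trans (∑-comm L L _)
               (∑-cong L λ {z} _ → ∑-cong L λ {y} _ → ∑-cong L λ {w} _ → cong (_* e x y w) (A₄-swap₂₃ x y z w)))
        q₄ : Q₃ ≡ ∑⁴ f₄
        q₄ = trans q₃ (trans (∑-comm L L _)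
               (∑-cong L λ {y} _ → ∑-cong L λ {x} _ → ∑-cong L λ {z} _ → ∑-cong L λ {w} _ → cong (_* e x z w) (A₄-swap₁₂ x y z w)))
        bits : ∀ a b c d → ⟦ a ⟧ * (⟦ b ⟧ * ⟦ c ⟧) + (⟦ a ⟧ * (⟦ b ⟧ * ⟦ d ⟧) + (⟦ a ⟧ * (⟦ c ⟧ * ⟦ d ⟧) + ⟦ b ⟧ * (⟦ c ⟧ * ⟦ d ⟧)))
                     ≤ 1 + 3 * (⟦ a ⟧ * (⟦ b ⟧ * (⟦ c ⟧ * ⟦ d ⟧)))
        bits false false c     d     = z≤n
        bits false true  false d     = z≤n
        bits false true  true  false = z≤n
        bits false true  true  true  = ≤-refl
        bits true  false false d     = z≤n
        bits true  false true  false = z≤n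
        bits true  false true  true  = ≤-refl
        bits true  true  false false = z≤n
        bits true  true  false true  = ≤-refl
        bits true  true  true  false = ≤-refl
        bits true  true  true  true  = ≤-refl
        pointwise : ∀ x y z w → f₁ x y z w + (f₂ x y z w + (f₃ x y z w + f₄ x y z w)) ≤ m * A₄ x y z w + 3 * ∑ L (A₅ x y z w)
        pointwise x y z w = begin
          a * e x y z + (a * e x y w + (a * e x z w + a * e y z w))
            ≡⟨ lem₁ a (e x y z) (e x y w) (e x z w) (e y z w) ⟩
          a * (e x y z + (e x y w + (e x z w + e y z w)))
            ≡⟨ cong (a *_) (trans (∑-+ L (C₃ x y z) _) (cong (e x y z +_) (trans (∑-+ L (C₃ x y w) _) (cong (e x y w +_) (∑-+ L (C₃ x z w) (C₃ y z w)))))) ⟨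
          a * ∑ L (λ u → C₃ x y z u + (C₃ x y w u + (C₃ x z w u + C₃ y z w u)))
            ≤⟨ *-monoʳ-≤ a (∑-mono L λ {u} _ → bits (adj x u) (adj y u) (adj z u) (adj w u)) ⟩
          a * ∑ L (λ u → 1 + 3 * C₄ x y z w u)
            ≡⟨ cong (a *_) (trans (∑-+ L (λ _ → 1) (λ u → 3 * C₄ x y z w u)) (cong₂ _+_ (∑-const L 1) (∑-*ˡ L 3 (C₄ x y z w)))) ⟩
          a * (m * 1 + 3 * ∑ L (C₄ x y z w))
            ≡⟨ lem₂ a m _ ⟩
          m * a + 3 * (a * ∑ L (C₄ x y z w))
            ≡⟨ cong (λ t → m * a + 3 * t) (∑-*ˡ L a (C₄ x y z w)) ⟨
          m * a + 3 * ∑ L (A₅ x y z w) ∎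
          where
            a = A₄ x y z w
            lem₁ : ∀ a p q r s → a * p + (a * q + (a * r + a * s)) ≡ a * (p + (q + (r + s)))
            lem₁ = solve-∀
            lem₂ : ∀ a m p → a * (m * 1 + 3 * p) ≡ m * a + 3 * (a * p)
            lem₂ = solve-∀

    -- Tangent-line bounds on the squares, at the values d = 3m/5 and e = 2m/5 taken in the Turán graph T(m,5).
    Q₂-tangent : 30 * m * K₃ L ≤ 25 * Q₂ + 9 * (m * m) * K₂ L
    Q₂-tangent = begin
      30 * m * K₃ L
        ≡⟨ cong (30 * m *_) K₃≡ ⟩
      30 * m * ∑ L (λ x → ∑ L λ y → A x y * d x y)
        ≡⟨ trans (∑-cong L λ _ → ∑-*ˡ L (30 * m) _) (∑-*ˡ L (30 * m) _) ⟨
      ∑ L (λ x → ∑ L λ y → 30 * m * (A x y * d x y))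
        ≤⟨ ∑-mono L (λ {x} _ → ∑-mono L λ {y} _ → pointwise (A x y) (d x y)) ⟩
      ∑ L (λ x → ∑ L λ y → 25 * (A x y * (d x y * d x y)) + 9 * (m * m) * A x y)
        ≡⟨ trans (∑-cong L λ _ → ∑-+ L _ _) (∑-+ L _ _) ⟩
      ∑ L (λ x → ∑ L λ y → 25 * (A x y * (d x y * d x y))) + ∑ L (λ x → ∑ L λ y → 9 * (m * m) * A x y)
        ≡⟨ cong₂ _+_ (trans (∑-cong L λ _ → ∑-*ˡ L 25 _) (∑-*ˡ L 25 _)) (trans (∑-cong L λ _ → ∑-*ˡ L (9 * (m * m)) _) (∑-*ˡ L (9 * (m * m)) _)) ⟩
      25 * Q₂ + 9 * (m * m) * K₂ L ∎
      where
        open ≤-Reasoning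
        pointwise : ∀ a q → 30 * m * (a * q) ≤ 25 * (a * (q * q)) + 9 * (m * m) * a
        pointwise a q = begin
          30 * m * (a * q)                        ≡⟨ lem₁ m a q ⟩
          a * (2 * (5 * q * (3 * m)))             ≤⟨ *-monoʳ-≤ a (2ab≤a²+b² (5 * q) (3 * m)) ⟩
          a * (5 * q * (5 * q) + 3 * m * (3 * m)) ≡⟨ lem₂ m a q ⟩
          25 * (a * (q * q)) + 9 * (m * m) * a    ∎
          where
            lem₁ : ∀ m a q → 30 * m * (a * q) ≡ a * (2 * (5 * q * (3 * m)))
            lem₁ = solve-∀
            lem₂ : ∀ m a q → a * (5 * q * (5 * q) + 3 * m * (3 * m)) ≡ 25 * (a * (q * q)) + 9 * (m * m) * a
            lem₂ = solve-∀

    Q₃-tangent : 20 * m * K₄ L ≤ 25 * Q₃ + 4 * (m * m) * K₃ L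
    Q₃-tangent = begin
      20 * m * K₄ L
        ≡⟨ cong (20 * m *_) K₄≡ ⟩
      20 * m * ∑ L (λ x → ∑ L λ y → ∑ L λ z → A₃ x y z * e x y z)
        ≡⟨ trans (∑-cong L λ _ → trans (∑-cong L λ _ → ∑-*ˡ L (20 * m) _) (∑-*ˡ L (20 * m) _)) (∑-*ˡ L (20 * m) _) ⟨
      ∑ L (λ x → ∑ L λ y → ∑ L λ z → 20 * m * (A₃ x y z * e x y z))
        ≤⟨ ∑-mono L (λ {x} _ → ∑-mono L λ {y} _ → ∑-mono L λ {z} _ → pointwise (A₃ x y z) (e x y z)) ⟩
      ∑ L (λ x → ∑ L λ y → ∑ L λ z → 25 * (A₃ x y z * (e x y z * e x y z)) + 4 * (m * m) * A₃ x y z)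
        ≡⟨ trans (∑-cong L λ _ → trans (∑-cong L λ _ → ∑-+ L _ _) (∑-+ L _ _)) (∑-+ L _ _) ⟩
      ∑ L (λ x → ∑ L λ y → ∑ L λ z → 25 * (A₃ x y z * (e x y z * e x y z))) + ∑ L (λ x → ∑ L λ y → ∑ L λ z → 4 * (m * m) * A₃ x y z)
        ≡⟨ cong₂ _+_ (trans (∑-cong L λ _ → trans (∑-cong L λ _ → ∑-*ˡ L 25 _) (∑-*ˡ L 25 _)) (∑-*ˡ L 25 _))
                     (trans (∑-cong L λ _ → trans (∑-cong L λ _ → ∑-*ˡ L (4 * (m * m)) _) (∑-*ˡ L (4 * (m * m)) _)) (∑-*ˡ L (4 * (m * m)) _)) ⟩
      25 * Q₃ + 4 * (m * m) * K₃ L ∎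
      where
        open ≤-Reasoning
        pointwise : ∀ a q → 20 * m * (a * q) ≤ 25 * (a * (q * q)) + 4 * (m * m) * a
        pointwise a q = begin
          20 * m * (a * q)                        ≡⟨ lem₁ m a q ⟩
          a * (2 * (5 * q * (2 * m)))             ≤⟨ *-monoʳ-≤ a (2ab≤a²+b² (5 * q) (2 * m)) ⟩
          a * (5 * q * (5 * q) + 2 * m * (2 * m)) ≡⟨ lem₂ m a q ⟩
          25 * (a * (q * q)) + 4 * (m * m) * a    ∎
          where
            lem₁ : ∀ m a q → 20 * m * (a * q) ≡ a * (2 * (5 * q * (2 * m)))
            lem₁ = solve-∀
            lem₂ : ∀ m a q → a * (5 * q * (5 * q) + 2 * m * (2 * m)) ≡ 25 * (a * (q * q)) + 4 * (m * m) * a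
            lem₂ = solve-∀

    -- Linear consequence of the two Moon-Moser inequalities and their tangent lines, bounding K₅
    -- from below. All four are equalities for T(m,5) with equal parts, and so is the result.
    K₃≤K₅+K₂ : 185 * (m * m * K₃ L) ≤ 250 * K₅ L + 99 * (m * m * m * K₂ L)
    K₃≤K₅+K₂ = combine m (K₂ L) (K₃ L) (K₄ L) (K₅ L) Q₂ Q₃ Q₂-bound Q₃-bound Q₂-tangent Q₃-tangent
      where
        open ≤-Reasoning
        combine : ∀ m a b c d p q → 3 * p ≤ m * b + 2 * c → 4 * q ≤ m * c + 3 * d →
                  30 * m * b ≤ 25 * p + 9 * (m * m) * a → 20 * m * c ≤ 25 * q + 4 * (m * m) * b →
                  185 * (m * m * b) ≤ 250 * d + 99 * (m * m * m * a)
        -- Eliminating the squares gives `bc` and `cd`; adding 55m times `bc` and 50 times `cd`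
        -- makes the K₄ terms 2750mc cancel.
        combine m a b c d p q hp hq tp tq = *-cancelˡ-≤ 15 (+-cancelʳ-≤ (2750 * (m * c) + 800 * (m * m * b)) _ _ (begin
          15 * (185 * (m * m * b)) + (2750 * (m * c) + 800 * (m * m * b))
            ≡⟨ lem₃ m b c ⟩
          55 * m * (65 * (m * b)) + 50 * (55 * (m * c))
            ≤⟨ +-mono-≤ (*-monoʳ-≤ (55 * m) bc) (*-monoʳ-≤ 50 cd) ⟩
          55 * m * (50 * c + 27 * (m * m * a)) + 50 * (75 * d + 16 * (m * m * b))
            ≡⟨ lem₄ m a b c d ⟩
          15 * (250 * d + 99 * (m * m * m * a)) + (2750 * (m * c) + 800 * (m * m * b)) ∎))
          where
            lem₃ : ∀ m b c → 15 * (185 * (m * m * b)) + (2750 * (m * c) + 800 * (m * m * b)) ≡ 55 * m * (65 * (m * b)) + 50 * (55 * (m * c))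
            lem₃ = solve-∀
            lem₄ : ∀ m a b c d → 55 * m * (50 * c + 27 * (m * m * a)) + 50 * (75 * d + 16 * (m * m * b)) ≡ 15 * (250 * d + 99 * (m * m * m * a)) + (2750 * (m * c) + 800 * (m * m * b))
            lem₄ = solve-∀
            bc : 65 * (m * b) ≤ 50 * c + 27 * (m * m * a)
            bc = +-cancelʳ-≤ (25 * (m * b)) _ _ (begin
              65 * (m * b) + 25 * (m * b)                     ≡⟨ l₁ m b ⟩
              3 * (30 * m * b)                                ≤⟨ *-monoʳ-≤ 3 tp ⟩
              3 * (25 * p + 9 * (m * m) * a)                  ≡⟨ l₂ m a p ⟩
              25 * (3 * p) + 27 * (m * m * a)                 ≤⟨ +-monoˡ-≤ (27 * (m * m * a)) (*-monoʳ-≤ 25 hp) ⟩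
              25 * (m * b + 2 * c) + 27 * (m * m * a)         ≡⟨ l₃ m a b c ⟩
              50 * c + 27 * (m * m * a) + 25 * (m * b)        ∎)
              where
                l₁ : ∀ m b → 65 * (m * b) + 25 * (m * b) ≡ 3 * (30 * m * b)
                l₁ = solve-∀
                l₂ : ∀ m a p → 3 * (25 * p + 9 * (m * m) * a) ≡ 25 * (3 * p) + 27 * (m * m * a)
                l₂ = solve-∀
                l₃ : ∀ m a b c → 25 * (m * b + 2 * c) + 27 * (m * m * a) ≡ 50 * c + 27 * (m * m * a) + 25 * (m * b)
                l₃ = solve-∀
            cd : 55 * (m * c) ≤ 75 * d + 16 * (m * m * b)
            cd = +-cancelʳ-≤ (25 * (m * c)) _ _ (begin
              55 * (m * c) + 25 * (m * c)                     ≡⟨ l₁ m c ⟩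
              4 * (20 * m * c)                                ≤⟨ *-monoʳ-≤ 4 tq ⟩
              4 * (25 * q + 4 * (m * m) * b)                  ≡⟨ l₂ m b q ⟩
              25 * (4 * q) + 16 * (m * m * b)                 ≤⟨ +-monoˡ-≤ (16 * (m * m * b)) (*-monoʳ-≤ 25 hq) ⟩
              25 * (m * c + 3 * d) + 16 * (m * m * b)         ≡⟨ l₃ m b c d ⟩
              75 * d + 16 * (m * m * b) + 25 * (m * c)        ∎)
              where
                l₁ : ∀ m c → 55 * (m * c) + 25 * (m * c) ≡ 4 * (20 * m * c)
                l₁ = solve-∀
                l₂ : ∀ m b q → 4 * (25 * q + 4 * (m * m) * b) ≡ 25 * (4 * q) + 16 * (m * m * b)
                l₂ = solve-∀
                l₃ : ∀ m b c d → 25 * (m * c + 3 * d) + 16 * (m * m * b) ≡ 75 * d + 16 * (m * m * b) + 25 * (m * c)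
                l₃ = solve-∀

  -- Dividing the first count by 2 K₂ L gives 6c ≤ K₃ - K₅/(2 K₂). For T(m,5) with parts of size q
  -- this is 60q³ - 3q³, that is c ≤ 19q³/2 = 19m³/250. Every estimate used is an equality there, so
  -- the constant is the value at T(m,5).
  packing-count : ∀ L c → Free 5 L → 12 * K₂ L * c + K₅ L ≤ 2 * K₂ L * K₃ L → 6 * c ≤ K₃ L →
                  250 * c ≤ 19 * (length L * length L * length L)
  packing-count L c free h h₀ = go (K₂ L) refl
    where
      open ≤-Reasoning
      m = length L
      k2 : 5 * K₂ L ≤ 4 * (m * m)
      k2 = proj₁ (Turán-bounds 5 L free)
      k3 : 25 * K₃ L ≤ 12 * (m * m * m)
      k3 = proj₂ (Turán-bounds 5 L free)
      K₃≤ : K₃ L ≤ K₂ L * m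
      K₃≤ = ≤-trans (∑-mono L λ {x} _ → ∑-mono L λ {y} _ → ≤-trans (≤-reflexive (∑-*ˡ L (A x y) _))
              (*-monoʳ-≤ (A x y) (≤-trans (∑-≤-const L 1 λ {z} _ → *-mono-≤ (A≤1 x z) (A≤1 y z)) (≤-reflexive (*-identityʳ m)))))
              (≤-reflexive (trans (∑-cong L λ _ → ∑-*ʳ L m _) (∑-*ʳ L m _)))
      -- κ stands for K₂ L, and is cancelled once it is known to be positive.
      main : ∀ κ → 5 * κ ≤ 4 * (m * m) → 12 * κ * c + K₅ L ≤ 2 * κ * K₃ L →
             185 * (m * m * K₃ L) ≤ 250 * K₅ L + 99 * (m * m * m * κ) → κ * (12000 * c) ≤ κ * (912 * (m * m * m))
      main κ hκ hc mm = +-cancelʳ-≤ (1000 * K₅ L + 925 * κ * K₃ L) _ _ (begin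
        κ * (12000 * c) + (1000 * K₅ L + 925 * κ * K₃ L)
          ≡⟨ l₁ κ c (K₃ L) (K₅ L) ⟩
        1000 * (12 * κ * c + K₅ L) + 185 * (5 * κ * K₃ L)
          -- Passing from 5κ to 4m² makes `mm` applicable. Afterwards the K₅ terms cancel and all
          -- remaining terms are multiples of κ, since 2000 - 925 = 43 · 25.
          ≤⟨ +-mono-≤ (*-monoʳ-≤ 1000 hc) (*-monoʳ-≤ 185 (*-monoˡ-≤ (K₃ L) hκ)) ⟩
        1000 * (2 * κ * K₃ L) + 185 * (4 * (m * m) * K₃ L)
          ≡⟨ l₂ κ (K₃ L) (m * m) ⟩
        2000 * (κ * K₃ L) + 4 * (185 * (m * m * K₃ L))
          ≤⟨ +-monoʳ-≤ (2000 * (κ * K₃ L)) (*-monoʳ-≤ 4 mm) ⟩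
        2000 * (κ * K₃ L) + 4 * (250 * K₅ L + 99 * (m * m * m * κ))
          ≡⟨ l₃ κ (K₃ L) (K₅ L) (m * m * m) ⟩
        κ * (43 * (25 * K₃ L)) + κ * (396 * (m * m * m)) + (1000 * K₅ L + 925 * κ * K₃ L)
          ≤⟨ +-monoˡ-≤ _ (+-monoˡ-≤ _ (*-monoʳ-≤ κ (*-monoʳ-≤ 43 k3))) ⟩
        κ * (43 * (12 * (m * m * m))) + κ * (396 * (m * m * m)) + (1000 * K₅ L + 925 * κ * K₃ L)
          ≡⟨ cong (_+ (1000 * K₅ L + 925 * κ * K₃ L)) (l₄ κ (m * m * m)) ⟩
        κ * (912 * (m * m * m)) + (1000 * K₅ L + 925 * κ * K₃ L) ∎)
        where
          l₁ : ∀ κ c b d → κ * (12000 * c) + (1000 * d + 925 * κ * b) ≡ 1000 * (12 * κ * c + d) + 185 * (5 * κ * b)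
          l₁ = solve-∀
          l₂ : ∀ κ b t → 1000 * (2 * κ * b) + 185 * (4 * t * b) ≡ 2000 * (κ * b) + 4 * (185 * (t * b))
          l₂ = solve-∀
          l₃ : ∀ κ b d t → 2000 * (κ * b) + 4 * (250 * d + 99 * (t * κ)) ≡ κ * (43 * (25 * b)) + κ * (396 * t) + (1000 * d + 925 * κ * b)
          l₃ = solve-∀
          l₄ : ∀ κ t → κ * (43 * (12 * t)) + κ * (396 * t) ≡ κ * (912 * t)
          l₄ = solve-∀
      go : ∀ κ → K₂ L ≡ κ → 250 * c ≤ 19 * (m * m * m)
      -- Without edges κ cannot be cancelled; then there are no triangles either, and 6c ≤ K₃ L
      -- forces c = 0.
      go zero    eq = subst (λ t → 250 * t ≤ 19 * (m * m * m)) (sym c≡0) z≤n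
        where c≡0 : c ≡ 0
              c≡0 = n≤0⇒n≡0 (*-cancelˡ-≤ 6 (≤-trans h₀ (≤-trans K₃≤ (≤-reflexive (cong (_* m) eq)))))
      go (suc κ) eq = *-cancelˡ-≤ 48 (*-cancelˡ-≤ (suc κ) (begin
        suc κ * (48 * (250 * c))         ≡⟨ cong (suc κ *_) (l₁ c) ⟩
        suc κ * (12000 * c)              ≤⟨ main (suc κ) (subst (λ κ → 5 * κ ≤ 4 * (m * m)) eq k2) (subst (λ κ → 12 * κ * c + K₅ L ≤ 2 * κ * K₃ L) eq h)
                                              (subst (λ κ → 185 * (m * m * K₃ L) ≤ 250 * K₅ L + 99 * (m * m * m * κ)) eq (MoonMoser.K₃≤K₅+K₂ L)) ⟩
        suc κ * (912 * (m * m * m))      ≡⟨ cong (suc κ *_) (l₂ (m * m * m)) ⟩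
        suc κ * (48 * (19 * (m * m * m))) ∎))
        where
          l₁ : ∀ c → 48 * (250 * c) ≡ 12000 * c
          l₁ = solve-∀
          l₂ : ∀ t → 912 * t ≡ 48 * (19 * t)
          l₂ = solve-∀

-- Symmetric sets of triangles, and the K₅ destroyed when one K₅ is used.

module TriangleSets {n : ℕ} (G : Graph n) where
  open Cliques G
  open TuránBounds G
  open MoonMoserBounds G

  Clique⇒Unique : ∀ {K} → Clique K → Unique K
  Clique⇒Unique = AllPairs.map λ { h refl → ~-irrefl h }

  Clique-adj : ∀ {K x y} → Clique K → x ∈ K → y ∈ K → x ≢ y → x ~ y
  Clique-adj (h ∷ c) (here refl) (here refl) ne = contradiction refl ne
  Clique-adj (h ∷ c) (here refl) (there y∈)  _  = All.lookup h y∈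
  Clique-adj (h ∷ c) (there x∈)  (here refl) _  = ~-sym (All.lookup h x∈)
  Clique-adj (h ∷ c) (there x∈)  (there y∈)  ne = Clique-adj c x∈ y∈ ne

  Unique⊑Clique : ∀ {Z K} → Clique K → Unique Z → Z ⊑ K → Clique Z
  Unique⊑Clique c []       []       = []
  Unique⊑Clique c (h ∷ u) (z∈ ∷ i) = All.tabulate (λ w∈ → Clique-adj c z∈ (All.lookup i w∈) (All.lookup h w∈)) ∷ Unique⊑Clique c u i

  k₃-small : ∀ Z → length Z ≤ 3 → K₃ Z ≤ 6
  k₃-small Z h = begin
    K₃ Z                        ≡⟨ K₃≡6k₃ Z ⟩
    6 * k₃ Z                    ≤⟨ *-monoʳ-≤ 6 (∑-≤-const (triples Z) 1 λ { {x , y , z} _ → *-mono-≤ (A≤1 x y) (*-mono-≤ (A≤1 x z) (A≤1 y z)) }) ⟩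
    6 * (length (triples Z) * 1) ≤⟨ *-monoʳ-≤ 6 (*-monoˡ-≤ 1 (length-triples-≤3 Z h)) ⟩
    6                           ∎
    where open ≤-Reasoning

  member : List V → V → Bool
  member X x = ⌊ any? (x ≟ᵥ_) X ⌋

  -- A decidable set of triangles that shrinks as the greedy choice proceeds. Invariance under two
  -- transpositions makes membership independent of the order, so adjacency in one position pair
  -- yields the others.
  record Triangles : Set where
    field
      holds  : V → V → V → Bool
      swap₁₂ : ∀ x y z → holds x y z ≡ holds y x z
      swap₂₃ : ∀ x y z → holds x y z ≡ holds x z y
      adj₁₂  : ∀ {x y z} → T (holds x y z) → x ~ y

    weight : V → V → V → ℕ
    weight x y z = ⟦ holds x y z ⟧
    total : List V → ℕ
    total L = ∑ L λ x → ∑ L λ y → ∑ L λ z → weight x y z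
    onTriple : V × V × V → Bool
    onTriple (x , y , z) = holds x y z
    adj₁₃ : ∀ {x y z} → T (holds x y z) → x ~ z
    adj₁₃ {x} {y} {z} h = adj₁₂ (subst T (swap₂₃ x y z) h)
    adj₂₃ : ∀ {x y z} → T (holds x y z) → y ~ z
    adj₂₃ {x} {y} {z} h = adj₁₃ (subst T (swap₁₂ x y z) h)
    diag : ∀ x z → weight x x z ≡ 0
    diag x z with holds x x z in eq
    ... | false = refl
    ... | true  = contradiction (adj₁₂ {x} {x} {z} (subst T (sym eq) _)) ~-irrefl
    total≡ : ∀ L → total L ≡ 6 * length (sift onTriple (triples L))
    total≡ L = trans (∑-triples L weight (λ x y z → cong ⟦_⟧ (swap₁₂ x y z)) (λ x y z → cong ⟦_⟧ (swap₂₃ x y z)) diag)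
                     (cong (6 *_) (sym (length-sift onTriple (triples L))))
    quintuples : List V → ℕ
    quintuples L = ∑ L λ a → ∑ L λ b → ∑ L λ c → ∑ L λ d → ∑ L λ e →
      A₅ a b c d e * ⟦ all onTriple (triples (a ∷ b ∷ c ∷ d ∷ e ∷ [])) ⟧

  open Triangles

  -- Only triangles wholly inside X are dropped, for these are the ones covered by the cliques v +
  -- (X ∩ N(v)).
  avoiding : Triangles → List V → Triangles
  avoiding τ X = record
    { holds  = λ x y z → holds τ x y z ∧ not (member X x ∧ (member X y ∧ member X z))
    ; swap₁₂ = λ x y z → cong₂ _∧_ (swap₁₂ τ x y z) (cong not (∧-leftComm (member X x) (member X y) (member X z)))
    ; swap₂₃ = λ x y z → cong₂ _∧_ (swap₂₃ τ x y z) (cong (λ t → not (member X x ∧ t)) (∧-comm (member X y) (member X z)))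
    ; adj₁₂  = λ {x} {y} {z} h → adj₁₂ τ {x} {y} {z} (proj₁ (Equivalence.to T-∧ h))
    }

  module Conflicts (R X : List V) (R! : Unique R) (free : Free 5 R) (cX : Clique X) where

    private
      ∑⁵ : (V → V → V → V → V → ℕ) → ℕ
      ∑⁵ h = ∑ R λ a → ∑ R λ b → ∑ R λ c → ∑ R λ d → ∑ R λ e → A₅ a b c d e * h a b c d e

      in₃ : V → V → V → ℕ
      in₃ x y z = ⟦ member X x ∧ (member X y ∧ member X z) ⟧

      -- The number of ordered K₅ is unchanged when two neighbouring positions are exchanged. Such
      -- exchanges carry each of the ten position triples to the last three.
      swap-ab : ∀ h → ∑⁵ (λ a b c d e → h b a c d e) ≡ ∑⁵ h
      swap-ab h = trans (∑-comm R R _) (∑-cong R λ {b} _ → ∑-cong R λ {a} _ → ∑-cong R λ {c} _ → ∑-cong R λ {d} _ → ∑-cong R λ {e} _ →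
        cong (_* h b a c d e) (cong₂ _*_ (A₄-swap₁₂ a b c d) (lem (A a e) (A b e) _)))
        where lem : ∀ a b c → a * (b * c) ≡ b * (a * c)
              lem = solve-∀

      swap-bc : ∀ h → ∑⁵ (λ a b c d e → h a c b d e) ≡ ∑⁵ h
      swap-bc h = ∑-cong R λ {a} _ → trans (∑-comm R R _) (∑-cong R λ {c} _ → ∑-cong R λ {b} _ → ∑-cong R λ {d} _ → ∑-cong R λ {e} _ →
        cong (_* h a c b d e) (cong₂ _*_ (A₄-swap₂₃ a b c d) (cong (A a e *_) (lem (A b e) (A c e) _))))
        where lem : ∀ a b c → a * (b * c) ≡ b * (a * c)
              lem = solve-∀

      swap-cd : ∀ h → ∑⁵ (λ a b c d e → h a b d c e) ≡ ∑⁵ h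
      swap-cd h = ∑-cong R λ {a} _ → ∑-cong R λ {b} _ → trans (∑-comm R R _) (∑-cong R λ {d} _ → ∑-cong R λ {c} _ → ∑-cong R λ {e} _ →
        cong (_* h a b d c e) (cong₂ _*_ (A₄-swap₃₄ a b c d) (cong (λ t → A a e * (A b e * t)) (*-comm (A c e) (A d e)))))

      swap-de : ∀ h → ∑⁵ (λ a b c d e → h a b c e d) ≡ ∑⁵ h
      swap-de h = ∑-cong R λ {a} _ → ∑-cong R λ {b} _ → ∑-cong R λ {c} _ → trans (∑-comm R R _) (∑-cong R λ {e} _ → ∑-cong R λ {d} _ →
        cong (_* h a b c e d) (trans (cong (λ t → A₃ a b c * (A a d * (A b d * A c d)) * (A a e * (A b e * (A c e * t)))) (A-sym d e))
          (lem (A₃ a b c) (A a d) (A b d) (A c d) (A a e) (A b e) (A c e) (A e d))))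
        where lem : ∀ k p q r s t u v → k * (p * (q * r)) * (s * (t * (u * v))) ≡ k * (s * (t * u)) * (p * (q * (r * v)))
              lem = solve-∀

      common : V → V → V → Bool
      common a b x = member X x ∧ (adj a x ∧ adj b x)

      -- Together with a and b, four common neighbours in X would form a K₆.
      common-bound : ∀ {a b} → a ∈ R → b ∈ R → a ~ b → length (sift (common a b) R) ≤ 3
      common-bound {a} {b} a∈ b∈ ab = s≤s⁻¹ (s≤s⁻¹ (free (a ∷ b ∷ Z)
        ((ab ∷ All.tabulate (λ h → proj₁ (adjs h))) ∷ All.tabulate (λ h → proj₂ (adjs h)) ∷
          Unique⊑Clique cX (AllPairs.filter⁺ _ R!) (All.tabulate λ h → toWitness (proj₁ (bits h))))
        (a∈ ∷ b∈ ∷ All.tabulate λ h → proj₁ (∈-sift⁻ (common a b) {R} h))))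
        where
          Z = sift (common a b) R
          bits : ∀ {x} → x ∈ Z → T (member X x) × T (adj a x ∧ adj b x)
          bits h = Equivalence.to T-∧ (proj₂ (∈-sift⁻ (common a b) {R} h))
          adjs : ∀ {x} → x ∈ Z → a ~ x × b ~ x
          adjs h = Equivalence.to T-∧ (proj₂ (bits h))

      -- For a fixed edge ab, the triples cde in X that complete a K₅ are the ordered triangles
      -- among the common neighbours of a and b in X.
      inner : ∀ a b → ∑ R (λ c → ∑ R λ d → ∑ R λ e → A₅ a b c d e * in₃ c d e) ≡ A a b * K₃ (sift (common a b) R)
      inner a b = begin
        ∑ R (λ c → ∑ R λ d → ∑ R λ e → A₅ a b c d e * in₃ c d e)
          ≡⟨ ∑-cong R (λ {c} _ → ∑-cong R λ {d} _ → ∑-cong R λ {e} _ → pointwise c d e) ⟩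
        ∑ R (λ c → ∑ R λ d → ∑ R λ e → A a b * (g c * (g d * (g e * A₃ c d e))))
          ≡⟨ trans (∑-cong R λ _ → trans (∑-cong R λ _ → ∑-*ˡ R (A a b) _) (∑-*ˡ R (A a b) _)) (∑-*ˡ R (A a b) _) ⟩
        A a b * ∑ R (λ c → ∑ R λ d → ∑ R λ e → g c * (g d * (g e * A₃ c d e)))
          ≡⟨ cong (A a b *_) (∑-cong R λ {c} _ → trans (∑-cong R λ {d} _ → trans (∑-*ˡ R (g c) _) (cong (g c *_) (∑-*ˡ R (g d) _))) (∑-*ˡ R (g c) _)) ⟩
        A a b * ∑ R (λ c → g c * ∑ R λ d → g d * ∑ R λ e → g e * A₃ c d e)
          ≡⟨ cong (A a b *_) (trans (∑-sift (common a b) R _) (∑-cong R λ {c} _ → cong (g c *_)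
               (trans (∑-sift (common a b) R _) (∑-cong R λ {d} _ → cong (g d *_) (∑-sift (common a b) R _))))) ⟨
        A a b * K₃ (sift (common a b) R) ∎
        where
          open ≡-Reasoning
          g : V → ℕ
          g x = ⟦ common a b x ⟧
          g≡ : ∀ x → g x ≡ ⟦ member X x ⟧ * (A a x * A b x)
          g≡ x = trans (⟦∧⟧ (member X x) _) (cong (⟦ member X x ⟧ *_) (⟦∧⟧ (adj a x) (adj b x)))
          in₃≡ : ∀ c d e → in₃ c d e ≡ ⟦ member X c ⟧ * (⟦ member X d ⟧ * ⟦ member X e ⟧)
          in₃≡ c d e = trans (⟦∧⟧ (member X c) _) (cong (⟦ member X c ⟧ *_) (⟦∧⟧ (member X d) (member X e)))
          lem : ∀ ab ac bc ad bd cd ae be ce de mc md me →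
            (ab * (ac * bc)) * (ad * (bd * cd)) * (ae * (be * (ce * de))) * (mc * (md * me))
            ≡ ab * ((mc * (ac * bc)) * ((md * (ad * bd)) * ((me * (ae * be)) * (cd * (ce * de)))))
          lem = solve-∀
          pointwise : ∀ c d e → A₅ a b c d e * in₃ c d e ≡ A a b * (g c * (g d * (g e * A₃ c d e)))
          pointwise c d e rewrite g≡ c | g≡ d | g≡ e | in₃≡ c d e =
            lem (A a b) (A a c) (A b c) (A a d) (A b d) (A c d) (A a e) (A b e) (A c e) (A d e) ⟦ member X c ⟧ ⟦ member X d ⟧ ⟦ member X e ⟧

      cde≤ : ∑⁵ (λ a b c d e → in₃ c d e) ≤ 6 * K₂ R
      cde≤ = begin
        ∑⁵ (λ a b c d e → in₃ c d e)
          ≡⟨ ∑-cong R (λ {a} _ → ∑-cong R λ {b} _ → inner a b) ⟩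
        ∑ R (λ a → ∑ R λ b → A a b * K₃ (sift (common a b) R))
          ≤⟨ ∑-mono R (λ a∈ → ∑-mono R λ b∈ → pointwise a∈ b∈) ⟩
        ∑ R (λ a → ∑ R λ b → 6 * A a b)
          ≡⟨ trans (∑-cong R λ _ → ∑-*ˡ R 6 _) (∑-*ˡ R 6 _) ⟩
        6 * K₂ R ∎
        where
          open ≤-Reasoning
          pointwise : ∀ {a b} → a ∈ R → b ∈ R → A a b * K₃ (sift (common a b) R) ≤ 6 * A a b
          pointwise {a} {b} a∈ b∈ with adj a b | common-bound a∈ b∈
          ... | false | _ = z≤n
          ... | true  | h = ≤-trans (≤-reflexive (*-identityˡ _)) (k₃-small (sift (common a b) R) (h _))

    -- A K₅ lost to X has one of its ten triples inside X. Its other two vertices span one of the K₂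
    -- R ordered edges, whose at most three common neighbours in X allow six orders of the triple:
    -- 10 · 6 · K₂ R in all.
    conflicts : ∀ τ → quintuples τ R ≤ quintuples (avoiding τ X) R + 60 * K₂ R
    conflicts τ = begin
      quintuples τ R
        ≤⟨ ∑-mono R (λ {a} _ → ∑-mono R λ {b} _ → ∑-mono R λ {c} _ → ∑-mono R λ {d} _ → ∑-mono R λ {e} _ →
             ≤-trans (*-monoʳ-≤ (A₅ a b c d e) (pointwise (triples (a ∷ b ∷ c ∷ d ∷ e ∷ [])))) (≤-reflexive (expand a b c d e))) ⟩
      ∑⁵′ (λ a b c d e → f₀ a b c d e + (f₁ a b c d e + (f₂ a b c d e + (f₃ a b c d e + (f₄ a b c d e + (f₅ a b c d e + (f₆ a b c d e + (f₇ a b c d e + (f₈ a b c d e + (f₉ a b c d e + f₁₀ a b c d e))))))))))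
        ≡⟨ trans (∑⁵′-+ f₀ _) (cong (∑⁵′ f₀ +_) (trans (∑⁵′-+ f₁ _) (cong (∑⁵′ f₁ +_) (trans (∑⁵′-+ f₂ _) (cong (∑⁵′ f₂ +_) (trans (∑⁵′-+ f₃ _) (cong (∑⁵′ f₃ +_)
           (trans (∑⁵′-+ f₄ _) (cong (∑⁵′ f₄ +_) (trans (∑⁵′-+ f₅ _) (cong (∑⁵′ f₅ +_) (trans (∑⁵′-+ f₆ _) (cong (∑⁵′ f₆ +_) (trans (∑⁵′-+ f₇ _) (cong (∑⁵′ f₇ +_)
           (trans (∑⁵′-+ f₈ _) (cong (∑⁵′ f₈ +_) (∑⁵′-+ f₉ f₁₀))))))))))))))))))  ⟩
      ∑⁵′ f₀ + (∑⁵′ f₁ + (∑⁵′ f₂ + (∑⁵′ f₃ + (∑⁵′ f₄ + (∑⁵′ f₅ + (∑⁵′ f₆ + (∑⁵′ f₇ + (∑⁵′ f₈ + (∑⁵′ f₉ + ∑⁵′ f₁₀)))))))))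
        ≤⟨ +-monoʳ-≤ (∑⁵′ f₀) (+-mono-≤ abc (+-mono-≤ abd (+-mono-≤ abe (+-mono-≤ acd (+-mono-≤ ace (+-mono-≤ ade (+-mono-≤ bcd (+-mono-≤ bce (+-mono-≤ bde cde≤))))))))) ⟩
      ∑⁵′ f₀ + (B + (B + (B + (B + (B + (B + (B + (B + (B + B)))))))))
        ≡⟨ cong (∑⁵′ f₀ +_) (lem (K₂ R)) ⟩
      quintuples (avoiding τ X) R + 60 * K₂ R ∎
      where
        open ≤-Reasoning
        B = 6 * K₂ R
        lem : ∀ k → 6 * k + (6 * k + (6 * k + (6 * k + (6 * k + (6 * k + (6 * k + (6 * k + (6 * k + 6 * k)))))))) ≡ 60 * k
        lem = solve-∀
        ∑⁵′ : (V → V → V → V → V → ℕ) → ℕ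
        ∑⁵′ h = ∑ R λ a → ∑ R λ b → ∑ R λ c → ∑ R λ d → ∑ R λ e → h a b c d e
        ∑⁵′-+ : ∀ f g → ∑⁵′ (λ a b c d e → f a b c d e + g a b c d e) ≡ ∑⁵′ f + ∑⁵′ g
        ∑⁵′-+ f g = trans (∑-cong R λ _ → trans (∑-cong R λ _ → trans (∑-cong R λ _ → trans (∑-cong R λ _ → ∑-+ R _ _) (∑-+ R _ _)) (∑-+ R _ _)) (∑-+ R _ _)) (∑-+ R _ _)
        in₃′ : V × V × V → ℕ
        in₃′ (x , y , z) = in₃ x y z
        f₀ f₁ f₂ f₃ f₄ f₅ f₆ f₇ f₈ f₉ f₁₀ : V → V → V → V → V → ℕ
        f₀ a b c d e = A₅ a b c d e * ⟦ all (onTriple (avoiding τ X)) (triples (a ∷ b ∷ c ∷ d ∷ e ∷ [])) ⟧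
        f₁ a b c d e = A₅ a b c d e * in₃ a b c
        f₂ a b c d e = A₅ a b c d e * in₃ a b d
        f₃ a b c d e = A₅ a b c d e * in₃ a b e
        f₄ a b c d e = A₅ a b c d e * in₃ a c d
        f₅ a b c d e = A₅ a b c d e * in₃ a c e
        f₆ a b c d e = A₅ a b c d e * in₃ a d e
        f₇ a b c d e = A₅ a b c d e * in₃ b c d
        f₈ a b c d e = A₅ a b c d e * in₃ b c e
        f₉ a b c d e = A₅ a b c d e * in₃ b d e
        f₁₀ a b c d e = A₅ a b c d e * in₃ c d e
        bde : ∑⁵′ f₉ ≤ B
        bde = ≤-trans (≤-reflexive (swap-bc (λ a b c d e → in₃ c d e))) cde≤
        bce : ∑⁵′ f₈ ≤ B
        bce = ≤-trans (≤-reflexive (swap-cd (λ a b c d e → in₃ b d e))) bde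
        bcd : ∑⁵′ f₇ ≤ B
        bcd = ≤-trans (≤-reflexive (swap-de (λ a b c d e → in₃ b c e))) bce
        ade : ∑⁵′ f₆ ≤ B
        ade = ≤-trans (≤-reflexive (swap-ab (λ a b c d e → in₃ b d e))) bde
        ace : ∑⁵′ f₅ ≤ B
        ace = ≤-trans (≤-reflexive (swap-cd (λ a b c d e → in₃ a d e))) ade
        acd : ∑⁵′ f₄ ≤ B
        acd = ≤-trans (≤-reflexive (swap-de (λ a b c d e → in₃ a c e))) ace
        abe : ∑⁵′ f₃ ≤ B
        abe = ≤-trans (≤-reflexive (swap-bc (λ a b c d e → in₃ a c e))) ace
        abd : ∑⁵′ f₂ ≤ B
        abd = ≤-trans (≤-reflexive (swap-de (λ a b c d e → in₃ a b e))) abe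
        abc : ∑⁵′ f₁ ≤ B
        abc = ≤-trans (≤-reflexive (swap-cd (λ a b c d e → in₃ a b d))) abd
        -- Union bound: triples that all belonged to τ either all survive, or some one of them lies
        -- inside X.
        pointwise : ∀ ts → ⟦ all (onTriple τ) ts ⟧ ≤ ⟦ all (onTriple (avoiding τ X)) ts ⟧ + ∑ ts in₃′
        pointwise []       = ≤-refl
        pointwise ((x , y , z) ∷ ts) with holds τ x y z | member X x ∧ (member X y ∧ member X z)
        ... | false | _     = z≤n
        ... | true  | false = pointwise ts
        ... | true  | true  = ≤-trans (⟦⟧≤1 _) (s≤s z≤n)
        expand : ∀ a b c d e → A₅ a b c d e * (⟦ all (onTriple (avoiding τ X)) (triples (a ∷ b ∷ c ∷ d ∷ e ∷ [])) ⟧ + ∑ (triples (a ∷ b ∷ c ∷ d ∷ e ∷ [])) in₃′)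
          ≡ f₀ a b c d e + (f₁ a b c d e + (f₂ a b c d e + (f₃ a b c d e + (f₄ a b c d e + (f₅ a b c d e + (f₆ a b c d e + (f₇ a b c d e + (f₈ a b c d e + (f₉ a b c d e + f₁₀ a b c d e)))))))))
        expand a b c d e = dist (A₅ a b c d e) _ (in₃ a b c) (in₃ a b d) (in₃ a b e) (in₃ a c d) (in₃ a c e) (in₃ a d e) (in₃ b c d) (in₃ b c e) (in₃ b d e) (in₃ c d e)
          where
            dist : ∀ m p a b c d e f g h i j → m * (p + (a + (b + (c + (d + (e + (f + (g + (h + (i + (j + 0)))))))))))
              ≡ m * p + (m * a + (m * b + (m * c + (m * d + (m * e + (m * f + (m * g + (m * h + (m * i + m * j)))))))))
            dist = solve-∀

-- Covering the triangles of R jointly with a vertex of K.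

module TriangleCovers {n : ℕ} (G : Graph n) where
  open Cliques G
  open TuránBounds G
  open MoonMoserBounds G
  open TriangleSets G

  open Triangles

  triangles : Triangles
  triangles = record
    { holds  = λ x y z → adj x y ∧ (adj x z ∧ adj y z)
    ; swap₁₂ = λ x y z → cong₂ _∧_ (Graph.sym G x y) (∧-comm (adj x z) (adj y z))
    ; swap₂₃ = λ x y z → trans (∧-leftComm (adj x y) (adj x z) (adj y z)) (cong (λ t → adj x z ∧ (adj x y ∧ t)) (Graph.sym G y z))
    ; adj₁₂  = λ {x} {y} h → proj₁ (Equivalence.to (T-∧ {adj x y}) h)
    }

  triangles-intro : ∀ {x y z} → x ~ y → x ~ z → y ~ z → T (holds triangles x y z)
  triangles-intro {x} {y} {z} p q r = Equivalence.from (T-∧ {adj x y}) (p , Equivalence.from (T-∧ {adj x z}) (q , r))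

  total-triangles : ∀ L → total triangles L ≡ K₃ L
  total-triangles L = ∑-cong L λ {x} _ → ∑-cong L λ {y} _ → ∑-cong L λ {z} _ →
    trans (⟦∧⟧ (adj x y) _) (cong (A x y *_) (⟦∧⟧ (adj x z) (adj y z)))

  -- These cliques are responsible for the 4-cliques with three vertices in R and one in K, which is
  -- why coverage involves a vertex v of K besides the triangle.
  record TriangleCover (K R : List V) (τ : Triangles) : Set where
    field
      cliques  : List (List V)
      isClique : All Clique cliques
      covers   : ∀ {x y z v} → x ∈ R → y ∈ R → z ∈ R → T (holds τ x y z) → v ∈ K → v ~ x → v ~ y → v ~ z →
                 Any (λ D → x ∈ D × y ∈ D × z ∈ D × v ∈ D) cliques

  open TriangleCover

  one-by-one : ∀ {K} R τ → Clique K → Σ (TriangleCover K R τ) λ 𝒟 → 6 * length (cliques 𝒟) ≡ total τ R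
  one-by-one {K} R τ cK = record { cliques = map extend alive ; isClique = All.map⁺ (All.tabulate λ {t} h → extend-clique t (proj₂ (∈-sift⁻ (onTriple τ) {triples R} h))) ; covers = cov }
                  , trans (cong (6 *_) (length-map extend alive)) (sym (total≡ τ R))
    where
      alive = sift (onTriple τ) (triples R)
      extend : V × V × V → List V
      extend (x , y , z) = x ∷ y ∷ z ∷ nbrs (x ∷ y ∷ z ∷ []) K
      extend-clique : ∀ t → T (onTriple τ t) → Clique (extend t)
      extend-clique (x , y , z) h = Clique-nbrs (x ∷ y ∷ z ∷ [])
        ((adj₁₂ τ {x} {y} {z} h ∷ adj₁₃ τ {x} {y} {z} h ∷ []) ∷ (adj₂₃ τ {x} {y} {z} h ∷ []) ∷ [] ∷ []) cK
      cov : ∀ {x y z v} → x ∈ R → y ∈ R → z ∈ R → T (holds τ x y z) → v ∈ K → v ~ x → v ~ y → v ~ z →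
            Any (λ D → x ∈ D × y ∈ D × z ∈ D × v ∈ D) (map extend alive)
      cov {x} {y} {z} {v} x∈ y∈ z∈ h v∈ vx vy vz
        -- Each triangle is listed in a single order; the predicate carries the permutation back to
        -- x, y, z.
        with triples-complete (λ a b c → T (holds τ a b c) × (x ∷ y ∷ z ∷ []) ↭ (a ∷ b ∷ c ∷ []))
               (λ { {a} {b} {c} (h , p) → subst T (swap₁₂ τ a b c) h , ↭-trans p (swap a b ↭-refl) })
               (λ { {a} {b} {c} (h , p) → subst T (swap₂₃ τ a b c) h , ↭-trans p (prep a (swap b c ↭-refl)) })
               (λ { {a} {c} (h , _) → ~-irrefl (adj₁₂ τ {a} {a} {c} h) })
               x∈ y∈ z∈ (h , ↭-refl)
      ... | a , b , c , abc∈ , h′ , p = Any.map (λ { refl → mem (here refl) , mem (there (here refl)) , mem (there (there (here refl)))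
                                                         , there (there (there (∈-nbrs⁺ (a ∷ b ∷ c ∷ []) v∈ (All-resp-↭ p (vx ∷ vy ∷ vz ∷ []))))) })
                                          (∈-map⁺ extend (∈-sift⁺ (onTriple τ) abc∈ h′))
        where
          mem : ∀ {u} → u ∈ x ∷ y ∷ z ∷ [] → u ∈ extend (a , b , c)
          mem u∈ = ∈-++⁺ˡ (∈-resp-↭ p u∈)

  A₅-clique : ∀ {a b c d e} → 0 < A₅ a b c d e → Clique (a ∷ b ∷ c ∷ d ∷ e ∷ [])
  A₅-clique {a} {b} {c} {d} {e} h =
    let h₄ , he = 0<* (A₄ a b c d) _ h
        h₃ , hd = 0<* (A₃ a b c) _ h₄
        ab , hc = 0<* (A a b) _ h₃
        ac , bc = 0<* (A a c) _ hc
        ad , hd′ = 0<* (A a d) _ hd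
        bd , cd = 0<* (A b d) _ hd′
        ae , he′ = 0<* (A a e) _ he
        be , he″ = 0<* (A b e) _ he′
        ce , de = 0<* (A c e) _ he″
    in (0<⟦⟧ ab ∷ 0<⟦⟧ ac ∷ 0<⟦⟧ ad ∷ 0<⟦⟧ ae ∷ []) ∷ (0<⟦⟧ bc ∷ 0<⟦⟧ bd ∷ 0<⟦⟧ be ∷ []) ∷ (0<⟦⟧ cd ∷ 0<⟦⟧ ce ∷ []) ∷ (0<⟦⟧ de ∷ []) ∷ [] ∷ []

  record AliveK₅ (τ : Triangles) (R : List V) : Set where
    field
      members : List V
      inside  : members ⊑ R
      clique  : Clique members
      size    : length (triples members) ≡ 10
      alive   : All (T ∘ onTriple τ) (triples members)

  findAlive : ∀ τ R → 0 < quintuples τ R → AliveK₅ τ R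
  findAlive τ R h with ∑-pos R h
  ... | a , a∈ , h₁ with ∑-pos R h₁
  ...   | b , b∈ , h₂ with ∑-pos R h₂
  ...     | c , c∈ , h₃ with ∑-pos R h₃
  ...       | d , d∈ , h₄ with ∑-pos R h₄
  ...         | e , e∈ , h₅ with 0<* (A₅ a b c d e) ⟦ all (onTriple τ) (triples (a ∷ b ∷ c ∷ d ∷ e ∷ [])) ⟧ h₅
  ...           | hA , hτ = record
    { members = a ∷ b ∷ c ∷ d ∷ e ∷ []
    ; inside  = a∈ ∷ b∈ ∷ c∈ ∷ d∈ ∷ e∈ ∷ []
    ; clique  = A₅-clique hA
    ; size    = refl
    ; alive   = All.all⁺ (onTriple τ) _ (0<⟦⟧ hτ)
    }

  ∑³-⊆ : ∀ {X R} (f : V → V → V → ℕ) → Unique X → X ⊑ R →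
         ∑ X (λ x → ∑ X λ y → ∑ X λ z → f x y z) ≤ ∑ R (λ x → ∑ R λ y → ∑ R λ z → f x y z)
  ∑³-⊆ {X} {R} f u i = ≤-trans (∑-mono X λ _ → ≤-trans (∑-mono X λ _ → ∑-⊆ _ u i) (∑-⊆ _ u i)) (∑-⊆ _ u i)

  ∈⇒member : ∀ {X x} → x ∈ X → T (member X x)
  ∈⇒member = fromWitness

  -- Ten triangles of X leave the set, each in six orders; all ten were still in τ because X was
  -- alive.
  total-avoiding : ∀ {τ R} (X : AliveK₅ τ R) → 60 + total (avoiding τ (AliveK₅.members X)) R ≤ total τ R
  total-avoiding {τ} {R} X = begin
    60 + total (avoiding τ X′) R
      ≤⟨ +-monoˡ-≤ (total (avoiding τ X′) R) (begin
           60                              ≡⟨ cong (6 *_) (trans (sym size) (sym (trans (∑-cong (triples X′) (λ h → one (All.lookup alive h))) (trans (∑-const (triples X′) 1) (*-identityʳ _))))) ⟩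
           6 * ∑ (triples X′) (λ (x , y , z) → weight τ x y z) ≡⟨ cong (6 *_) (length-sift (onTriple τ) (triples X′)) ⟨
           6 * length (sift (onTriple τ) (triples X′)) ≡⟨ total≡ τ X′ ⟨
           total τ X′                      ≤⟨ ∑-mono X′ (λ x∈ → ∑-mono X′ λ y∈ → ∑-mono X′ λ z∈ → inside-X x∈ y∈ z∈) ⟩
           ∑ X′ (λ x → ∑ X′ λ y → ∑ X′ λ z → inside-weight x y z) ≤⟨ ∑³-⊆ inside-weight (Clique⇒Unique clique) inside ⟩
           ∑ R (λ x → ∑ R λ y → ∑ R λ z → inside-weight x y z) ∎) ⟩
    ∑ R (λ x → ∑ R λ y → ∑ R λ z → inside-weight x y z) + total (avoiding τ X′) R
      ≡⟨ trans (∑-cong R λ _ → trans (∑-cong R λ _ → ∑-+ R _ _) (∑-+ R _ _)) (∑-+ R _ _) ⟨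
    ∑ R (λ x → ∑ R λ y → ∑ R λ z → inside-weight x y z + weight (avoiding τ X′) x y z)
      ≤⟨ ∑-mono R (λ {x} _ → ∑-mono R λ {y} _ → ∑-mono R λ {z} _ → splits (holds τ x y z) _) ⟩
    total τ R ∎
    where
      open ≤-Reasoning
      open AliveK₅ X renaming (members to X′)
      inside-weight : V → V → V → ℕ
      inside-weight x y z = ⟦ holds τ x y z ∧ (member X′ x ∧ (member X′ y ∧ member X′ z)) ⟧
      splits : ∀ a b → ⟦ a ∧ b ⟧ + ⟦ a ∧ not b ⟧ ≤ ⟦ a ⟧
      splits true  true  = ≤-refl
      splits true  false = ≤-refl
      splits false _     = z≤n
      one : ∀ {b} → T b → ⟦ b ⟧ ≡ 1
      one {true} _ = refl
      absorb : ∀ a {b c d} → T b → T c → T d → ⟦ a ⟧ ≤ ⟦ a ∧ (b ∧ (c ∧ d)) ⟧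
      absorb true  {true} {true} {true} _ _ _ = ≤-refl
      absorb false _ _ _ = z≤n
      inside-X : ∀ {x y z} → x ∈ X′ → y ∈ X′ → z ∈ X′ → weight τ x y z ≤ inside-weight x y z
      inside-X {x} {y} {z} x∈ y∈ z∈ = absorb (holds τ x y z) (∈⇒member x∈) (∈⇒member y∈) (∈⇒member z∈)

  -- The five cliques v + (X ∩ N(v)), v ∈ K, do the work of the ten triangles of X.
  use-K₅ : ∀ {K R τ} (X : AliveK₅ τ R) → TriangleCover K R (avoiding τ (AliveK₅.members X)) → TriangleCover K R τ
  use-K₅ {K} {R} {τ} X 𝒟 = record
    { cliques  = map star K ++ cliques 𝒟
    ; isClique = All.++⁺ (All.map⁺ (All.universal (λ v → Clique-nbrs (v ∷ []) ([] ∷ []) clique) K)) (isClique 𝒟)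
    ; covers   = λ {x} {y} {z} → cov {x} {y} {z}
    }
    where
      open AliveK₅ X renaming (members to X′)
      star : V → List V
      star v = v ∷ nbrs (v ∷ []) X′
      cov : ∀ {x y z v} → x ∈ R → y ∈ R → z ∈ R → T (holds τ x y z) → v ∈ K → v ~ x → v ~ y → v ~ z →
            Any (λ D → x ∈ D × y ∈ D × z ∈ D × v ∈ D) (map star K ++ cliques 𝒟)
      cov {x} {y} {z} {v} x∈ y∈ z∈ h v∈ vx vy vz with T? (member X′ x ∧ (member X′ y ∧ member X′ z))
      ... | yes p = let px , pyz = Equivalence.to (T-∧ {member X′ x}) p
                        py , pz  = Equivalence.to (T-∧ {member X′ y}) pyz
                        leaf : ∀ {u} → T (member X′ u) → v ~ u → u ∈ star v
                        leaf = λ pu vu → there (∈-nbrs⁺ (v ∷ []) (toWitness pu) (~-sym vu ∷ []))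
                    in Any.++⁺ˡ (Any.map (λ { refl → leaf px vx , leaf py vy , leaf pz vz , here refl }) (∈-map⁺ star v∈))
      ... | no ¬p = Any.++⁺ʳ (map star K) (covers 𝒟 x∈ y∈ z∈ (Equivalence.from (T-∧ {holds τ x y z}) (h , T-not⁺ ¬p)) v∈ vx vy vz)

  -- τ holds the triangles still to be covered, `quintuples` counts the ordered K₅ all of whose triangles are in τ;
  -- the first inequality is 6c ≤ total − quintuples / (2 K₂) cleared of its denominator.
  Packing : (K R : List V) → Triangles → Set
  Packing K R τ = Σ (TriangleCover K R τ) λ 𝒟 →
    12 * K₂ R * length (cliques 𝒟) + quintuples τ R ≤ 2 * K₂ R * total τ R × 6 * length (cliques 𝒟) ≤ total τ R

  -- Greedy choice: a K₅ with all ten triangles still to be covered is used while there is one; the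
  -- remaining triangles are then extended singly, when no quintuple is left to account for.
  pack : ∀ {K R} → Clique K → length K ≡ 5 → Unique R → Free 5 R → ∀ τ → Packing K R τ
  pack {K} {R} cK |K|≡5 R! free τ = go (total τ R) τ ≤-refl
    where
      open ≤-Reasoning
      κ = K₂ R
      finish : ∀ τ → quintuples τ R ≡ 0 → Packing K R τ
      finish τ none = 𝒟 , (begin
          12 * κ * length (cliques 𝒟) + quintuples τ R ≡⟨ cong₂ _+_ (lem κ (length (cliques 𝒟))) none ⟩
          2 * κ * (6 * length (cliques 𝒟)) + 0         ≡⟨ +-identityʳ _ ⟩
          2 * κ * (6 * length (cliques 𝒟))             ≡⟨ cong (2 * κ *_) eq ⟩
          2 * κ * total τ R                            ∎) , ≤-reflexive eq
        where
          𝒟 = proj₁ (one-by-one R τ cK)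
          eq = proj₂ (one-by-one R τ cK)
          lem : ∀ k c → 12 * k * c ≡ 2 * k * (6 * c)
          lem = solve-∀
      extend : ∀ {τ} (X : AliveK₅ τ R) → Packing K R (avoiding τ (AliveK₅.members X)) → Packing K R τ
      extend {τ} X (𝒟 , ih , ih₆) = use-K₅ X 𝒟
        , step κ (length (cliques 𝒟)) len ih (Conflicts.conflicts R (AliveK₅.members X) R! free (AliveK₅.clique X) τ) (total-avoiding X)
        , step₆ (length (cliques 𝒟)) len ih₆ (total-avoiding X)
        where
          len : length (cliques (use-K₅ X 𝒟)) ≡ 5 + length (cliques 𝒟)
          len = trans (length-++ (map _ K)) (cong (_+ length (cliques 𝒟)) (trans (length-map _ K) |K|≡5))
          -- The weights balance exactly: five cliques cost 60κ, the destroyed K₅ another 60κ, and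
          -- the sixty ordered triangles removed pay 2κ · 60.
          step : ∀ κ c {c′ q q′ t t′} → c′ ≡ 5 + c → 12 * κ * c + q′ ≤ 2 * κ * t′ → q ≤ q′ + 60 * κ → 60 + t′ ≤ t →
                 12 * κ * c′ + q ≤ 2 * κ * t
          step κ c {q = q} {q′} {t} {t′} refl ih hq ht = begin
            12 * κ * (5 + c) + q             ≤⟨ +-monoʳ-≤ (12 * κ * (5 + c)) hq ⟩
            12 * κ * (5 + c) + (q′ + 60 * κ) ≡⟨ lem₁ κ c q′ ⟩
            12 * κ * c + q′ + 120 * κ        ≤⟨ +-monoˡ-≤ (120 * κ) ih ⟩
            2 * κ * t′ + 120 * κ             ≡⟨ lem₂ κ t′ ⟩
            2 * κ * (60 + t′)                ≤⟨ *-monoʳ-≤ (2 * κ) ht ⟩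
            2 * κ * t                        ∎
            where
              lem₁ : ∀ k c q → 12 * k * (5 + c) + (q + 60 * k) ≡ 12 * k * c + q + 120 * k
              lem₁ = solve-∀
              lem₂ : ∀ k t → 2 * k * t + 120 * k ≡ 2 * k * (60 + t)
              lem₂ = solve-∀
          step₆ : ∀ c {c′ t t′} → c′ ≡ 5 + c → 6 * c ≤ t′ → 60 + t′ ≤ t → 6 * c′ ≤ t
          step₆ c {t′ = t′} refl ih ht = begin
            6 * (5 + c) ≡⟨ *-distribˡ-+ 6 5 c ⟩
            30 + 6 * c  ≤⟨ +-mono-≤ (m≤m+n 30 30) ih ⟩
            60 + t′     ≤⟨ ht ⟩
            _           ∎
      go : ∀ fuel τ → total τ R ≤ fuel → Packing K R τ
      next : ∀ fuel τ → total τ R ≤ fuel → Dec (0 < quintuples τ R) → Packing K R τ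
      descend : ∀ fuel {τ} → total τ R ≤ fuel → AliveK₅ τ R → Packing K R τ
      go fuel τ h = next fuel τ h (0 <? quintuples τ R)
      next fuel τ h (no none)  = finish τ (n≤0⇒n≡0 (≮⇒≥ none))
      next fuel τ h (yes some) = descend fuel h (findAlive τ R some)
      descend zero       h X = contradiction (≤-trans (total-avoiding X) h) λ ()
      -- At least sixty ordered triangles disappear, so the loss of one unit of fuel is safe.
      descend (suc fuel) h X = extend X (go fuel _ (s≤s⁻¹ (≤-trans (s≤s (m≤n+m _ 59)) (≤-trans (total-avoiding X) h))))

  K₅≤quintuples : ∀ R → K₅ R ≤ quintuples triangles R
  K₅≤quintuples R = ∑-mono R λ {a} _ → ∑-mono R λ {b} _ → ∑-mono R λ {c} _ → ∑-mono R λ {d} _ → ∑-mono R λ {e} _ →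
    m≤m*⟦b⟧ (A₅ a b c d e) λ h → All.all⁻ (onTriple triangles)
      (All.map (λ { {x , y , z} (p , q , r) → triangles-intro p q r }) (all-triples (A₅-clique h)))
    where
      m≤m*⟦b⟧ : ∀ m {b} → (0 < m → T b) → m ≤ m * ⟦ b ⟧
      m≤m*⟦b⟧ zero            _ = z≤n
      m≤m*⟦b⟧ (suc m) {true}  _ = ≤-reflexive (sym (*-identityʳ (suc m)))
      m≤m*⟦b⟧ (suc m) {false} h = contradiction (h z<s) λ ()

  packed-cover : ∀ {K R} → Clique K → length K ≡ 5 → Unique R → Free 5 R →
         Σ (TriangleCover K R triangles) λ 𝒟 → 250 * length (cliques 𝒟) ≤ 19 * (length R * length R * length R)
  packed-cover {K} {R} cK s R! free =
    proj₁ packing , packing-count R c free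
      (≤-trans (+-monoʳ-≤ (12 * K₂ R * c) (K₅≤quintuples R)) (subst (λ t → 12 * K₂ R * c + quintuples triangles R ≤ 2 * K₂ R * t) (total-triangles R) (proj₁ (proj₂ packing))))
      (subst (6 * c ≤_) (total-triangles R) (proj₂ (proj₂ packing)))
    where
      packing : Packing K R triangles
      packing = pack cK s R! free triangles
      c = length (cliques (proj₁ packing))

-- Assembling a cover of L from a cover of R.

module FourCliqueCovers {n : ℕ} (G : Graph n) where
  open Cliques G
  open TuránBounds G
  open MoonMoserBounds G
  open TriangleSets G
  open TriangleCovers G

  open Triangles

  record FourCover (L : List V) : Set where
    field
      cliques  : List (List V)
      isClique : All Clique cliques
      covers   : ∀ Q → Clique Q → length Q ≡ 4 → Q ⊑ L → Any (Q ⊑_) cliques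

  open FourCover public

  cost : ∀ {L} → FourCover L → ℕ
  cost 𝒞 = length (cliques 𝒞)

  empty-cover : ∀ {L} → Free 3 L → FourCover L
  empty-cover free = record { cliques = [] ; isClique = [] ; covers = λ Q c s i → contradiction (free Q c i) (subst (λ k → ¬ k ≤ 3) (sym s) λ { (s≤s (s≤s (s≤s ()))) }) }

  Unique-⊆-length : ∀ {X Y : List V} → Unique X → X ⊑ Y → length X ≤ length Y
  Unique-⊆-length {X} {Y} u i = begin
    length X        ≡⟨ *-identityʳ _ ⟨
    length X * 1    ≡⟨ ∑-const X 1 ⟨
    ∑ X (λ _ → 1)   ≤⟨ ∑-⊆ (λ _ → 1) u i ⟩
    ∑ Y (λ _ → 1)   ≡⟨ ∑-const Y 1 ⟩
    length Y * 1    ≡⟨ *-identityʳ _ ⟩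
    length Y        ∎
    where open ≤-Reasoning

  cross : ∀ xs {ys} → Clique (xs ++ ys) → ∀ {x y} → x ∈ xs → y ∈ ys → x ~ y
  cross (_ ∷ xs) (h ∷ _) (here refl) y∈ = All.lookup h (∈-++⁺ʳ xs y∈)
  cross (_ ∷ xs) (_ ∷ c) (there x∈)  y∈ = cross xs c x∈ y∈

  module Assemble {r L} (C : CliqueIn r L) (𝒞 : FourCover (CliqueIn.rest C))
                  (𝒟 : TriangleCover (CliqueIn.members C) (CliqueIn.rest C) triangles) where
    open CliqueIn C renaming (members to K; rest to R; isClique to K-clique)
    open TriangleCover 𝒟 renaming (cliques to triangleCliques; isClique to triangleCliques-clique; covers to triangle-covers)

    -- A vertex of R lies in a 4-clique with three vertices of K only if it has three neighbours
    -- there. Sparing the other vertices their clique makes the bound strict as soon as one of them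
    -- exists.
    triple-joined : V → Bool
    triple-joined w = 3 ≤ᵇ length (nbrs (w ∷ []) K)

    onPair : V × V → Bool
    onPair (x , y) = adj x y

    vertexClique : V → List V
    vertexClique w = w ∷ nbrs (w ∷ []) K

    edgeClique : V × V → List V
    edgeClique (x , y) = x ∷ y ∷ nbrs (x ∷ y ∷ []) K

    vertexCliques edgeCliques all-cliques : List (List V)
    vertexCliques = map vertexClique (sift triple-joined R)
    edgeCliques   = map edgeClique (sift onPair (pairs R))
    all-cliques   = cliques 𝒞 ++ triangleCliques ++ edgeCliques ++ vertexCliques ++ K ∷ []

    assemble : FourCover L
    assemble = record
      { cliques  = all-cliques
      ; isClique = All.++⁺ (isClique 𝒞) (All.++⁺ triangleCliques-clique (All.++⁺ edgeCliques-clique (All.++⁺ vertexCliques-clique (K-clique ∷ []))))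
      ; covers   = λ Q c s i → let QK , QR , p , iK , iR = divide i in
          Any.map (All-resp-↭ p) (cover QK QR (Clique-↭ (↭-sym p) c) (trans (↭-length p) s) iK iR)
      }
      where
        edgeCliques-clique : All Clique edgeCliques
        edgeCliques-clique = All.map⁺ (All.tabulate λ { {x , y} h → Clique-nbrs (x ∷ y ∷ []) ((proj₂ (∈-sift⁻ onPair {pairs R} h) ∷ []) ∷ [] ∷ []) K-clique })
        vertexCliques-clique : All Clique vertexCliques
        vertexCliques-clique = All.map⁺ (All.universal (λ w → Clique-nbrs (w ∷ []) ([] ∷ []) K-clique) (sift triple-joined R))
        divide : ∀ {Q} → Q ⊑ L → ∃₂ λ QK QR → QK ++ QR ↭ Q × QK ⊑ K × QR ⊑ R
        divide []       = [] , [] , ↭-refl , [] , []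
        divide {q ∷ Q} (q∈ ∷ i) with divide i | ∈-++⁻ K (∈-resp-↭ (↭-sym split) q∈)
        ... | QK , QR , p , iK , iR | inj₁ q∈K = q ∷ QK , QR , prep q p , q∈K ∷ iK , iR
        ... | QK , QR , p , iK , iR | inj₂ q∈R = QK , q ∷ QR , ↭-trans (shift q QK QR) (prep q p) , iK , q∈R ∷ iR

        cover : ∀ QK QR → Clique (QK ++ QR) → length (QK ++ QR) ≡ 4 → QK ⊑ K → QR ⊑ R → Any ((QK ++ QR) ⊑_) all-cliques
        cover QK [] c s iK _ = Any.++⁺ʳ (cliques 𝒞) (Any.++⁺ʳ triangleCliques (Any.++⁺ʳ edgeCliques (Any.++⁺ʳ vertexCliques (here (All.++⁺ iK [])))))
        cover QK QR@(w ∷ []) c s iK (w∈ ∷ []) = Any.++⁺ʳ (cliques 𝒞) (Any.++⁺ʳ triangleCliques (Any.++⁺ʳ edgeCliques (Any.++⁺ˡ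
          (Any.map (λ { refl → All.++⁺ (All.map there inNbrs) (here refl ∷ []) })
            (∈-map⁺ vertexClique (∈-sift⁺ triple-joined w∈ (≤⇒≤ᵇ (≤-trans (≤-reflexive (sym s₃)) (Unique-⊆-length (Clique⇒Unique (dropʳ QK c)) inNbrs)))))))))
          where
            inNbrs : QK ⊑ nbrs QR K
            inNbrs = All.tabulate λ h → ∈-nbrs⁺ QR (All.lookup iK h) (All.tabulate (cross QK c h))
            s₃ : length QK ≡ 3
            s₃ = suc-injective (trans (+-comm 1 (length QK)) (trans (sym (length-++ QK)) s))
        cover QK QR@(x ∷ y ∷ []) c s iK (x∈ ∷ y∈ ∷ []) = go (dropˡ QK c)
          where
            go : Clique QR → Any ((QK ++ QR) ⊑_) all-cliques
            go ((xy ∷ []) ∷ _) with pairs-complete (λ a b → a ~ b × QR ↭ (a ∷ b ∷ [])) (λ { {a} {b} (h , p) → ~-sym h , ↭-trans p (swap a b ↭-refl) }) (~-irrefl ∘ proj₁) x∈ y∈ (xy , ↭-refl)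
            ... | a , b , ab∈ , ab , p = Any.++⁺ʳ (cliques 𝒞) (Any.++⁺ʳ triangleCliques (Any.++⁺ˡ
                  (Any.map (λ { refl → All.++⁺ (All.tabulate λ h → there (there (∈-nbrs⁺ (a ∷ b ∷ []) (All.lookup iK h) (All-resp-↭ p (All.tabulate (cross QK c h))))))
                                                (All.tabulate λ h → ∈-++⁺ˡ (∈-resp-↭ p h)) })
                    (∈-map⁺ edgeClique (∈-sift⁺ onPair ab∈ ab)))))
        cover (v ∷ []) (x ∷ y ∷ z ∷ []) ((vx ∷ vy ∷ vz ∷ []) ∷ (xy ∷ xz ∷ []) ∷ (yz ∷ []) ∷ _) s (v∈ ∷ []) (x∈ ∷ y∈ ∷ z∈ ∷ []) =
          Any.++⁺ʳ (cliques 𝒞) (Any.++⁺ˡ (Any.map (λ (px , py , pz , pv) → pv ∷ px ∷ py ∷ pz ∷ [])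
            (triangle-covers x∈ y∈ z∈ (triangles-intro xy xz yz) v∈ vx vy vz)))
        cover [] QR c s _ iR = Any.++⁺ˡ (covers 𝒞 QR c s iR)
        -- Two vertices in K and three in R would already be five.
        cover (_ ∷ _ ∷ QK) (_ ∷ _ ∷ _ ∷ QR) c s _ _ = contradiction (trans (sym (cong (2 +_) (length-++ QK))) s) (lem (length QK) (length QR))
          where lem : ∀ a b → 2 + (a + (3 + b)) ≢ 4
                lem a b eq = contradiction (subst (3 ≤_) (suc-injective (suc-injective eq)) (≤-trans (m≤m+n 3 b) (m≤n+m (3 + b) a))) λ { (s≤s (s≤s ())) }
        cover (_ ∷ []) (_ ∷ _ ∷ _ ∷ _ ∷ QR) c () _ _

    joined : ℕ
    joined = length (sift triple-joined R)

    cost-assemble : cost assemble ≡ cost 𝒞 + (length triangleCliques + k₂ R + joined + 1)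
    cost-assemble = trans (length-++ (cliques 𝒞)) (cong (cost 𝒞 +_)
      (trans (length-++ triangleCliques) (trans (cong (length triangleCliques +_)
        (trans (length-++ edgeCliques) (cong₂ _+_ (trans (length-map edgeClique (sift onPair (pairs R))) (length-sift onPair (pairs R)))
          (trans (length-++ vertexCliques) (cong (_+ 1) (length-map vertexClique (sift triple-joined R)))))))
        (lem (length triangleCliques) (k₂ R) joined))))
      where lem : ∀ a b c → a + (b + (c + 1)) ≡ a + b + c + 1
            lem a b c = trans (sym (+-assoc a b (c + 1))) (sym (+-assoc (a + b) c 1))

    joined≤ : joined ≤ length R
    joined≤ = length-filter (T? ∘ triple-joined) R

-- The equality case: round-robin enumerations.

module Extremal {n : ℕ} (G : Graph n) where
  open Cliques G
  open TuránBounds G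
  open MoonMoserBounds G
  open TriangleSets G
  open TriangleCovers G
  open FourCliqueCovers G

  open Triangles

  Unique-↭ : ∀ {X Y : List V} → X ↭ Y → Unique X → Unique Y
  Unique-↭ p = PermSetoid.Unique-resp-↭ (setoid V) (↭⇒↭ₛ p)

  -- Adjacency of T(n,4) read off the positions. It depends on positions modulo 4 only, so four
  -- vertices can be prepended without disturbing the old ones.
  RoundRobin : List V → Set
  RoundRobin ℓ = ∀ i j → adj (lookup ℓ i) (lookup ℓ j) ≡ not ⌊ toℕ i % 4 ≟ toℕ j % 4 ⌋

  Tight : List V → Set
  Tight L = ∃ λ ℓ → ℓ ↭ L × RoundRobin ℓ

  Clique-RoundRobin : ∀ {ℓ} → Clique ℓ → length ℓ ≤ 4 → RoundRobin ℓ
  Clique-RoundRobin {ℓ} c s i j with i ≟ᵥ j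
  ... | yes refl = trans (irrefl G (lookup ℓ i)) (sym (≡⇒not-≟ {toℕ i % 4} refl))
  ... | no  i≢j  = trans (T⇒≡true (lookup-adj c i j i≢j)) (sym (≢⇒not-≟ λ eq → i≢j (toℕ-injective
          (trans (sym (small i)) (trans eq (small j))))))
    where
      small : ∀ k → toℕ k % 4 ≡ toℕ k
      small k = m<n⇒m%n≡m (≤-trans (toℕ<n k) s)
      lookup-adj : ∀ {ℓ} → Clique ℓ → ∀ i j → i ≢ j → lookup ℓ i ~ lookup ℓ j
      lookup-adj (h ∷ c) zero    zero    ne = contradiction refl ne
      lookup-adj {_ ∷ ℓ} (h ∷ c) zero    (suc j) _  = All.lookup h (∈-lookup j)
      lookup-adj {_ ∷ ℓ} (h ∷ c) (suc i) zero    _  = ~-sym (All.lookup h (∈-lookup i))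
      lookup-adj (h ∷ c) (suc i) (suc j) ne = lookup-adj c i j (ne ∘ cong suc)

  module TightStep {L} (free : Free 4 L) (C : CliqueIn 4 L)
    (joined : All (λ w → 3 ≤ length (nbrs (w ∷ []) (CliqueIn.members C))) (CliqueIn.rest C)) where
    open CliqueIn C renaming (members to K; rest to R; isClique to K-clique)

    Missed : V → V → Set
    Missed w v = v ∈ K × ¬ v ~ w × (∀ {u} → u ∈ K → u ≢ v → u ~ w)

    private
      joins : V → V → Bool
      joins w v = all (adj v) (w ∷ [])

      -- The default w serves totality: for w in R, `missed-spec` finds exactly one non-neighbour in
      -- K.
      head-or : V → List V → V
      head-or w []      = w
      head-or _ (v ∷ _) = v


    missed : V → V
    missed w = head-or w (sift (not ∘ joins w) K)

    -- At least three neighbours in K by `joined`, and at most three since a fourth would give a K₅: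
    -- of the four vertices of K exactly one is missed.
    missed-spec : ∀ {w} → w ∈ R → Missed w (missed w)
    missed-spec {w} w∈ = go (sift (not ∘ joins w) K) refl
      where
        len : length (nbrs (w ∷ []) K) + length (sift (not ∘ joins w) K) ≡ 4
        len = trans (sym (length-++ (nbrs (w ∷ []) K))) (trans (↭-length (sift-split (joins w) K)) size)
        nbrs≤3 : length (nbrs (w ∷ []) K) ≤ 3
        nbrs≤3 = s≤s⁻¹ (nbrs-bound (w ∷ []) free ([] ∷ []) (All.lookup rest⊑ w∈ ∷ []) K-clique members⊑)
        go : ∀ N → sift (not ∘ joins w) K ≡ N → Missed w (head-or w N)
        go [] eq = contradiction (≤-trans (≤-reflexive (trans (sym len) (trans (cong (λ N → length (nbrs (w ∷ []) K) + length N) eq) (+-identityʳ _)))) nbrs≤3) λ { (s≤s (s≤s (s≤s ()))) }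
        go (v ∷ _ ∷ N) eq = contradiction (≤-trans (+-mono-≤ (All.lookup joined w∈) (s≤s (s≤s (z≤n {length N})))) (≤-reflexive (trans (cong (λ N → length (nbrs (w ∷ []) K) + length N) (sym eq)) len)))
                              λ { (s≤s (s≤s (s≤s (s≤s ())))) }
        go (v ∷ []) eq = proj₁ v-spec , (λ vw → T-not⁻ (proj₂ v-spec) (Equivalence.from (T-∧ {adj v w}) (vw , tt))) , others
          where
            v-spec : v ∈ K × T (not (joins w v))
            v-spec = ∈-sift⁻ (not ∘ joins w) {K} (subst (v ∈_) (sym eq) (here refl))
            others : ∀ {u} → u ∈ K → u ≢ v → u ~ w
            others {u} u∈ u≢v with T? (adj u w)
            ... | yes h = h
            ... | no  h with subst (u ∈_) eq (∈-sift⁺ (not ∘ joins w) u∈ (T-not⁺ (h ∘ proj₁ ∘ Equivalence.to (T-∧ {adj u w}))))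
            ...   | here u≡v = contradiction u≡v u≢v

    -- If adjacent w and w′ missed the same vertex of K, they would share the other three as
    -- neighbours and form a K₅ with them.
    missed-distinct : ∀ {w w′} → w ∈ R → w′ ∈ R → w ~ w′ → missed w ≢ missed w′
    missed-distinct {w} {w′} w∈ w′∈ h eq = contradiction
      (≤-trans (+-monoʳ-≤ 2 (≤-trans (All.lookup joined w∈) (Unique-⊆-length (AllPairs.filter⁺ _ (Clique⇒Unique K-clique)) common)))
               (nbrs-bound (w ∷ w′ ∷ []) free ((h ∷ []) ∷ [] ∷ []) (All.lookup rest⊑ w∈ ∷ All.lookup rest⊑ w′∈ ∷ []) K-clique members⊑))
      λ { (s≤s (s≤s (s≤s (s≤s ())))) }
      where
        common : nbrs (w ∷ []) K ⊑ nbrs (w ∷ w′ ∷ []) K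
        common = All.tabulate λ {u} u∈ → let u∈K , uw = ∈-nbrs⁻ (w ∷ []) {K} u∈ in
          ∈-nbrs⁺ (w ∷ w′ ∷ []) u∈K (All.head uw ∷ proj₂ (proj₂ (missed-spec w′∈)) u∈K
            (λ u≡ → proj₁ (proj₂ (missed-spec w∈)) (subst (_~ w) (trans u≡ (sym eq)) (All.head uw))) ∷ [])

    pick : V → V → V → V → ℕ → V
    pick a b c d 0 = a
    pick a b c d 1 = b
    pick a b c d 2 = c
    pick a b c d _ = d

    record Order (ℓ : List V) : Set where
      field
        a b c d : V
        perm    : a ∷ b ∷ c ∷ d ∷ [] ↭ K
        matches : ∀ j → missed (lookup ℓ j) ≡ pick a b c d (toℕ j % 4)

    -- The first four entries of ℓ are pairwise adjacent, so they miss four distinct vertices, which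
    -- exhaust K and fix its order. With fewer than four entries the missed vertices are completed
    -- to K arbitrarily.
    order : ∀ ℓ → ℓ ⊑ R → RoundRobin ℓ → Order ℓ
    order [] _ _ = go K size refl
      where
        go : ∀ K′ → length K′ ≡ 4 → K′ ≡ K → Order []
        go (a ∷ b ∷ c ∷ d ∷ []) _ refl = record { perm = ↭-refl ; matches = λ () }
    order (w₀ ∷ []) (h₀ ∷ []) rr = go (extend-↭ ([] ∷ []) (proj₁ (missed-spec h₀) ∷ []))
      where
        go : (∃ λ Q → missed w₀ ∷ Q ↭ K) → Order (w₀ ∷ [])
        go (Q , p) with Q | p | trans (↭-length p) size
        ... | b ∷ c ∷ d ∷ [] | p′ | _ = record { perm = p′ ; matches = λ { zero → refl } }
    order (w₀ ∷ w₁ ∷ []) (h₀ ∷ h₁ ∷ []) rr = go (extend-↭ ((ne ∷ []) ∷ [] ∷ []) (proj₁ (missed-spec h₀) ∷ proj₁ (missed-spec h₁) ∷ []))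
      where
        ne : missed w₀ ≢ missed w₁
        ne = missed-distinct h₀ h₁ (subst T (sym (rr zero (suc zero))) tt)
        go : (∃ λ Q → missed w₀ ∷ missed w₁ ∷ Q ↭ K) → Order (w₀ ∷ w₁ ∷ [])
        go (Q , p) with Q | p | trans (↭-length p) size
        ... | c ∷ d ∷ [] | p′ | _ = record { perm = p′ ; matches = λ { zero → refl ; (suc zero) → refl } }
    order (w₀ ∷ w₁ ∷ w₂ ∷ []) (h₀ ∷ h₁ ∷ h₂ ∷ []) rr =
        go (extend-↭ ((ne₀₁ ∷ ne₀₂ ∷ []) ∷ (ne₁₂ ∷ []) ∷ [] ∷ []) (proj₁ (missed-spec h₀) ∷ proj₁ (missed-spec h₁) ∷ proj₁ (missed-spec h₂) ∷ []))
      where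
        ne₀₁ : missed w₀ ≢ missed w₁
        ne₀₁ = missed-distinct h₀ h₁ (subst T (sym (rr zero (suc zero))) tt)
        ne₀₂ : missed w₀ ≢ missed w₂
        ne₀₂ = missed-distinct h₀ h₂ (subst T (sym (rr zero (suc (suc zero)))) tt)
        ne₁₂ : missed w₁ ≢ missed w₂
        ne₁₂ = missed-distinct h₁ h₂ (subst T (sym (rr (suc zero) (suc (suc zero)))) tt)
        go : (∃ λ Q → missed w₀ ∷ missed w₁ ∷ missed w₂ ∷ Q ↭ K) → Order (w₀ ∷ w₁ ∷ w₂ ∷ [])
        go (Q , p) with Q | p | trans (↭-length p) size
        ... | d ∷ [] | p′ | _ = record { perm = p′ ; matches = λ { zero → refl ; (suc zero) → refl ; (suc (suc zero)) → refl } }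
    order ℓ@(w₀ ∷ w₁ ∷ w₂ ∷ w₃ ∷ ℓ′) i@(h₀ ∷ h₁ ∷ h₂ ∷ h₃ ∷ _) rr =
        go (extend-↭ ((ne i₀ i₁ ∷ ne i₀ i₂ ∷ ne i₀ i₃ ∷ []) ∷ (ne i₁ i₂ ∷ ne i₁ i₃ ∷ []) ∷ (ne i₂ i₃ ∷ []) ∷ [] ∷ [])
                     (proj₁ (missed-spec h₀) ∷ proj₁ (missed-spec h₁) ∷ proj₁ (missed-spec h₂) ∷ proj₁ (missed-spec h₃) ∷ []))
      where
        i₀ i₁ i₂ i₃ : Fin (length ℓ)
        i₀ = zero
        i₁ = suc zero
        i₂ = suc (suc zero)
        i₃ = suc (suc (suc zero))
        ne : ∀ i j {h : T (not ⌊ toℕ i % 4 ≟ toℕ j % 4 ⌋)} → missed (lookup ℓ i) ≢ missed (lookup ℓ j)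
        ne i′ j {h} = missed-distinct (All.lookup i (∈-lookup i′)) (All.lookup i (∈-lookup j)) (subst T (sym (rr i′ j)) h)
        -- Contrapositive of `missed-distinct`: entries in different residue classes are adjacent,
        -- so a common missed vertex forces equal residues.
        same : ∀ i j → missed (lookup ℓ i) ≡ missed (lookup ℓ j) → toℕ i % 4 ≡ toℕ j % 4
        same i j eq with toℕ i % 4 ≟ toℕ j % 4 | ne i j
        ... | yes p | _ = p
        ... | no  _ | f = contradiction eq (f {tt})
        go : (∃ λ Q → missed w₀ ∷ missed w₁ ∷ missed w₂ ∷ missed w₃ ∷ Q ↭ K) → Order ℓ
        go (Q , p) with Q | p | trans (↭-length p) size
        ... | [] | p′ | _ = record { perm = p′ ; matches = matches }
          where
            matches : ∀ j → missed (lookup ℓ j) ≡ pick (missed w₀) (missed w₁) (missed w₂) (missed w₃) (toℕ j % 4)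
            matches j with ∈-resp-↭ (↭-sym p′) (proj₁ (missed-spec (All.lookup i (∈-lookup j))))
            ... | here eq                         = trans eq (cong (pick _ _ _ _) (sym (same j i₀ eq)))
            ... | there (here eq)                 = trans eq (cong (pick _ _ _ _) (sym (same j i₁ eq)))
            ... | there (there (here eq))         = trans eq (cong (pick _ _ _ _) (sym (same j i₂ eq)))
            ... | there (there (there (here eq))) = trans eq (cong (pick _ _ _ _) (sym (same j i₃ eq)))
            ... | there (there (there (there ())))

    tight-step : Tight R → Tight L
    tight-step (ℓ , ℓ↭R , rr) = prefix ++ ℓ , ↭-trans (++⁺ perm ℓ↭R) split , rr′
      where
        ℓ⊑R : ℓ ⊑ R
        ℓ⊑R = All.tabulate (∈-resp-↭ ℓ↭R)
        open Order (order ℓ ℓ⊑R rr)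
        prefix = a ∷ b ∷ c ∷ d ∷ []
        v = pick a b c d
        v∈K : ∀ k → v k ∈ K
        v∈K k = ∈-resp-↭ perm (inside k)
          where
            inside : ∀ k → v k ∈ prefix
            inside 0 = here refl
            inside 1 = there (here refl)
            inside 2 = there (there (here refl))
            inside (suc (suc (suc _))) = there (there (there (here refl)))
        prefix-rr : RoundRobin prefix
        prefix-rr = Clique-RoundRobin (Clique-↭ (↭-sym perm) K-clique) ≤-refl
        Small : ℕ → Set
        Small k = Σ (Fin 4) λ i → toℕ i ≡ k × lookup prefix i ≡ v k
        -- An index is either below 4, and names a vertex of K, or of the form 4 + j, whose residue
        -- computes to that of j.
        at : ∀ i → Small (toℕ i % 4) × lookup (prefix ++ ℓ) i ≡ v (toℕ i % 4) ⊎ (∃ λ j → toℕ i % 4 ≡ toℕ j % 4 × lookup (prefix ++ ℓ) i ≡ lookup ℓ j)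
        at zero                         = inj₁ ((zero , refl , refl) , refl)
        at (suc zero)                   = inj₁ ((suc zero , refl , refl) , refl)
        at (suc (suc zero))             = inj₁ ((suc (suc zero) , refl , refl) , refl)
        at (suc (suc (suc zero)))       = inj₁ ((suc (suc (suc zero)) , refl , refl) , refl)
        at (suc (suc (suc (suc j))))    = inj₂ (j , refl , refl)
        small% : ∀ (i : Fin 4) → toℕ i % 4 ≡ toℕ i
        small% i = m<n⇒m%n≡m (toℕ<n i)
        v-v : ∀ {k l} → Small k → Small l → adj (v k) (v l) ≡ not ⌊ k ≟ l ⌋
        v-v (i , refl , p) (j , refl , q) = trans (sym (cong₂ adj p q)) (trans (prefix-rr i j) (cong₂ (λ k l → not ⌊ k ≟ l ⌋) (small% i) (small% j)))
        smalls : ∀ k → k < 4 → Small k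
        smalls 0 _ = zero , refl , refl
        smalls 1 _ = suc zero , refl , refl
        smalls 2 _ = suc (suc zero) , refl , refl
        smalls 3 _ = suc (suc (suc zero)) , refl , refl
        smalls (suc (suc (suc (suc _)))) (s≤s (s≤s (s≤s (s≤s ()))))
        v-w : ∀ {k} → Small k → ∀ j → adj (v k) (lookup ℓ j) ≡ not ⌊ k ≟ toℕ j % 4 ⌋
        v-w {k} sk j with k ≟ toℕ j % 4
        ... | yes refl = ¬T⇒≡false (subst (λ u → ¬ u ~ lookup ℓ j) (matches j) (proj₁ (proj₂ (missed-spec w∈))))
          where w∈ = All.lookup ℓ⊑R (∈-lookup j)
        ... | no  k≢   = T⇒≡true (proj₂ (proj₂ (missed-spec w∈)) (v∈K k) (λ eq → v≢ (trans eq (matches j))))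
          where
            w∈ = All.lookup ℓ⊑R (∈-lookup j)
            sl : Small (toℕ j % 4)
            sl = smalls (toℕ j % 4) (m%n<n (toℕ j) 4)
            v≢ : v k ≢ v (toℕ j % 4)
            v≢ eq = ~-irrefl {v k} (subst T (sym (trans (cong (adj (v k)) eq) (trans (v-v sk sl) (≢⇒not-≟ k≢)))) tt)
        rr′ : RoundRobin (prefix ++ ℓ)
        rr′ i j with at i | at j
        ... | inj₁ (si , p)       | inj₁ (sj , q)       = trans (cong₂ adj p q) (v-v si sj)
        ... | inj₁ (si , p)       | inj₂ (j′ , ej , q)  = trans (cong₂ adj p q) (trans (v-w si j′) (cong (λ l → not ⌊ toℕ i % 4 ≟ l ⌋) (sym ej)))
        ... | inj₂ (i′ , ei , p)  | inj₁ (sj , q)       = trans (cong₂ adj p q) (trans (Graph.sym G _ _) (trans (v-w sj i′)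
                                                            (trans (cong (λ l → not ⌊ toℕ j % 4 ≟ l ⌋) (sym ei)) (not-≟-comm (toℕ j % 4) (toℕ i % 4)))))
          where
            not-≟-comm : ∀ k l → not ⌊ k ≟ l ⌋ ≡ not ⌊ l ≟ k ⌋
            not-≟-comm k l with k ≟ l
            ... | yes refl = sym (≡⇒not-≟ {k} refl)
            ... | no  h    = sym (≢⇒not-≟ (h ∘ sym))
        ... | inj₂ (i′ , ei , p)  | inj₂ (j′ , ej , q)  = trans (cong₂ adj p q) (trans (rr i′ j′) (cong₂ (λ k l → not ⌊ k ≟ l ⌋) (sym ei) (sym ej)))

-- The induction for the upper bound.

module UpperBound {n : ℕ} (G : Graph n) where
  open Cliques G
  open TuránBounds G
  open MoonMoserBounds G
  open TriangleSets G
  open TriangleCovers G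
  open FourCliqueCovers G
  open Extremal G

  open CliqueIn
  open TriangleCover

  -- Strictness or structure, so that the equality case travels with the induction. Fewer than four
  -- vertices are a separate alternative: there `turán₄` is 0 and equality says nothing about
  -- adjacency.
  Result : List V → Set
  Result L = Σ (FourCover L) λ 𝒞 →
    cost 𝒞 < turán₄ (length L) ⊎ (cost 𝒞 ≤ turán₄ (length L) × (length L < 4 ⊎ Tight L))

  cost≤ : ∀ {L} ((𝒞 , _) : Result L) → cost 𝒞 ≤ turán₄ (length L)
  cost≤ (𝒞 , inj₁ h)       = <⇒≤ h
  cost≤ (𝒞 , inj₂ (h , _)) = h

  length-one-by-one : ∀ {K} R (cK : Clique K) → length (cliques (proj₁ (one-by-one R triangles cK))) ≡ k₃ R
  length-one-by-one R cK = *-cancelˡ-≡ _ _ 6 (trans (proj₂ (one-by-one R triangles cK)) (trans (total-triangles R) (K₃≡6k₃ R)))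

  -- Without 4-cliques the empty cover works, and it is strictly below `turán₄` from four vertices
  -- on.
  small-result : ∀ {L} → Free 3 L → Result L
  small-result {L} free with 4 ≤? length L
  ... | yes h = empty-cover free , inj₁ (subst (λ k → 0 < turán₄ k) (m+[n∸m]≡n h) (turán₄-pos (length L ∸ 4)))
  ... | no  h = empty-cover free , inj₂ (z≤n , inj₁ (≰⇒> h))

  k₂-bound : ∀ r R → Free r R → r * (2 * k₂ R) ≤ (r ∸ 1) * (length R * length R)
  k₂-bound r R free = subst (λ k → r * k ≤ (r ∸ 1) * (length R * length R)) (K₂≡2k₂ R) (proj₁ (Turán-bounds r R free))

  k₃-bound : ∀ r R → Free r R → r * r * (6 * k₃ R) ≤ (r ∸ 1) * (r ∸ 2) * (length R * length R * length R)
  k₃-bound r R free = subst (λ k → r * r * k ≤ (r ∸ 1) * (r ∸ 2) * (length R * length R * length R)) (K₃≡6k₃ R) (proj₂ (Turán-bounds r R free))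

  strict-result : ∀ {r L} (C : CliqueIn r L) ((𝒞 , _) : Result (rest C)) (𝒟 : TriangleCover (members C) (rest C) triangles) →
    turán₄ (length (rest C)) + (length (cliques 𝒟) + k₂ (rest C) + length (rest C) + 1) < turán₄ (length (rest C) + r) → Result L
  strict-result {r} {L} C res@(𝒞 , _) 𝒟 h = assemble , inj₁ (begin-strict
    cost assemble
      ≡⟨ cost-assemble ⟩
    cost 𝒞 + (length (cliques 𝒟) + k₂ R + joined + 1)
      ≤⟨ +-mono-≤ (cost≤ res) (+-monoˡ-≤ 1 (+-monoʳ-≤ (length (cliques 𝒟) + k₂ R) joined≤)) ⟩
    turán₄ (length R) + (length (cliques 𝒟) + k₂ R + length R + 1)
      <⟨ h ⟩
    turán₄ (length R + r)
      ≡⟨ cong turán₄ (trans (+-comm (length R) r) (sym (length-split C))) ⟩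
    turán₄ (length L) ∎)
    where
      open ≤-Reasoning
      open Assemble C 𝒞 𝒟
      R = rest C

  five-result : ∀ {L} → Free 5 L → Unique L → (C : CliqueIn 5 L) → Result (rest C) → Result L
  five-result {L} free L! C res = strict-result C res 𝒟 (gap-5 (length R) (k₂ R) (length (cliques 𝒟))
      (*-cancelˡ-≤ 2 (begin
        2 * (5 * k₂ R)               ≡⟨ lem (k₂ R) ⟩
        5 * (2 * k₂ R)               ≤⟨ k₂-bound 5 R freeR ⟩
        4 * (length R * length R)    ≡⟨ *-assoc 2 2 (length R * length R) ⟩
        2 * (2 * (length R * length R)) ∎)) (proj₂ packed))
    where
      open ≤-Reasoning
      R = rest C
      freeR = Free-⊑ (rest⊑ C) free
      packed = packed-cover (isClique C) (size C) (dropˡ (members C) (Unique-↭ (↭-sym (split C)) L!)) freeR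
      𝒟 = proj₁ packed
      lem : ∀ k → 2 * (5 * k) ≡ 5 * (2 * k)
      lem = solve-∀

  big-result : ∀ {L} p → Free (6 + p) L → (C : CliqueIn (6 + p) L) → Result (rest C) → Result L
  big-result {L} p free C res = strict-result C res (proj₁ (one-by-one R triangles (isClique C)))
      (subst (λ c → turán₄ m + (c + k₂ R + m + 1) < turán₄ (m + (6 + p))) (sym (length-one-by-one R (isClique C)))
        (gap-≥6 m p (k₂ R) (k₃ R)
          (*-cancelˡ-≤ (6 + p) (≤-trans (k₂-bound (6 + p) R freeR) (*-monoˡ-≤ (m * m) (n≤1+n (5 + p)))))
          (k₃-bound (6 + p) R freeR)))
    where
      R = rest C
      m = length R
      freeR = Free-⊑ (rest⊑ C) free

  length-pairs : ∀ (R : List V) → length R < 4 → length (pairs R) ≡ turán₂ (length R)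
  length-pairs []                   _ = refl
  length-pairs (_ ∷ [])             _ = refl
  length-pairs (_ ∷ _ ∷ [])         _ = refl
  length-pairs (_ ∷ _ ∷ _ ∷ [])     _ = refl
  length-pairs (_ ∷ _ ∷ _ ∷ _ ∷ _) (s≤s (s≤s (s≤s (s≤s ()))))

  pairs⇒Clique : ∀ R → All (λ (x , y) → x ~ y) (pairs R) → Clique R
  pairs⇒Clique []      _ = []
  pairs⇒Clique (x ∷ R) h = All.map⁻ (All.++⁻ˡ (map (x ,_) R) h) ∷ pairs⇒Clique R (All.++⁻ʳ (map (x ,_) R) h)

  -- The cost is a sum of terms each at most its counterpart for T(m,4), so a deficit in the cover
  -- of R, in the edges or in the joined vertices makes it strict; if there is none, the enumeration
  -- of R extends.
  four-result : ∀ {L} → Free 4 L → (C : CliqueIn 4 L) → Result (rest C) → Result L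
  four-result {L} free C res@(𝒞 , quality) = assemble , verdict
    where
      open ≤-Reasoning
      R = rest C
      m = length R
      𝒟 = proj₁ (one-by-one R triangles (isClique C))
      open Assemble C 𝒞 𝒟
      bounds : k₂ R ≤ turán₂ m × k₃ R ≤ turán₃ m
      bounds = Turán₄-bounds R (Free-⊑ (rest⊑ C) free)

      step : turán₄ m + (turán₃ m + turán₂ m + m + 1) ≡ turán₄ (length L)
      step = trans (sym (turán₄-step m)) (cong turán₄ (sym (length-split C)))

      cost≡ : cost assemble ≡ cost 𝒞 + (k₃ R + k₂ R + joined + 1)
      cost≡ = trans cost-assemble (cong (λ c → cost 𝒞 + (c + k₂ R + joined + 1)) (length-one-by-one R (isClique C)))

      bound : cost assemble ≤ turán₄ (length L)
      bound = begin
        cost assemble                                   ≡⟨ cost≡ ⟩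
        cost 𝒞 + (k₃ R + k₂ R + joined + 1)             ≤⟨ +-mono-≤ (cost≤ res) (+-monoˡ-≤ 1 (+-mono-≤ (+-mono-≤ (proj₂ bounds) (proj₁ bounds)) joined≤)) ⟩
        turán₄ m + (turán₃ m + turán₂ m + m + 1)        ≡⟨ step ⟩
        turán₄ (length L)                               ∎

      strict-𝒞 : cost 𝒞 < turán₄ m → cost assemble < turán₄ (length L)
      strict-𝒞 h = begin-strict
        cost assemble                                   ≡⟨ cost≡ ⟩
        cost 𝒞 + (k₃ R + k₂ R + joined + 1)             <⟨ +-mono-<-≤ h (+-monoˡ-≤ 1 (+-mono-≤ (+-mono-≤ (proj₂ bounds) (proj₁ bounds)) joined≤)) ⟩
        turán₄ m + (turán₃ m + turán₂ m + m + 1)        ≡⟨ step ⟩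
        turán₄ (length L)                               ∎

      strict-k₂ : k₂ R < turán₂ m → cost assemble < turán₄ (length L)
      strict-k₂ h = begin-strict
        cost assemble                                   ≡⟨ cost≡ ⟩
        cost 𝒞 + (k₃ R + k₂ R + joined + 1)             <⟨ +-mono-≤-< (cost≤ res) (+-monoˡ-< 1 (+-mono-<-≤ (+-mono-≤-< (proj₂ bounds) h) joined≤)) ⟩
        turán₄ m + (turán₃ m + turán₂ m + m + 1)        ≡⟨ step ⟩
        turán₄ (length L)                               ∎

      strict-joined : joined < m → cost assemble < turán₄ (length L)
      strict-joined h = begin-strict
        cost assemble                                   ≡⟨ cost≡ ⟩
        cost 𝒞 + (k₃ R + k₂ R + joined + 1)             <⟨ +-mono-≤-< (cost≤ res) (+-monoˡ-< 1 (+-mono-≤-< (+-mono-≤ (proj₂ bounds) (proj₁ bounds)) h)) ⟩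
        turán₄ m + (turán₃ m + turán₂ m + m + 1)        ≡⟨ step ⟩
        turán₄ (length L)                               ∎

      module Joined (all-joined : All (T ∘ triple-joined) R) where
        open TightStep free C (All.map (λ {w} → ≤ᵇ⇒≤ 3 (length (nbrs (w ∷ []) (members C)))) all-joined)

        -- For m < 4 the graph T(m,4) is complete, so a missing edge in R gives strictness through
        -- k₂; otherwise R is a clique and any order of it is round-robin.
        small : m < 4 → cost assemble < turán₄ (length L) ⊎ (cost assemble ≤ turán₄ (length L) × (length L < 4 ⊎ Tight L))
        small m<4 with All.all? (T? ∘ onPair) (pairs R)
        ... | yes h = inj₂ (bound , inj₂ (tight-step (R , ↭-refl , Clique-RoundRobin (pairs⇒Clique R h) (<⇒≤ m<4))))
        ... | no  h = inj₁ (strict-k₂ (begin-strict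
                k₂ R                              ≡⟨ length-sift onPair (pairs R) ⟨
                length (sift onPair (pairs R))    <⟨ filter-notAll (T? ∘ onPair) (pairs R) (All.¬All⇒Any¬ (T? ∘ onPair) (pairs R) h) ⟩
                length (pairs R)                  ≡⟨ length-pairs R m<4 ⟩
                turán₂ m                          ∎))

        conclude : cost 𝒞 < turán₄ m ⊎ (cost 𝒞 ≤ turán₄ m × (m < 4 ⊎ Tight R)) →
                   cost assemble < turán₄ (length L) ⊎ (cost assemble ≤ turán₄ (length L) × (length L < 4 ⊎ Tight L))
        conclude (inj₁ h)                 = inj₁ (strict-𝒞 h)
        conclude (inj₂ (_ , inj₁ m<4))    = small m<4
        conclude (inj₂ (_ , inj₂ tight))  = inj₂ (bound , inj₂ (tight-step tight))

      verdict : cost assemble < turán₄ (length L) ⊎ (cost assemble ≤ turán₄ (length L) × (length L < 4 ⊎ Tight L))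
      verdict with All.all? (T? ∘ triple-joined) R
      ... | yes h = Joined.conclude h quality
      ... | no  h = inj₁ (strict-joined (filter-notAll (T? ∘ triple-joined) R (All.¬All⇒Any¬ (T? ∘ triple-joined) R h)))

  upper : ∀ L → Unique L → Result L
  upper = clique-induction (λ L → Unique L → Result L) (λ _ → small-result λ { [] _ _ → z≤n ; (x ∷ K) _ (() ∷ _) }) step
    where
      step : ∀ {L s} → 1 ≤ s → Free s L → (C : CliqueIn s L) → (Unique (rest C) → Result (rest C)) → Unique L → Result L
      step {L} {s} _ free C ih L! = go s free C (ih (dropˡ (members C) (Unique-↭ (↭-sym (split C)) L!)))
        where
          go : ∀ s → Free s L → (C : CliqueIn s L) → Result (rest C) → Result L
          go 4 free C res = four-result free C res
          go 5 free C res = five-result free L! C res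
          go (suc (suc (suc (suc (suc (suc p)))))) free C res = big-result p free C res
          go 0 free _ _ = small-result λ K c i → ≤-trans (free K c i) z≤n
          go 1 free _ _ = small-result λ K c i → ≤-trans (free K c i) (s≤s z≤n)
          go 2 free _ _ = small-result λ K c i → ≤-trans (free K c i) (s≤s (s≤s z≤n))
          go 3 free _ _ = small-result free

-- From lists to subsets, and existence of the cover number.

-- Writing a labelling of Fin 4 by its four values turns quantification over labelled 4-cliques into
-- quantification over vertices, which is decidable.
quad : ∀ {A : Set} → A → A → A → A → Fin 4 → A
quad a b c d zero                   = a
quad a b c d (suc zero)             = b
quad a b c d (suc (suc zero))       = c
quad a b c d (suc (suc (suc zero))) = d

quad-η : ∀ {A : Set} (f : Fin 4 → A) i → quad (f zero) (f (suc zero)) (f (suc (suc zero))) (f (suc (suc (suc zero)))) i ≡ f i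
quad-η f zero                   = refl
quad-η f (suc zero)             = refl
quad-η f (suc (suc zero))       = refl
quad-η f (suc (suc (suc zero))) = refl

module _ {n : ℕ} (G : Graph n) where
  open Cliques G hiding (V)
  open TriangleSets G using (member; Clique-adj)
  open FourCliqueCovers G using (FourCover; cost)
  open FourCover

  subset : List (Fin n) → Subset n
  subset K = Vec.tabulate (member K)

  ∈⇒∈ₛ : ∀ {K v} → v ∈ K → v ∈ₛ subset K
  ∈⇒∈ₛ {K} {v} h = lookup⇒[]= v (subset K) (trans (lookup∘tabulate (member K) v) (Equivalence.to T-≡ (fromWitness h)))

  ∈ₛ⇒∈ : ∀ {K v} → v ∈ₛ subset K → v ∈ K
  ∈ₛ⇒∈ {K} {v} h = toWitness (Equivalence.from T-≡ (trans (sym (lookup∘tabulate (member K) v)) ([]=⇒lookup h)))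

  subset-cover : (𝒞 : FourCover (allFin n)) → IsCliqueCover 4 G (map subset (cliques 𝒞))
  subset-cover 𝒞 = All.map⁺ (All.map (λ c u v u∈ v∈ u≢v → Clique-adj c (∈ₛ⇒∈ u∈) (∈ₛ⇒∈ v∈) u≢v) (isClique 𝒞))
                 , λ f k → Any.map⁺ (Any.map (λ { (a ∷ b ∷ c ∷ d ∷ []) → λ
                     { zero → ∈⇒∈ₛ a ; (suc zero) → ∈⇒∈ₛ b ; (suc (suc zero)) → ∈⇒∈ₛ c ; (suc (suc (suc zero))) → ∈⇒∈ₛ d } })
                     (covers 𝒞 (map f (allFin 4)) (clique f k) refl (All.universal ∈-allFin _)))
    where
      clique : ∀ f → IsKClique 4 G f → Clique (map f (allFin 4))
      clique f k = (k zero (suc zero) (λ ()) ∷ k zero (suc (suc zero)) (λ ()) ∷ k zero (suc (suc (suc zero))) (λ ()) ∷ [])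
                 ∷ (k (suc zero) (suc (suc zero)) (λ ()) ∷ k (suc zero) (suc (suc (suc zero))) (λ ()) ∷ [])
                 ∷ (k (suc (suc zero)) (suc (suc (suc zero))) (λ ()) ∷ []) ∷ [] ∷ []

  isClique? : ∀ C → Dec (IsClique G C)
  isClique? C = all? λ u → all? λ v → (u ∈ₛ? C) →-dec ((v ∈ₛ? C) →-dec (¬? (u ≟ᵥ v) →-dec T? (Adj G u v)))

  isCliqueCover? : ∀ 𝒞 → Dec (IsCliqueCover 4 G 𝒞)
  isCliqueCover? 𝒞 = All.all? isClique? 𝒞 ×-dec map′ from to
      (all? λ a → all? λ b → all? λ c → all? λ d →
        (all? λ i → all? λ j → ¬? (i ≟ᵥ j) →-dec T? (Adj G (quad a b c d i) (quad a b c d j)))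
        →-dec Any.any? (λ C → all? λ i → quad a b c d i ∈ₛ? C) 𝒞)
    where
      from : (∀ a b c d → IsKClique 4 G (quad a b c d) → Any (quad a b c d ⊆K_) 𝒞) → ∀ f → IsKClique 4 G f → Any (f ⊆K_) 𝒞
      from h f k = Any.map (λ {C} s i → subst (_∈ₛ C) (quad-η f i) (s i))
        (h (f zero) (f (suc zero)) (f (suc (suc zero))) (f (suc (suc (suc zero))))
           (λ i j i≢j → subst₂ (λ u v → T (Adj G u v)) (sym (quad-η f i)) (sym (quad-η f j)) (k i j i≢j)))
      to : (∀ f → IsKClique 4 G f → Any (f ⊆K_) 𝒞) → ∀ a b c d → IsKClique 4 G (quad a b c d) → Any (quad a b c d ⊆K_) 𝒞
      to h a b c d = h (quad a b c d)

  ofLength? : ∀ m {P : List (Subset n) → Set} → (∀ 𝒞 → Dec (P 𝒞)) → Dec (∃ λ 𝒞 → P 𝒞 × length 𝒞 ≡ m)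
  ofLength? zero    P? = map′ (λ p → [] , p , refl) (λ { ([] , p , _) → p }) (P? [])
  ofLength? (suc m) P? = map′ (λ (C , 𝒞 , p , s) → C ∷ 𝒞 , p , cong suc s) (λ { (C ∷ 𝒞 , p , s) → C , 𝒞 , p , suc-injective s })
    (anySubset? λ C → ofLength? m (P? ∘ (C ∷_)))

  -- Sizes are tried upwards from 0, so the first one realised is the minimum; the given cover
  -- bounds the search.
  ccNumber : ∀ 𝒞 → IsCliqueCover 4 G 𝒞 → ∃ λ c → IsCCNumber 4 G c
  ccNumber 𝒞 h = search (length 𝒞) 0 (+-identityʳ _) λ _ _ → z≤n
    where
      search : ∀ fuel m → fuel + m ≡ length 𝒞 → (∀ 𝒞′ → IsCliqueCover 4 G 𝒞′ → m ≤ length 𝒞′) → ∃ λ c → IsCCNumber 4 G c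
      search fuel m eq min with ofLength? m isCliqueCover?
      ... | yes found = m , found , min
      search zero       m eq min | no none = contradiction (𝒞 , h , sym eq) none
      search (suc fuel) m eq min | no none = search fuel (suc m) (trans (+-suc fuel m) eq)
        λ 𝒞′ h′ → ≤∧≢⇒< (min 𝒞′ h′) λ m≡ → none (𝒞′ , h′ , sym m≡)

-- The lower bound by double counting of transversals.

-- Each clique of T(n,4) meets every part at most once, so it contains at most one transversal.
module LowerBound {n : ℕ} (G : Graph n) (G≅T : G ≅ turán n 4) (𝒞 : List (Subset n)) (cover : IsCliqueCover 4 G 𝒞) where
  private
    φ = proj₁ G≅T
    φ-adj = proj₂ G≅T

    ψ : Fin n → Fin n
    ψ = Inverse.from φ

    adj-ψ : ∀ x y → Adj G (ψ x) (ψ y) ≡ not ⌊ toℕ x % 4 ≟ toℕ y % 4 ⌋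
    adj-ψ x y = trans (φ-adj (ψ x) (ψ y)) (cong₂ (turánAdj 4) (Inverse.strictlyInverseˡ φ x) (Inverse.strictlyInverseˡ φ y))

    part : ℕ → List (Fin n)
    part i = sift (λ x → ⌊ toℕ x % 4 ≟ i ⌋) (allFin n)

    ∈-part : ∀ i {x} → x ∈ part i → toℕ x % 4 ≡ i
    ∈-part i h = toWitness (proj₂ (∈-sift⁻ (λ x → ⌊ toℕ x % 4 ≟ i ⌋) {allFin n} h))

    hits : Subset n → Fin n → Bool
    hits C x = ⌊ ψ x ∈ₛ? C ⌋

    hits-≤1 : ∀ {C} → IsClique G C → ∀ i → ∑ (part i) (⟦_⟧ ∘ hits C) ≤ 1
    hits-≤1 {C} clique i = ∑-≤1 (hits C) (AllPairs.filter⁺ _ (allFin⁺ n)) same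
      where
        same : ∀ {x y} → x ∈ part i → y ∈ part i → T (hits C x) → T (hits C y) → x ≡ y
        same {x} {y} x∈ y∈ hx hy with x ≟ᵥ y
        ... | yes p = p
        ... | no  x≢y = contradiction
              (subst T (trans (adj-ψ x y) (≡⇒not-≟ (trans (∈-part i x∈) (sym (∈-part i y∈)))))
                (clique (ψ x) (ψ y) (toWitness hx) (toWitness hy) (λ eq → x≢y (trans (sym (Inverse.strictlyInverseˡ φ x)) (trans (cong (Inverse.to φ) eq) (Inverse.strictlyInverseˡ φ y))))))
              λ ()

    count : Subset n → Fin n → Fin n → Fin n → Fin n → ℕ
    count C a b c d = ⟦ hits C a ⟧ * (⟦ hits C b ⟧ * (⟦ hits C c ⟧ * ⟦ hits C d ⟧))

    -- A transversal consists of pairwise adjacent vertices, so some member of the cover contains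
    -- it.
    covered : ∀ {a b c d} → a ∈ part 0 → b ∈ part 1 → c ∈ part 2 → d ∈ part 3 → 1 ≤ ∑ 𝒞 (λ C → count C a b c d)
    covered {a} {b} {c} {d} a∈ b∈ c∈ d∈ = found (proj₂ cover (ψ ∘ quad a b c d) clique)
      where
        residue : ∀ i → toℕ (quad a b c d i) % 4 ≡ toℕ i
        residue zero                   = ∈-part 0 a∈
        residue (suc zero)             = ∈-part 1 b∈
        residue (suc (suc zero))       = ∈-part 2 c∈
        residue (suc (suc (suc zero))) = ∈-part 3 d∈
        clique : IsKClique 4 G (ψ ∘ quad a b c d)
        clique i j i≢j = subst T (sym (trans (adj-ψ _ _) (≢⇒not-≟ λ eq → i≢j
          (toℕ-injective (trans (sym (residue i)) (trans eq (residue j))))))) tt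
        inside : ∀ {C} x → ψ x ∈ₛ C → 1 ≤ ⟦ hits C x ⟧
        inside {C} x h with ψ x ∈ₛ? C
        ... | yes _ = ≤-refl
        ... | no  f = contradiction h f
        hit : ∀ {C} → (ψ ∘ quad a b c d) ⊆K C → 1 ≤ count C a b c d
        hit s = *-mono-≤ (inside a (s zero)) (*-mono-≤ (inside b (s (suc zero)))
                  (*-mono-≤ (inside c (s (suc (suc zero)))) (inside d (s (suc (suc (suc zero)))))))
        found : ∀ {𝒞} → Any ((ψ ∘ quad a b c d) ⊆K_) 𝒞 → 1 ≤ ∑ 𝒞 (λ C → count C a b c d)
        found {C ∷ 𝒞} (here s)  = ≤-trans (hit s) (m≤m+n _ _)
        found {C ∷ 𝒞} (there h) = ≤-trans (found h) (m≤n+m _ (count C a b c d))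

    ∑⁴ : (Fin n → Fin n → Fin n → Fin n → ℕ) → ℕ
    ∑⁴ f = ∑ (part 0) λ a → ∑ (part 1) λ b → ∑ (part 2) λ c → ∑ (part 3) λ d → f a b c d

    length-part : ∀ i → length (part i) ≡ part-size i n
    length-part i = length-sift _ (allFin n)

    ∑⁴-one : ∑⁴ (λ _ _ _ _ → 1) ≡ turán₄ n
    ∑⁴-one = trans (∑-cong (part 0) λ _ → trans (∑-cong (part 1) λ _ → trans (∑-cong (part 2) λ _ → ∑-const (part 3) 1) (∑-const (part 2) _)) (∑-const (part 1) _))
      (trans (∑-const (part 0) _) (trans (lem (length (part 0)) (length (part 1)) (length (part 2)) (length (part 3)))
        (cong₂ _*_ (cong₂ _*_ (cong₂ _*_ (trans (length-part 0) (part-size₀ n)) (trans (length-part 1) (part-size₁ n))) (trans (length-part 2) (part-size₂ n)))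
                   (trans (length-part 3) (part-size₃ n)))))
      where lem : ∀ a b c d → a * (b * (c * (d * 1))) ≡ a * b * c * d
            lem = solve-∀

    -- The number of transversals inside C factors into the numbers of vertices that C has in the
    -- four parts, each at most 1.
    ∑⁴-count : ∀ {C} → IsClique G C → ∑⁴ (count C) ≤ 1
    ∑⁴-count {C} clique = ≤-trans (≤-reflexive factor)
      (*-mono-≤ (hits-≤1 clique 0) (*-mono-≤ (hits-≤1 clique 1) (*-mono-≤ (hits-≤1 clique 2) (hits-≤1 clique 3))))
      where
        s : ℕ → ℕ
        s i = ∑ (part i) (⟦_⟧ ∘ hits C)
        factor : ∑⁴ (count C) ≡ s 0 * (s 1 * (s 2 * s 3))
        factor = trans (∑-cong (part 0) λ {a} _ → trans (∑-cong (part 1) λ {b} _ → trans (∑-cong (part 2) λ {c} _ →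
                   trans (∑-*ˡ (part 3) ⟦ hits C a ⟧ _) (cong (⟦ hits C a ⟧ *_) (trans (∑-*ˡ (part 3) ⟦ hits C b ⟧ _) (cong (⟦ hits C b ⟧ *_) (∑-*ˡ (part 3) ⟦ hits C c ⟧ _)))))
                   (trans (∑-*ˡ (part 2) ⟦ hits C a ⟧ _) (cong (⟦ hits C a ⟧ *_) (trans (∑-*ˡ (part 2) ⟦ hits C b ⟧ _) (cong (⟦ hits C b ⟧ *_) (∑-*ʳ (part 2) (s 3) _))))))
                   (trans (∑-*ˡ (part 1) ⟦ hits C a ⟧ _) (cong (⟦ hits C a ⟧ *_) (∑-*ʳ (part 1) (s 2 * s 3) _))))
                   (∑-*ʳ (part 0) (s 1 * (s 2 * s 3)) _)

  lower : turán₄ n ≤ length 𝒞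
  lower = begin
    turán₄ n
      ≡⟨ ∑⁴-one ⟨
    ∑⁴ (λ _ _ _ _ → 1)
      ≤⟨ ∑-mono (part 0) (λ a∈ → ∑-mono (part 1) λ b∈ → ∑-mono (part 2) λ c∈ → ∑-mono (part 3) λ d∈ → covered a∈ b∈ c∈ d∈) ⟩
    ∑⁴ (λ a b c d → ∑ 𝒞 (λ C → count C a b c d))
      ≡⟨ trans (∑-cong (part 0) λ _ → trans (∑-cong (part 1) λ _ → trans (∑-cong (part 2) λ _ → ∑-comm (part 3) 𝒞 _) (∑-comm (part 2) 𝒞 _)) (∑-comm (part 1) 𝒞 _)) (∑-comm (part 0) 𝒞 _) ⟩
    ∑ 𝒞 (λ C → ∑⁴ (count C))
      ≤⟨ ∑-≤-const 𝒞 1 (λ C∈ → ∑⁴-count (All.lookup (proj₁ cover) C∈)) ⟩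
    length 𝒞 * 1
      ≡⟨ *-identityʳ _ ⟩
    length 𝒞 ∎
    where open ≤-Reasoning

-- From enumerations to isomorphisms, and the conclusion.

-- A vertex is sent to its position in ℓ: the parts of `turán` are residue classes of positions,
-- which is exactly the round-robin condition.
tight⇒≅ : ∀ {n} (G : Graph n) → Extremal.Tight G (allFin n) → G ≅ turán n 4
tight⇒≅ {n} G (ℓ , ℓ↭ , rr) = mk↔ₛ′ to from to-from from-to , preserves
  where
    len : length ℓ ≡ n
    len = trans (↭-length ℓ↭) (length-tabulate id)
    mem : ∀ u → u ∈ ℓ
    mem u = ∈-resp-↭ (↭-sym ℓ↭) (∈-allFin u)
    ℓ! : Unique ℓ
    ℓ! = Extremal.Unique-↭ G (↭-sym ℓ↭) (allFin⁺ n)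
    at : ∀ u → lookup ℓ (index (mem u)) ≡ u
    at u = sym (Any.lookup-index (mem u))
    to from : Fin n → Fin n
    to u   = cast len (index (mem u))
    from i = lookup ℓ (cast (sym len) i)
    from-to : ∀ u → from (to u) ≡ u
    from-to u = trans (cong (lookup ℓ) (trans (cast-trans len (sym len) (index (mem u))) (cast-is-id refl _))) (at u)
    to-from : ∀ i → to (from i) ≡ i
    to-from i = trans (cong (cast len) (lookup-injective ℓ! _ _ (at (from i)))) (trans (cast-trans (sym len) len i) (cast-is-id refl i))
    preserves : ∀ u v → Adj G u v ≡ turánAdj 4 (to u) (to v)
    preserves u v = trans (sym (cong₂ (Adj G) (at u) (at v))) (trans (rr (index (mem u)) (index (mem v)))
      (sym (cong₂ (λ a b → not ⌊ a % 4 ≟ b % 4 ⌋) (toℕ-cast len _) (toℕ-cast len _))))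

record SmallCover {n} (G : Graph n) : Set where
  field
    cliques : List (Subset n)
    covers  : IsCliqueCover 4 G cliques
    small   : length cliques < turán₄ n ⊎ (length cliques ≤ turán₄ n × (n < 4 ⊎ G ≅ turán n 4))

  small≤ : length cliques ≤ turán₄ n
  small≤ with small
  ... | inj₁ h       = <⇒≤ h
  ... | inj₂ (h , _) = h

smallCover : ∀ {n} (G : Graph n) → UpperBound.Result G (allFin n) → SmallCover G
smallCover {n} G (𝒞 , h) = record
  { cliques = map (subset G) (FourCliqueCovers.FourCover.cliques 𝒞)
  ; covers  = subset-cover G 𝒞
  ; small   = convert (length-map (subset G) (FourCliqueCovers.FourCover.cliques 𝒞)) (length-tabulate id) h
  }
  where
    convert : ∀ {c c′ k} → c′ ≡ c → k ≡ n → c < turán₄ k ⊎ (c ≤ turán₄ k × (k < 4 ⊎ Extremal.Tight G (allFin n))) →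
              c′ < turán₄ n ⊎ (c′ ≤ turán₄ n × (n < 4 ⊎ G ≅ turán n 4))
    convert refl refl (inj₁ h)              = inj₁ h
    convert refl refl (inj₂ (h , inj₁ n<4)) = inj₂ (h , inj₁ n<4)
    convert refl refl (inj₂ (h , inj₂ t))   = inj₂ (h , inj₂ (tight⇒≅ G t))

module _ {n} (n≥4 : n ≥ 4) (G : Graph n) (𝒢 : SmallCover G) (𝒯 : SmallCover (turán n 4)) where
  open SmallCover

  private
    T≅T : turán n 4 ≅ turán n 4
    T≅T = ↔-id _ , λ _ _ → refl

  -- The upper bound is the general one applied to the Turán graph itself; the lower bound is the
  -- count of its transversals.
  turán-ccNumber : IsCCNumber 4 (turán n 4) (turán₄ n)
  turán-ccNumber = (cliques 𝒯 , covers 𝒯 , ≤-antisym (small≤ 𝒯) (LowerBound.lower (turán n 4) T≅T (cliques 𝒯) (covers 𝒯)))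
                 , LowerBound.lower (turán n 4) T≅T

  -- A minimum cover is no larger than the constructed one, so c = `turán₄ n` excludes its strict
  -- alternative and leaves the isomorphism. Conversely, the transversal count transported along an
  -- isomorphism bounds c from below.
  turán-extremal : ∀ {c} → IsCCNumber 4 G c → c ≤ turán₄ n × ((c ≡ turán₄ n) ⇔ (G ≅ turán n 4))
  turán-extremal {c} ((𝒞 , cover , len) , minimal) = c≤ , mk⇔ (equal⇒≅ (small 𝒢))
      λ iso → ≤-antisym c≤ (≤-trans (LowerBound.lower G iso 𝒞 cover) (≤-reflexive len))
    where
      c≤cover : c ≤ length (cliques 𝒢)
      c≤cover = minimal (cliques 𝒢) (covers 𝒢)

      c≤ : c ≤ turán₄ n
      c≤ = ≤-trans c≤cover (small≤ 𝒢)

      equal⇒≅ : length (cliques 𝒢) < turán₄ n ⊎ (length (cliques 𝒢) ≤ turán₄ n × (n < 4 ⊎ G ≅ turán n 4)) → c ≡ turán₄ n → G ≅ turán n 4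
      equal⇒≅ (inj₁ strict)           refl = contradiction (≤-<-trans c≤cover strict) (<-irrefl refl)
      equal⇒≅ (inj₂ (_ , inj₁ n<4))   _    = contradiction n≥4 (<⇒≱ n<4)
      equal⇒≅ (inj₂ (_ , inj₂ iso))   _    = iso

theorem1p1 : ∀ (n : ℕ) → n ≥ 4 → (G : Graph n) →
    Σ ℕ λ c → Σ ℕ λ cT →
    IsCCNumber 4 G c × IsCCNumber 4 (turán n 4) cT ×
    c ≤ cT × ((c ≡ cT) ⇔ (G ≅ turán n 4))
theorem1p1 n n≥4 G =
  let c , cc = ccNumber G (SmallCover.cliques 𝒢) (SmallCover.covers 𝒢)
  in c , turán₄ n , cc , turán-ccNumber n≥4 G 𝒢 𝒯 , turán-extremal n≥4 G 𝒢 𝒯 cc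
  where
    𝒢 : SmallCover G
    𝒢 = smallCover G (UpperBound.upper G (allFin n) (allFin⁺ n))
    𝒯 : SmallCover (turán n 4)
    𝒯 = smallCover (turán n 4) (UpperBound.upper (turán n 4) (allFin n) (allFin⁺ n))
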